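{- For every integer $r \geqslant 1$, $$\mathsf{D}(C^r_n) \sim rn \quad \text{as } n \to +\infty,$$ i.e. $\mathsf{D}(C^r_n)/(rn) \to 1$ as $n \to +\infty$.
   Context: For an integer $n \geqslant 1$, $C_n$ denotes the cyclic group of order $n$ and $C_n^r$ the direct sum of $r$ copies of $C_n$. For a finite Abelian group $G$, a sequence over $G$ is a finite (unordered, repetitions allowed) sequence of elements of $G$; it is zero-sum if the sum of its elements is $0$. The Davenport constant $\mathsf{D}(G)$ is the smallest integer $t \geqslant 1$ such that every sequence over $G$ of length at least $t$ contains a non-empty zero-sum subsequence. -}

module Defs where

open import Data.Nat using (ℕ; _≤_; _+_)
open import Data.Nat.Divisibility using (_∣_)
open import Data.Fin using (Fin; toℕ)
open import Data.List using (List; []; map; length)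
open import Data.Nat.ListAction using (sum)
open import Data.List.Relation.Binary.Sublist.Propositional using (_⊆_)
open import Data.Product using (Σ; _×_)
open import Relation.Binary.PropositionalEquality using (_≢_)

-- An element of C_n^r: an r-tuple of residues mod n (Fin n = ℤ/nℤ).
Elem : ℕ → ℕ → Set
Elem n r = Fin r → Fin n

-- A sequence over C_n^r (a list; order is irrelevant for the notions below).
Seq : ℕ → ℕ → Set
Seq n r = List (Elem n r)

ZeroSum : (n r : ℕ) → Seq n r → Set
ZeroSum n r s = ∀ (i : Fin r) → n ∣ sum (map (λ g → toℕ (g i)) s)

HasZeroSumSubseq : (n r : ℕ) → Seq n r → Set
HasZeroSumSubseq n r s = Σ (Seq n r) λ t → (t ⊆ s) × (t ≢ []) × ZeroSum n r t

Good : (n r : ℕ) → ℕ → Set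
Good n r t = (1 ≤ t) × (∀ (s : Seq n r) → t ≤ length s → HasZeroSumSubseq n r s)

IsDavenport : (n r : ℕ) → ℕ → Set
IsDavenport n r t = Good n r t × (∀ t' → Good n r t' → t ≤ t')

{-# OPTIONS --safe #-}
-- Write n = mQ with Q a large prime power bounding all prime factors of m. Suppose that, for every prime
-- p ≤ Q, any pF elements of ℤʳ include p elements whose sum vanishes modulo p. Using up the primes of m
-- one after the other, mt + 2Fm elements contain t disjoint blocks with sum in mℤʳ; after division by m,
-- Olson's theorem D(C_Qʳ) = r(Q - 1) + 1 yields D(Cₙʳ) ≤ rn + 2Fm, and it remains to find F = o(Q).
--
-- For bounded p this is trivial. For large p we grow a set Y of subset sums as Alon and Dubiner do,
-- replacing Y by (Y + a) ∪ (Y + b); two such sets of more than half the group have sum everything. The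
-- growth is N(b - a), where N(x) = |Y \ (Y - x)| satisfies the triangle inequality. If no pair a, b
-- makes Y grow by a factor 1 + κ/2p, then N is small on all differences. Take a basis of differences. If
-- the coordinates of some further difference, times a bounded integer q, are small but not bounded, then
-- a rational approximation of their direction is a vector v with N small on the whole line through v,
-- and we pass to the quotient by v. Either this exhausts the space and N is small everywhere, which
-- contradicts its average, or all differences lie in boundedly many affine hyperplanes; a popular
-- hyperplane then reduces the dimension. Powers of p up to a small exponent count as bounded here.
module Submission where

open import Defs
open import Data.Nat as ℕ using (ℕ; zero; suc; _+_; _*_; _^_; _∸_; _≤_; _<_; z≤n; s≤s; NonZero)
import Data.Nat.Properties as ℕ
open import Data.Nat.Combinatorics using (_C_; nCk+nC[k+1]≡[n+1]C[k+1]; nCk≡nC[n∸k]; nCn≡1; nC1≡n; k>n⇒nCk≡0)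
open import Data.Nat.Coprimality using (Coprime; coprime-Bézout)
open import Data.Nat.Divisibility using (_∣_; divides; _∣?_)
import Data.Nat.Divisibility as ∣
open import Data.Nat.DivMod using (_/_; _%_; m<n*o⇒m/o<n; m≡m%n+[m/n]*n; m%n<n; m/n*n≤m; m*n/n≡m; /-monoˡ-≤)
open import Data.Nat.GCD using (module Bézout)
open import Data.Nat.ListAction as ℕList using (product)
open import Data.Nat.ListAction.Properties using (product-↭; product-++; sum-↭; sum-++)
open import Data.Nat.Primality using (Prime; euclidsLemma; prime⇒nonTrivial; prime⇒nonZero; prime⇒irreducible; ¬prime[0]; productOfPrimes≢0; productOfPrimes≥1)
open import Data.Nat.Primality.Factorisation using (PrimeFactorisation; factorise)
import Data.Nat.Tactic.RingSolver as ℕ-Ring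
open import Data.Integer using (ℤ; +_; -[1+_]; ∣_∣; 0ℤ; 1ℤ) renaming (_⊖_ to _⊖ℕ_; _+_ to _⊕_; _*_ to _⊗_; -_ to ⊖_; _-_ to _⊝_)
import Data.Integer.Properties as ℤ
open import Data.Integer.DivMod using (_%ℕ_; _/ℕ_; n%ℕd<d; a≡a%ℕn+[a/ℕn]*n)
open import Data.Integer.Tactic.RingSolver using (solve-∀)
open import Data.Bool using (Bool; true; false; _∧_; _∨_; not; if_then_else_)
open import Data.Bool.Properties using (∧-comm; ∧-inverseʳ)
open import Data.Fin as Fin using (Fin; toℕ; punchIn; fromℕ<; funToFin; finToFun; #_)
import Data.Fin.Properties as Fin
open import Data.List using (List; []; _∷_; _++_; length; map; concat; replicate; take; drop)
import Data.List.Properties as List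
open import Data.List.Membership.Propositional using (_∈_)
open import Data.List.Relation.Unary.All as All using (All; []; _∷_)
import Data.List.Relation.Unary.All.Properties as All
open import Data.List.Relation.Unary.Any using (here; there)
open import Data.List.Relation.Binary.Permutation.Propositional as ↭ using (_↭_; ↭-refl; ↭-sym; ↭-trans; ↭-prep; ↭-swap; ↭-reflexive)
open import Data.List.Relation.Binary.Permutation.Propositional.Properties using (↭-length; ++⁺ˡ; ++⁺ʳ; ++⁺; shift; shifts; All-resp-↭; ++-comm; ++-commutativeMonoid; ↭-empty-inv) renaming (map⁺ to ↭-map⁺)
open import Data.List.Relation.Binary.Sublist.Propositional using (_⊆_; []; _∷_; _∷ʳ_; ⊆-refl)
import Data.List.Relation.Binary.Sublist.Propositional.Properties as Sub
open import Data.Vec using () renaming (_∷_ to _∷ᵛ_; [] to []ᵛ)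
open import Data.Product using (Σ; _×_; _,_; proj₁; proj₂)
open import Data.Sum as Sum using (_⊎_; inj₁; inj₂; [_,_]′)
import Algebra.Solver.CommutativeMonoid as CommutativeMonoidSolver
open import Function using (_∘_; id; mk⇔)
open import Relation.Nullary using (¬_; Dec; yes; no; does; contradiction)
open import Relation.Nullary.Decidable using (does-⇔; dec-true)
open import Relation.Binary.Bundles using (Setoid)
open import Relation.Binary.PropositionalEquality using (_≡_; _≢_; refl; sym; trans; cong; cong₂; subst; module ≡-Reasoning)
import Relation.Binary.Reasoning.Setoid as SetoidReasoning

-- Integer vectors and linear forms

-- The loss `2Fm` only has to be small against `rn = rmQ`, so `F` may be any small fraction of `Q`
-- and a crude substitute for a bound linear in `p` is enough. The factor `Q` need not be a prime:
-- if all primes dividing a large `n` are small, one of them occurs to a high power, which exceeds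
-- them all.
--
-- Taking exactly one of `a`, `b` from each pair gives every sum in `Y` the same number of terms.
-- This is what allows blocks of exactly `p` elements, and exactly `p` terms make an affine
-- hyperplane `c·x = h` as good as a linear one: the sum `s` of a block inside it has
-- `c·s = ph = 0`. Hence differences, and not the elements themselves, carry the argument.
--
-- The obstacle is the budget. Passing half of `p^r` takes about `r log p` doublings within `p/2`
-- pairs, so `κ` must grow like `log p`. All later thresholds are powers of a number `z` that
-- dominates `κ`; they cannot be constants, and the number of hyperplanes multiplies the length in
-- every dimension. Taking `z` to be a small power of `p` leaves room for all of this.

sum : ∀ {k} → (Fin k → ℤ) → ℤ
sum {zero}  f = 0ℤ
sum {suc k} f = f Fin.zero ⊕ sum (f ∘ Fin.suc)

sum-cong-≗ : ∀ {k} {f g : Fin k → ℤ} → (∀ i → f i ≡ g i) → sum f ≡ sum g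
sum-cong-≗ {zero}  e = refl
sum-cong-≗ {suc k} e = cong₂ _⊕_ (e Fin.zero) (sum-cong-≗ (e ∘ Fin.suc))

sum-zero : ∀ {k} (f : Fin k → ℤ) → (∀ i → f i ≡ 0ℤ) → sum f ≡ 0ℤ
sum-zero {zero}  f e = refl
sum-zero {suc k} f e = cong₂ _⊕_ (e Fin.zero) (sum-zero (f ∘ Fin.suc) (e ∘ Fin.suc))

sum-+ : ∀ {k} (f g : Fin k → ℤ) → sum (λ i → f i ⊕ g i) ≡ sum f ⊕ sum g
sum-+ {zero}  f g = refl
sum-+ {suc k} f g = trans (cong (f Fin.zero ⊕ g Fin.zero ⊕_) (sum-+ (f ∘ Fin.suc) (g ∘ Fin.suc)))
                          (lem (f Fin.zero) (g Fin.zero) (sum (f ∘ Fin.suc)) (sum (g ∘ Fin.suc)))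
  where
  lem : ∀ a b c d → (a ⊕ b) ⊕ (c ⊕ d) ≡ (a ⊕ c) ⊕ (b ⊕ d)
  lem = solve-∀

sum-* : ∀ {k} a (f : Fin k → ℤ) → a ⊗ sum f ≡ sum (λ i → a ⊗ f i)
sum-* {zero}  a f = ℤ.*-zeroʳ a
sum-* {suc k} a f = trans (ℤ.*-distribˡ-+ a _ _) (cong (a ⊗ f Fin.zero ⊕_) (sum-* a (f ∘ Fin.suc)))

sum-comm : ∀ {k l} (f : Fin k → Fin l → ℤ) → sum (λ i → sum (f i)) ≡ sum (λ j → sum (λ i → f i j))
sum-comm {zero} {l} f = sym (sum-zero {l} (λ j → 0ℤ) (λ j → refl))
sum-comm {suc k} f = trans (cong (sum (f Fin.zero) ⊕_) (sum-comm (f ∘ Fin.suc))) (sym (sum-+ (f Fin.zero) (λ j → sum (λ i → f (Fin.suc i) j))))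

sum-remove : ∀ {k} (f : Fin (suc k) → ℤ) i → sum f ≡ f i ⊕ sum (f ∘ punchIn i)
sum-remove f Fin.zero = refl
sum-remove {suc k} f (Fin.suc i) = trans (cong (f Fin.zero ⊕_) (sum-remove (f ∘ Fin.suc) i))
  (lem (f Fin.zero) (f (Fin.suc i)) (sum (f ∘ Fin.suc ∘ punchIn i)))
  where
  lem : ∀ a b c → a ⊕ (b ⊕ c) ≡ b ⊕ (a ⊕ c)
  lem = solve-∀

-- Entries stay integers, and congruence is a separate relation, because sums of blocks are divided
-- by the modulus and then read modulo another number.
V : ℕ → Set
V d = Fin d → ℤ

infixl 6 _+ᵛ_ _-ᵛ_
infixl 7 _*ᵛ_
infix 8 -ᵛ_

_+ᵛ_ _-ᵛ_ : ∀ {d} → V d → V d → V d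
(x +ᵛ y) i = x i ⊕ y i
(x -ᵛ y) i = x i ⊝ y i

-ᵛ_ : ∀ {d} → V d → V d
(-ᵛ x) i = ⊖ x i

_*ᵛ_ : ∀ {d} → ℤ → V d → V d
(a *ᵛ x) i = a ⊗ x i

0ᵛ : ∀ {d} → V d
0ᵛ _ = 0ℤ

comb : ∀ {k d} → (Fin k → ℤ) → (Fin k → V d) → V d
comb γ u i = sum (λ j → γ j ⊗ u j i)

dot : ∀ {d} → V d → V d → ℤ
dot c x = sum (λ i → c i ⊗ x i)

dot-+ʳ : ∀ {d} (c x y : V d) → dot c (x +ᵛ y) ≡ dot c x ⊕ dot c y
dot-+ʳ c x y = trans (sum-cong-≗ (λ i → ℤ.*-distribˡ-+ (c i) (x i) (y i))) (sum-+ (λ i → c i ⊗ x i) (λ i → c i ⊗ y i))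

dot-*ʳ : ∀ {d} (c : V d) a (x : V d) → dot c (a *ᵛ x) ≡ a ⊗ dot c x
dot-*ʳ c a x = trans (sum-cong-≗ (λ i → lem (c i) a (x i))) (sym (sum-* a (λ i → c i ⊗ x i)))
  where
  lem : ∀ c a x → c ⊗ (a ⊗ x) ≡ a ⊗ (c ⊗ x)
  lem = solve-∀

dot-*ˡ : ∀ {d} a (c x : V d) → dot (a *ᵛ c) x ≡ a ⊗ dot c x
dot-*ˡ a c x = trans (sum-cong-≗ (λ i → ℤ.*-assoc a (c i) (x i))) (sym (sum-* a (λ i → c i ⊗ x i)))

dot-+ˡ : ∀ {d} (b c x : V d) → dot (b +ᵛ c) x ≡ dot b x ⊕ dot c x
dot-+ˡ b c x = trans (sum-cong-≗ (λ i → ℤ.*-distribʳ-+ (x i) (b i) (c i))) (sum-+ (λ i → b i ⊗ x i) (λ i → c i ⊗ x i))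

dot-comb : ∀ {k d} (c : V d) (γ : Fin k → ℤ) (u : Fin k → V d) →
           dot c (comb γ u) ≡ sum (λ j → γ j ⊗ dot c (u j))
dot-comb c γ u = begin
  sum (λ i → c i ⊗ sum (λ j → γ j ⊗ u j i))
    ≡⟨ sum-cong-≗ (λ i → sum-* (c i) (λ j → γ j ⊗ u j i)) ⟩
  sum (λ i → sum (λ j → c i ⊗ (γ j ⊗ u j i)))
    ≡⟨ sum-comm (λ i j → c i ⊗ (γ j ⊗ u j i)) ⟩
  sum (λ j → dot c (γ j *ᵛ u j))
    ≡⟨ sum-cong-≗ (λ j → dot-*ʳ c (γ j) (u j)) ⟩
  sum (λ j → γ j ⊗ dot c (u j)) ∎
  where open ≡-Reasoning

δ : ∀ {k} → Fin k → Fin k → ℤ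
δ i j with i Fin.≟ j
... | yes _ = 1ℤ
... | no  _ = 0ℤ

δ-refl : ∀ {k} (i : Fin k) → δ i i ≡ 1ℤ
δ-refl i with i Fin.≟ i
... | yes _ = refl
... | no i≢i = contradiction refl i≢i

δ-≢ : ∀ {k} {i j : Fin k} → i ≢ j → δ i j ≡ 0ℤ
δ-≢ {i = i} {j} i≢j with i Fin.≟ j
... | yes i≡j = contradiction i≡j i≢j
... | no _ = refl

δ-sym : ∀ {k} (i j : Fin k) → δ i j ≡ δ j i
δ-sym i j with i Fin.≟ j
... | yes refl = sym (δ-refl i)
... | no i≢j = sym (δ-≢ (i≢j ∘ sym))

sum-isolate : ∀ {k} (f : Fin k → ℤ) i → (∀ j → j ≢ i → f j ≡ 0ℤ) → sum f ≡ f i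
sum-isolate {suc k} f i f≡0 =
  trans (sum-remove f i) (trans (cong (f i ⊕_) (sum-zero (f ∘ punchIn i) λ j → f≡0 _ (Fin.punchInᵢ≢i i j))) (ℤ.+-identityʳ (f i)))

dot-δ : ∀ {d} i (x : V d) → dot (δ i) x ≡ x i
dot-δ i x = trans (sum-isolate (λ j → δ i j ⊗ x j) i λ j j≢i → cong (_⊗ x j) (δ-≢ (j≢i ∘ sym)))
                  (trans (cong (_⊗ x i) (δ-refl i)) (ℤ.*-identityˡ (x i)))

comb-δ : ∀ {d} (x : V d) i → comb x δ i ≡ x i
comb-δ x i = trans (sum-isolate (λ j → x j ⊗ δ j i) i λ j j≢i → trans (cong (x j ⊗_) (δ-≢ j≢i)) (ℤ.*-zeroʳ (x j)))
                   (trans (cong (x i ⊗_) (δ-refl i)) (ℤ.*-identityʳ (x i)))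

-- Congruences

module Mod (p : ℕ) where

  infix 4 _≈_ _≋_

  record _≈_ (x y : ℤ) : Set where
    constructor mod
    field
      quot : ℤ
      eq   : x ≡ y ⊕ quot ⊗ + p

  ≡⇒≈ : ∀ {x y} → x ≡ y → x ≈ y
  ≡⇒≈ {x} refl = mod 0ℤ (lem x (+ p))
    where
    lem : ∀ x p → x ≡ x ⊕ 0ℤ ⊗ p
    lem = solve-∀

  ≈-refl : ∀ {x} → x ≈ x
  ≈-refl = ≡⇒≈ refl

  ≈-sym : ∀ {x y} → x ≈ y → y ≈ x
  ≈-sym {y = y} (mod q refl) = mod (⊖ q) (lem y q (+ p))
    where
    lem : ∀ y q p → y ≡ (y ⊕ q ⊗ p) ⊕ (⊖ q) ⊗ p
    lem = solve-∀

  ≈-trans : ∀ {x y z} → x ≈ y → y ≈ z → x ≈ z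
  ≈-trans {z = z} (mod q refl) (mod r refl) = mod (r ⊕ q) (lem z q r (+ p))
    where
    lem : ∀ z q r p → (z ⊕ r ⊗ p) ⊕ q ⊗ p ≡ z ⊕ (r ⊕ q) ⊗ p
    lem = solve-∀

  ≈-setoid : Setoid _ _
  ≈-setoid = record
    { _≈_ = _≈_
    ; isEquivalence = record { refl = ≈-refl ; sym = ≈-sym ; trans = ≈-trans } }

  module ≈-Reasoning = SetoidReasoning ≈-setoid

  ⊕-cong : ∀ {x y u v} → x ≈ y → u ≈ v → x ⊕ u ≈ y ⊕ v
  ⊕-cong {y = y} {v = v} (mod q refl) (mod r refl) = mod (q ⊕ r) (lem y v q r (+ p))
    where
    lem : ∀ y v q r p → (y ⊕ q ⊗ p) ⊕ (v ⊕ r ⊗ p) ≡ y ⊕ v ⊕ (q ⊕ r) ⊗ p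
    lem = solve-∀

  ⊗-congˡ : ∀ a {x y} → x ≈ y → a ⊗ x ≈ a ⊗ y
  ⊗-congˡ a {y = y} (mod q refl) = mod (a ⊗ q) (lem a y q (+ p))
    where
    lem : ∀ a y q p → a ⊗ (y ⊕ q ⊗ p) ≡ a ⊗ y ⊕ a ⊗ q ⊗ p
    lem = solve-∀

  ⊗-congʳ : ∀ a {x y} → x ≈ y → x ⊗ a ≈ y ⊗ a
  ⊗-congʳ a {x} {y} e = ≈-trans (≡⇒≈ (ℤ.*-comm x a)) (≈-trans (⊗-congˡ a e) (≡⇒≈ (ℤ.*-comm a y)))

  ⊖-cong : ∀ {x y} → x ≈ y → ⊖ x ≈ ⊖ y
  ⊖-cong {y = y} (mod q refl) = mod (⊖ q) (lem y q (+ p))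
    where
    lem : ∀ y q p → ⊖ (y ⊕ q ⊗ p) ≡ ⊖ y ⊕ ⊖ q ⊗ p
    lem = solve-∀

  ⊝-cong : ∀ {x y u v} → x ≈ y → u ≈ v → x ⊝ u ≈ y ⊝ v
  ⊝-cong e f = ⊕-cong e (⊖-cong f)

  ⊕-congˡ : ∀ a {x y} → x ≈ y → a ⊕ x ≈ a ⊕ y
  ⊕-congˡ a = ⊕-cong (≈-refl {a})

  ⊝-congˡ : ∀ a {x y} → x ≈ y → a ⊝ x ≈ a ⊝ y
  ⊝-congˡ a = ⊝-cong (≈-refl {a})

  sum-cong : ∀ {k} {f g : Fin k → ℤ} → (∀ i → f i ≈ g i) → sum f ≈ sum g
  sum-cong {zero}  e = ≈-refl
  sum-cong {suc k} e = ⊕-cong (e Fin.zero) (sum-cong (e ∘ Fin.suc))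

  ≈0⇒∣ : ∀ {x} → x ≈ 0ℤ → p ∣ ∣ x ∣
  ≈0⇒∣ {x} (mod q eq) = divides ∣ q ∣ (trans (cong ∣_∣ (trans eq (ℤ.+-identityˡ (q ⊗ + p)))) (ℤ.abs-* q (+ p)))

  ∣⇒≈0 : ∀ {x} → p ∣ ∣ x ∣ → x ≈ 0ℤ
  ∣⇒≈0 {x} (divides q eq) with ℤ.+∣i∣≡i⊎+∣i∣≡-i x
  ... | inj₁ e = mod (+ q) (trans (sym e) (trans (cong +_ eq) (trans (ℤ.pos-* q p) (sym (ℤ.+-identityˡ _)))))
  ... | inj₂ e = mod (⊖ + q) (trans (sym (ℤ.neg-involutive x)) (trans (cong ⊖_ (trans (sym e) (trans (cong +_ eq) (ℤ.pos-* q p))))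
                   (lem (+ q) (+ p))))
    where
    lem : ∀ q p → ⊖ (q ⊗ p) ≡ 0ℤ ⊕ (⊖ q) ⊗ p
    lem = solve-∀

  ≈0? : ∀ x → Dec (x ≈ 0ℤ)
  ≈0? x with p ∣? ∣ x ∣
  ... | yes d = yes (∣⇒≈0 d)
  ... | no ¬d = no (¬d ∘ ≈0⇒∣)

  ⊝≈0⇒≈ : ∀ {x y} → x ⊝ y ≈ 0ℤ → x ≈ y
  ⊝≈0⇒≈ {x} {y} e = ≈-trans (≡⇒≈ (lem x y)) (≈-trans (⊕-cong e (≈-refl {y})) (≡⇒≈ (ℤ.+-identityˡ y)))
    where
    lem : ∀ x y → x ≡ (x ⊝ y) ⊕ y
    lem = solve-∀

  _≋_ : ∀ {d} → V d → V d → Set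
  x ≋ y = ∀ i → x i ≈ y i

  ≡⇒≋ : ∀ {d} {x y : V d} → (∀ i → x i ≡ y i) → x ≋ y
  ≡⇒≋ e i = ≡⇒≈ (e i)

  ≋-trans : ∀ {d} {x y z : V d} → x ≋ y → y ≋ z → x ≋ z
  ≋-trans e f i = ≈-trans (e i) (f i)

  dot-congʳ : ∀ {d} (c : V d) {x y : V d} → x ≋ y → dot c x ≈ dot c y
  dot-congʳ c e = sum-cong (λ i → ⊗-congˡ (c i) (e i))

  comb-congˡ : ∀ {k d} {γ γ′ : Fin k → ℤ} (u : Fin k → V d) → (∀ j → γ j ≈ γ′ j) → comb γ u ≋ comb γ′ u
  comb-congˡ u e i = sum-cong (λ j → ⊗-congʳ (u j i) (e j))

  module _ (pp : Prime p) where

    private instance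
      nz : NonZero p
      nz = prime⇒nonZero pp

    1≉0 : ¬ (1ℤ ≈ 0ℤ)
    1≉0 e with ∣.∣1⇒≡1 (≈0⇒∣ e)
    ... | p≡1 = ℕ.nonTrivial⇒≢1 {{prime⇒nonTrivial pp}} p≡1

    ⊗≈0 : ∀ a b → a ⊗ b ≈ 0ℤ → a ≈ 0ℤ ⊎ b ≈ 0ℤ
    ⊗≈0 a b e with euclidsLemma ∣ a ∣ ∣ b ∣ pp (subst (p ∣_) (ℤ.abs-* a b) (≈0⇒∣ e))
    ... | inj₁ d = inj₁ (∣⇒≈0 d)
    ... | inj₂ d = inj₂ (∣⇒≈0 d)

    ∤⇒coprime : ∀ {m} → ¬ p ∣ m → Coprime m p
    ∤⇒coprime ¬d (k∣m , k∣p) with prime⇒irreducible pp k∣p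
    ... | inj₁ k≡1 = k≡1
    ... | inj₂ refl = contradiction k∣m ¬d

    inverse : ∀ x → ¬ (x ≈ 0ℤ) → Σ ℤ λ y → x ⊗ y ≈ 1ℤ
    inverse x x≉0 with natInverse (coprime-Bézout (∤⇒coprime (x≉0 ∘ ∣⇒≈0)))
      where
      natInverse : ∀ {m} → Bézout.Identity 1 m p → Σ ℤ λ y → + m ⊗ y ≈ 1ℤ
      natInverse {m} (Bézout.+- a b e) = + a , mod (+ b) (begin
        + m ⊗ + a        ≡⟨ sym (ℤ.pos-* m a) ⟩
        + (m * a)        ≡⟨ cong +_ (ℕ.*-comm m a) ⟩
        + (a * m)        ≡⟨ cong +_ (sym e) ⟩
        + (1 + b * p)    ≡⟨ ℤ.pos-+ 1 (b * p) ⟩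
        1ℤ ⊕ + (b * p)   ≡⟨ cong (1ℤ ⊕_) (ℤ.pos-* b p) ⟩
        1ℤ ⊕ + b ⊗ + p   ∎)
        where open ≡-Reasoning
      natInverse {m} (Bézout.-+ a b e) = ⊖ + a , mod (⊖ + b) (begin
        + m ⊗ (⊖ + a)                 ≡⟨ lem (+ m) (+ a) (+ b ⊗ + p) ⟩
        (⊖ (1ℤ ⊕ + a ⊗ + m)) ⊕ 1ℤ     ≡⟨ cong (λ t → (⊖ t) ⊕ 1ℤ) e′ ⟩
        (⊖ (+ b ⊗ + p)) ⊕ 1ℤ          ≡⟨ lem′ (+ b) (+ p) ⟩
        1ℤ ⊕ (⊖ + b) ⊗ + p            ∎)
        where
        open ≡-Reasoning
        lem : ∀ m a t → m ⊗ (⊖ a) ≡ (⊖ (1ℤ ⊕ a ⊗ m)) ⊕ 1ℤ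
        lem = solve-∀
        lem′ : ∀ b p → (⊖ (b ⊗ p)) ⊕ 1ℤ ≡ 1ℤ ⊕ (⊖ b) ⊗ p
        lem′ = solve-∀
        e′ : 1ℤ ⊕ + a ⊗ + m ≡ + b ⊗ + p
        e′ = trans (cong (1ℤ ⊕_) (sym (ℤ.pos-* a m))) (trans (sym (ℤ.pos-+ 1 (a * m))) (trans (cong +_ e) (ℤ.pos-* b p)))
    ... | y , e with ℤ.+∣i∣≡i⊎+∣i∣≡-i x
    ... | inj₁ abs≡ = y , subst (λ t → t ⊗ y ≈ 1ℤ) abs≡ e
    ... | inj₂ abs≡ = ⊖ y , ≈-trans (≡⇒≈ (lem x y)) (subst (λ t → t ⊗ y ≈ 1ℤ) abs≡ e)
      where
      lem : ∀ x y → x ⊗ (⊖ y) ≡ (⊖ x) ⊗ y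
      lem = solve-∀

    small≉0 : ∀ {x} → 0 < ∣ x ∣ → ∣ x ∣ < p → ¬ (x ≈ 0ℤ)
    small≉0 {x} 0<x x<p e = ℕ.<⇒≱ x<p (∣.∣⇒≤ {{ℕ.>-nonZero 0<x}} (≈0⇒∣ e))

-- Simultaneous Diophantine approximation

close : ∀ a b P .{{_ : NonZero P}} → a / P ≡ b / P → ∣ + a ⊝ + b ∣ ≤ P
close a b P e = begin
  ∣ + a ⊝ + b ∣
    ≡⟨ cong ∣_∣ (cong₂ _⊝_ (expand a) (trans (expand b) (cong (λ t → + (b % P) ⊕ + t ⊗ + P) (sym e)))) ⟩
  ∣ (+ (a % P) ⊕ + (a / P) ⊗ + P) ⊝ (+ (b % P) ⊕ + (a / P) ⊗ + P) ∣
    ≡⟨ cong ∣_∣ (lem (+ (a % P)) (+ (b % P)) (+ (a / P) ⊗ + P)) ⟩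
  ∣ + (a % P) ⊝ + (b % P) ∣
    ≡⟨ cong ∣_∣ (ℤ.m-n≡m⊖n (a % P) (b % P)) ⟩
  ∣ (a % P) ⊖ℕ (b % P) ∣
    ≤⟨ ℤ.∣m⊝n∣≤m⊔n (a % P) (b % P) ⟩
  a % P ℕ.⊔ b % P
    ≤⟨ ℕ.⊔-lub (ℕ.<⇒≤ (m%n<n a P)) (ℕ.<⇒≤ (m%n<n b P)) ⟩
  P ∎
  where
  open ℕ.≤-Reasoning
  lem : ∀ x y t → (x ⊕ t) ⊝ (y ⊕ t) ≡ x ⊝ y
  lem = solve-∀
  expand : ∀ a → + a ≡ + (a % P) ⊕ + (a / P) ⊗ + P
  expand a = trans (cong +_ (m≡m%n+[m/n]*n a P)) (trans (ℤ.pos-+ (a % P) _) (cong (+ (a % P) ⊕_) (ℤ.pos-* (a / P) P)))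

abstract
  -- Pigeonhole: among the multiples of `α` by 0, ..., `L ^ k`, two have all residues modulo `P` in
  -- the same box of side `P / L`, and their difference is the multiple sought. The result is an
  -- equation in ℤ, since it is applied both with the prime `p` and with an arbitrary modulus `W`.
  dirichlet : ∀ k L P .{{_ : NonZero L}} .{{_ : NonZero P}} (α : Fin k → ℤ) →
              Σ ℕ λ q → 1 ≤ q × q ≤ L ^ k × Σ (Fin k → ℤ) λ w → Σ (Fin k → ℤ) λ m →
              (∀ i → + q ⊗ α i ≡ w i ⊕ m i ⊗ + P) × (∀ i → L * ∣ w i ∣ ≤ P)
  dirichlet k L P α = found (Fin.pigeonhole (ℕ.n<1+n (L ^ k)) (λ q → funToFin (box (toℕ q))))
    where
    res : ℕ → Fin k → ℕ
    res q i = (+ q ⊗ α i) %ℕ P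
    quo : ℕ → Fin k → ℤ
    quo q i = (+ q ⊗ α i) /ℕ P
    res<P : ∀ q i → L * res q i < L * P
    res<P q i = ℕ.*-monoʳ-< L (n%ℕd<d (+ q ⊗ α i) P)
    box : ℕ → Fin k → Fin L
    box q i = fromℕ< (m<n*o⇒m/o<n {L * res q i} {L} {P} (res<P q i))

    found : (Σ (Fin (suc (L ^ k))) λ a → Σ (Fin (suc (L ^ k))) λ b →
               a Fin.< b × funToFin (box (toℕ a)) ≡ funToFin (box (toℕ b))) →
            Σ ℕ λ q → 1 ≤ q × q ≤ L ^ k × Σ (Fin k → ℤ) λ w → Σ (Fin k → ℤ) λ m →
            (∀ i → + q ⊗ α i ≡ w i ⊕ m i ⊗ + P) × (∀ i → L * ∣ w i ∣ ≤ P)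
    found (a′ , b′ , a<b , same) =
      b ∸ a , ℕ.m<n⇒0<n∸m a<b , ℕ.≤-trans (ℕ.m∸n≤m b a) (Fin.toℕ≤pred[n] b′) ,
      (λ i → + res b i ⊝ + res a i) , (λ i → quo b i ⊝ quo a i) , eqn , small
      where
      a b : ℕ
      a = toℕ a′
      b = toℕ b′
      eqn : ∀ i → + (b ∸ a) ⊗ α i ≡ (+ res b i ⊝ + res a i) ⊕ (quo b i ⊝ quo a i) ⊗ + P
      eqn i = begin
        + (b ∸ a) ⊗ α i          ≡⟨ cong (_⊗ α i) (sym (trans (ℤ.m-n≡m⊖n b a) (ℤ.⊖-≥ (ℕ.<⇒≤ a<b)))) ⟩
        (+ b ⊝ + a) ⊗ α i        ≡⟨ lem (+ b) (+ a) (α i) ⟩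
        + b ⊗ α i ⊝ + a ⊗ α i    ≡⟨ cong₂ _⊝_ (a≡a%ℕn+[a/ℕn]*n (+ b ⊗ α i) P) (a≡a%ℕn+[a/ℕn]*n (+ a ⊗ α i) P) ⟩
        (+ res b i ⊕ quo b i ⊗ + P) ⊝ (+ res a i ⊕ quo a i ⊗ + P)
                                 ≡⟨ lem′ (+ res b i) (quo b i) (+ res a i) (quo a i) (+ P) ⟩
        (+ res b i ⊝ + res a i) ⊕ (quo b i ⊝ quo a i) ⊗ + P ∎
        where
        open ≡-Reasoning
        lem : ∀ b a x → (b ⊝ a) ⊗ x ≡ b ⊗ x ⊝ a ⊗ x
        lem = solve-∀
        lem′ : ∀ r q r′ q′ P → (r ⊕ q ⊗ P) ⊝ (r′ ⊕ q′ ⊗ P) ≡ (r ⊝ r′) ⊕ (q ⊝ q′) ⊗ P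
        lem′ = solve-∀
      sameBox : ∀ i → (L * res b i) / P ≡ (L * res a i) / P
      sameBox i = begin
        (L * res b i) / P     ≡⟨ sym (Fin.toℕ-fromℕ< _) ⟩
        toℕ (box b i)         ≡⟨ cong toℕ (sym (Fin.finToFun-funToFin (box b) i)) ⟩
        toℕ (finToFun (funToFin (box b)) i) ≡⟨ cong (λ t → toℕ (finToFun t i)) (sym same) ⟩
        toℕ (finToFun (funToFin (box a)) i) ≡⟨ cong toℕ (Fin.finToFun-funToFin (box a) i) ⟩
        toℕ (box a i)         ≡⟨ Fin.toℕ-fromℕ< _ ⟩
        (L * res a i) / P     ∎
        where open ≡-Reasoning
      small : ∀ i → L * ∣ + res b i ⊝ + res a i ∣ ≤ P
      small i = begin
        L * ∣ + res b i ⊝ + res a i ∣          ≡⟨ sym (ℤ.abs-* (+ L) (+ res b i ⊝ + res a i)) ⟩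
        ∣ + L ⊗ (+ res b i ⊝ + res a i) ∣      ≡⟨ cong ∣_∣ (lem (+ L) (+ res b i) (+ res a i)) ⟩
        ∣ + L ⊗ + res b i ⊝ + L ⊗ + res a i ∣  ≡⟨ cong ∣_∣ (cong₂ _⊝_ (sym (ℤ.pos-* L (res b i))) (sym (ℤ.pos-* L (res a i)))) ⟩
        ∣ + (L * res b i) ⊝ + (L * res a i) ∣  ≤⟨ close (L * res b i) (L * res a i) P (sameBox i) ⟩
        P ∎
        where
        open ℕ.≤-Reasoning
        lem : ∀ L b a → L ⊗ (b ⊝ a) ≡ L ⊗ b ⊝ L ⊗ a
        lem = solve-∀

argmax : ∀ {k} (f : Fin (suc k) → ℕ) → Σ (Fin (suc k)) λ i → ∀ j → f j ≤ f i
argmax {zero} f = Fin.zero , λ { Fin.zero → ℕ.≤-refl }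
argmax {suc k} f with argmax (f ∘ Fin.suc)
... | i , max with ℕ.≤-total (f Fin.zero) (f (Fin.suc i))
... | inj₁ f0≤ = Fin.suc i , λ { Fin.zero → f0≤ ; (Fin.suc j) → max j }
... | inj₂ ≤f0 = Fin.zero , λ { Fin.zero → ℕ.≤-refl ; (Fin.suc j) → ℕ.≤-trans (max j) ≤f0 }

-- Dual systems modulo p

module Duality (p : ℕ) where
  open Mod p

  record Dual {k d} (γ u : Fin k → V d) : Set where
    constructor mkDual
    field
      pairing : ∀ i j → dot (γ i) (u j) ≈ δ i j

  open Dual public

  project : ∀ {k d} → (γ u : Fin k → V d) → V d → V d
  project γ u x = comb (λ j → dot (γ j) x) u

  dot-comb-dual : ∀ {k d} {γ u : Fin k → V d} → Dual γ u → ∀ (v : Fin k → ℤ) i → dot (γ i) (comb v u) ≈ v i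
  dot-comb-dual {γ = γ} {u} dual v i = begin
    dot (γ i) (comb v u)               ≡⟨ dot-comb (γ i) v u ⟩
    sum (λ j → v j ⊗ dot (γ i) (u j))  ≈⟨ sum-cong (λ j → ⊗-congˡ (v j) (pairing dual i j)) ⟩
    sum (λ j → v j ⊗ δ i j)            ≡⟨ sum-isolate (λ j → v j ⊗ δ i j) i (λ j j≢i → trans (cong (v j ⊗_) (δ-≢ (j≢i ∘ sym))) (ℤ.*-zeroʳ (v j))) ⟩
    v i ⊗ δ i i                        ≡⟨ trans (cong (v i ⊗_) (δ-refl i)) (ℤ.*-identityʳ (v i)) ⟩
    v i                                ∎
    where open ≈-Reasoning

  -- The basis exchange replacing u i₀ by comb v u, written uniformly in j.
  module Exchange {k d} (γ u : Fin k → V d) (dual : Dual γ u) (v : Fin k → ℤ) (i₀ : Fin k) (y : ℤ) (vy : v i₀ ⊗ y ≈ 1ℤ) where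

    -- Since `y` inverts `v i₀`, this makes `γ′ i₀` congruent to `y γ i₀`, and for other `j`
    -- subtracts from `γ j` the multiple of `γ i₀` that makes it vanish on `comb v u`.
    c : Fin k → ℤ
    c j = (v j ⊝ δ j i₀) ⊗ y

    Δ : V d
    Δ = comb v u -ᵛ u i₀

    γ′ u′ : Fin k → V d
    γ′ j = γ j +ᵛ (⊖ c j) *ᵛ γ i₀
    u′ j = u j +ᵛ δ j i₀ *ᵛ Δ

    dot-γ′ : ∀ j x → dot (γ′ j) x ≡ dot (γ j) x ⊕ (⊖ c j) ⊗ dot (γ i₀) x
    dot-γ′ j x = trans (dot-+ˡ (γ j) _ x) (cong (dot (γ j) x ⊕_) (dot-*ˡ (⊖ c j) (γ i₀) x))

    u′-new : u′ i₀ ≋ comb v u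
    u′-new i = ≡⇒≈ (trans (cong (λ t → u i₀ i ⊕ t ⊗ Δ i) (δ-refl i₀)) (lem (u i₀ i) (comb v u i)))
      where
      lem : ∀ a b → a ⊕ 1ℤ ⊗ (b ⊝ a) ≡ b
      lem = solve-∀

    u′-old : ∀ {j} → j ≢ i₀ → u′ j ≋ u j
    u′-old {j} j≢i₀ i = ≡⇒≈ (trans (cong (λ t → u j i ⊕ t ⊗ Δ i) (δ-≢ j≢i₀)) (lem (u j i) (Δ i)))
      where
      lem : ∀ a b → a ⊕ 0ℤ ⊗ b ≡ a
      lem = solve-∀

    dual′ : Dual γ′ u′
    dual′ .pairing i j = go (j Fin.≟ i₀)
      where
      open ≈-Reasoning
      lem : ∀ a e y b → a ⊕ (⊖ ((a ⊝ e) ⊗ y)) ⊗ b ≡ a ⊝ (a ⊝ e) ⊗ (b ⊗ y)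
      lem = solve-∀
      lem′ : ∀ a e → a ⊝ (a ⊝ e) ⊗ 1ℤ ≡ e
      lem′ = solve-∀
      lem″ : ∀ a b → a ⊕ b ⊗ 0ℤ ≡ a
      lem″ = solve-∀
      go : Dec (j ≡ i₀) → dot (γ′ i) (u′ j) ≈ δ i j
      go (yes refl) = begin
        dot (γ′ i) (u′ i₀)                    ≈⟨ dot-congʳ (γ′ i) u′-new ⟩
        dot (γ′ i) (comb v u)                 ≡⟨ dot-γ′ i (comb v u) ⟩
        dot (γ i) (comb v u) ⊕ (⊖ c i) ⊗ dot (γ i₀) (comb v u)
          ≈⟨ ⊕-cong (dot-comb-dual dual v i) (⊗-congˡ (⊖ c i) (dot-comb-dual dual v i₀)) ⟩
        v i ⊕ (⊖ ((v i ⊝ δ i i₀) ⊗ y)) ⊗ v i₀ ≡⟨ lem (v i) (δ i i₀) y (v i₀) ⟩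
        v i ⊝ (v i ⊝ δ i i₀) ⊗ (v i₀ ⊗ y)     ≈⟨ ⊝-congˡ (v i) (⊗-congˡ (v i ⊝ δ i i₀) vy) ⟩
        v i ⊝ (v i ⊝ δ i i₀) ⊗ 1ℤ             ≡⟨ lem′ (v i) (δ i i₀) ⟩
        δ i i₀                                ∎
      go (no j≢i₀) = begin
        dot (γ′ i) (u′ j)             ≈⟨ dot-congʳ (γ′ i) (u′-old j≢i₀) ⟩
        dot (γ′ i) (u j)              ≡⟨ dot-γ′ i (u j) ⟩
        dot (γ i) (u j) ⊕ (⊖ c i) ⊗ dot (γ i₀) (u j)
          ≈⟨ ⊕-cong (pairing dual i j) (⊗-congˡ (⊖ c i) (≈-trans (pairing dual i₀ j) (≡⇒≈ (δ-≢ (j≢i₀ ∘ sym))))) ⟩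
        δ i j ⊕ (⊖ c i) ⊗ 0ℤ          ≡⟨ lem″ (δ i j) (⊖ c i) ⟩
        δ i j                         ∎

    -- The exchange changes neither the span of the vectors nor the common kernel of the forms. In
    -- coordinates, the discrepancy collects into a multiple of `1 - v i₀ y`.
    project′ : ∀ x → project γ′ u′ x ≋ project γ u x
    project′ x i = begin
      sum (λ j → dot (γ′ j) x ⊗ u′ j i)
        ≡⟨ sum-cong-≗ (λ j → trans (cong (_⊗ u′ j i) (dot-γ′ j x)) (lem (dot (γ j) x) (v j) (δ j i₀) y g (u j i) (Δ i))) ⟩
      sum (λ j → dot (γ j) x ⊗ u j i ⊕ ((⊖ (g ⊗ y)) ⊗ (v j ⊗ u j i) ⊕ δ j i₀ ⊗ T j))
        ≡⟨ sum-+ (λ j → dot (γ j) x ⊗ u j i) (λ j → (⊖ (g ⊗ y)) ⊗ (v j ⊗ u j i) ⊕ δ j i₀ ⊗ T j) ⟩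
      Px ⊕ sum (λ j → (⊖ (g ⊗ y)) ⊗ (v j ⊗ u j i) ⊕ δ j i₀ ⊗ T j)
        ≡⟨ cong (Px ⊕_) (sum-+ (λ j → (⊖ (g ⊗ y)) ⊗ (v j ⊗ u j i)) (λ j → δ j i₀ ⊗ T j)) ⟩
      Px ⊕ (sum (λ j → (⊖ (g ⊗ y)) ⊗ (v j ⊗ u j i)) ⊕ sum (λ j → δ j i₀ ⊗ T j))
        ≡⟨ cong (Px ⊕_) (cong₂ _⊕_ (sym (sum-* (⊖ (g ⊗ y)) (λ j → v j ⊗ u j i))) isolate) ⟩
      Px ⊕ ((⊖ (g ⊗ y)) ⊗ comb v u i ⊕ T i₀)
        ≡⟨ cong (λ e → Px ⊕ ((⊖ (g ⊗ y)) ⊗ comb v u i ⊕ (g ⊗ y ⊗ u i₀ i ⊕ (g ⊝ (v i₀ ⊝ e) ⊗ y ⊗ g) ⊗ Δ i))) (δ-refl i₀) ⟩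
      Px ⊕ ((⊖ (g ⊗ y)) ⊗ comb v u i ⊕ (g ⊗ y ⊗ u i₀ i ⊕ (g ⊝ (v i₀ ⊝ 1ℤ) ⊗ y ⊗ g) ⊗ (comb v u i ⊝ u i₀ i)))
        ≡⟨ lem′ Px g y (v i₀) (comb v u i) (u i₀ i) ⟩
      Px ⊕ (1ℤ ⊝ v i₀ ⊗ y) ⊗ (g ⊗ (comb v u i ⊝ u i₀ i))
        ≈⟨ ⊕-congˡ Px (⊗-congʳ (g ⊗ (comb v u i ⊝ u i₀ i)) (⊝-congˡ 1ℤ vy)) ⟩
      Px ⊕ (1ℤ ⊝ 1ℤ) ⊗ (g ⊗ (comb v u i ⊝ u i₀ i))
        ≡⟨ lem″ Px (g ⊗ (comb v u i ⊝ u i₀ i)) ⟩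
      Px ∎
      where
      open ≈-Reasoning
      g = dot (γ i₀) x
      Px = project γ u x i
      T : Fin k → ℤ
      T j = g ⊗ y ⊗ u j i ⊕ (dot (γ j) x ⊝ (v j ⊝ δ j i₀) ⊗ y ⊗ g) ⊗ Δ i
      isolate : sum (λ j → δ j i₀ ⊗ T j) ≡ T i₀
      isolate = trans (sum-isolate (λ j → δ j i₀ ⊗ T j) i₀ (λ j j≢ → cong (_⊗ T j) (δ-≢ j≢)))
                      (trans (cong (_⊗ T i₀) (δ-refl i₀)) (ℤ.*-identityˡ (T i₀)))
      lem : ∀ a v e y g u D → (a ⊕ (⊖ ((v ⊝ e) ⊗ y)) ⊗ g) ⊗ (u ⊕ e ⊗ D) ≡
            a ⊗ u ⊕ ((⊖ (g ⊗ y)) ⊗ (v ⊗ u) ⊕ e ⊗ (g ⊗ y ⊗ u ⊕ (a ⊝ (v ⊝ e) ⊗ y ⊗ g) ⊗ D))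
      lem = solve-∀
      lem′ : ∀ P g y v c u → P ⊕ ((⊖ (g ⊗ y)) ⊗ c ⊕ (g ⊗ y ⊗ u ⊕ (g ⊝ (v ⊝ 1ℤ) ⊗ y ⊗ g) ⊗ (c ⊝ u))) ≡
             P ⊕ (1ℤ ⊝ v ⊗ y) ⊗ (g ⊗ (c ⊝ u))
      lem′ = solve-∀
      lem″ : ∀ P t → P ⊕ (1ℤ ⊝ 1ℤ) ⊗ t ≡ P
      lem″ = solve-∀

  δ-punchIn : ∀ {k} (i₀ : Fin (suc k)) i j → δ (punchIn i₀ i) (punchIn i₀ j) ≡ δ i j
  δ-punchIn i₀ i j with i Fin.≟ j
  ... | yes refl = δ-refl (punchIn i₀ i)
  ... | no i≢j = δ-≢ (i≢j ∘ Fin.punchIn-injective i₀ i j)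

  drop-dual : ∀ {k d} {γ u : Fin (suc k) → V d} i₀ → Dual γ u → Dual (γ ∘ punchIn i₀) (u ∘ punchIn i₀)
  drop-dual i₀ dual .pairing i j = ≈-trans (pairing dual (punchIn i₀ i) (punchIn i₀ j)) (≡⇒≈ (δ-punchIn i₀ i j))

-- Norms on (ℤ/p)ᵈ that are small on a list not concentrated near a hyperplane

-- The price of filling one more line, in units of `pν/σ`: the old remainder is used twice, at `K`
-- each, two combinations of at most `d` cheap vectors cost `d` each, and a multiple of the given
-- difference costs 1.
step : ℕ → ℕ → ℕ
step d K = K + (K + (2 * d + 1))

steps : ℕ → ℕ → ℕ → ℕ
steps d zero    K = K
steps d (suc k) K = steps d k (step d K)

module Covering (p : ℕ) (pp : Prime p) (d : ℕ) where
  open Mod p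
  open Duality p

  record Norm : Set where
    field
      N      : V d → ℕ
      N-cong : ∀ {x y} → x ≋ y → N x ≡ N y
      N-0    : N 0ᵛ ≡ 0
      N-+    : ∀ x y → N (x +ᵛ y) ≤ N x + N y
      N-neg  : ∀ x → N (-ᵛ x) ≡ N x

  module _ (norm : Norm) where
    open Norm norm

    N-ℕ* : ∀ n x → N (+ n *ᵛ x) ≤ n * N x
    N-ℕ* zero x = ℕ.≤-reflexive (trans (N-cong {y = 0ᵛ} (λ i → ≡⇒≈ (ℤ.*-zeroˡ (x i)))) N-0)
    N-ℕ* (suc n) x = begin
      N (+ suc n *ᵛ x)      ≡⟨ N-cong {y = x +ᵛ + n *ᵛ x} (λ i → ≡⇒≈ (ℤ.suc-* (+ n) (x i))) ⟩
      N (x +ᵛ + n *ᵛ x)     ≤⟨ N-+ x (+ n *ᵛ x) ⟩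
      N x + N (+ n *ᵛ x)    ≤⟨ ℕ.+-monoʳ-≤ (N x) (N-ℕ* n x) ⟩
      N x + n * N x         ∎
      where open ℕ.≤-Reasoning

    N-* : ∀ a x → N (a *ᵛ x) ≤ ∣ a ∣ * N x
    N-* a x with ℤ.+∣i∣≡i⊎+∣i∣≡-i a
    ... | inj₁ e = subst (λ t → N (t *ᵛ x) ≤ ∣ a ∣ * N x) e (N-ℕ* ∣ a ∣ x)
    ... | inj₂ e = begin
      N (a *ᵛ x)           ≡⟨ N-cong (λ i → ≡⇒≈ (trans (lem a (x i)) (cong (λ t → ⊖ (t ⊗ x i)) (sym e)))) ⟩
      N (-ᵛ (+ ∣ a ∣ *ᵛ x)) ≡⟨ N-neg (+ ∣ a ∣ *ᵛ x) ⟩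
      N (+ ∣ a ∣ *ᵛ x)      ≤⟨ N-ℕ* ∣ a ∣ x ⟩
      ∣ a ∣ * N x          ∎
      where
      open ℕ.≤-Reasoning
      lem : ∀ a x → a ⊗ x ≡ ⊖ ((⊖ a) ⊗ x)
      lem = solve-∀

    N-comb : ∀ {k} S P ν (c : Fin k → ℤ) (u : Fin k → V d) → (∀ i → S * ∣ c i ∣ ≤ P) → (∀ i → N (u i) ≤ ν) →
             S * N (comb c u) ≤ k * (P * ν)
    N-comb {zero}  S P ν c u small cheap = ℕ.≤-reflexive (trans (cong (S *_) N-0) (ℕ.*-zeroʳ S))
    N-comb {suc k} S P ν c u small cheap = begin
      S * N (comb c u)
        ≤⟨ ℕ.*-monoʳ-≤ S (N-+ (c Fin.zero *ᵛ u Fin.zero) (comb (c ∘ Fin.suc) (u ∘ Fin.suc))) ⟩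
      S * (N (c Fin.zero *ᵛ u Fin.zero) + rest)
        ≡⟨ ℕ.*-distribˡ-+ S _ rest ⟩
      S * N (c Fin.zero *ᵛ u Fin.zero) + S * rest
        ≤⟨ ℕ.+-mono-≤ head≤ (N-comb S P ν (c ∘ Fin.suc) (u ∘ Fin.suc) (small ∘ Fin.suc) (cheap ∘ Fin.suc)) ⟩
      P * ν + k * (P * ν) ∎
      where
      open ℕ.≤-Reasoning
      rest = N (comb (c ∘ Fin.suc) (u ∘ Fin.suc))
      head≤ : S * N (c Fin.zero *ᵛ u Fin.zero) ≤ P * ν
      head≤ = begin
        S * N (c Fin.zero *ᵛ u Fin.zero)          ≤⟨ ℕ.*-monoʳ-≤ S (N-* (c Fin.zero) (u Fin.zero)) ⟩
        S * (∣ c Fin.zero ∣ * N (u Fin.zero))     ≡⟨ sym (ℕ.*-assoc S ∣ c Fin.zero ∣ _) ⟩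
        S * ∣ c Fin.zero ∣ * N (u Fin.zero)       ≤⟨ ℕ.*-mono-≤ (small Fin.zero) (cheap Fin.zero) ⟩
        P * ν                                     ∎

  -- σ, S and Q are thresholds: a dual system of size at most d needs denominators at most S to be
  -- approximated within 1/σ, and at most Q to be approximated within 1/(2σS).
  module _ (norm : Norm) (ν σ S Q : ℕ) (2≤σ : 2 ≤ σ) (1≤Q : 1 ≤ Q)
           (S-bound : ∀ {k} → k ≤ d → σ ^ k ≤ S) (Q-bound : ∀ {k} → k ≤ d → (2 * (σ * S)) ^ k ≤ Q)
           (2S<p : 2 * S < p) where
    open Norm norm

    private instance
      nz-p : NonZero p
      nz-p = prime⇒nonZero pp
      nz-σ : NonZero σ
      nz-σ = ℕ.>-nonZero (ℕ.≤-trans (s≤s z≤n) 2≤σ)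

    1≤S : 1 ≤ S
    1≤S = S-bound z≤n

    -- For coordinates of maximum `W` with `E ≤ W ≤ p / L`, the upper bound keeps `W` times a vector
    -- with entries up to `2S` below `p / σ`, and the lower bound gives `σ j S Q ≤ j W ≤ p` whenever
    -- `j W ≤ p`.
    L E : ℕ
    L = 2 * (σ * S)
    E = σ * (S * Q)

    private instance
      nz-L : NonZero L
      nz-L = ℕ.>-nonZero (ℕ.*-mono-≤ {1} {2} (s≤s z≤n) (ℕ.*-mono-≤ (ℕ.≤-trans (s≤s z≤n) 2≤σ) 1≤S))

    1≤E : 1 ≤ E
    1≤E = ℕ.*-mono-≤ (ℕ.≤-trans (s≤s z≤n) 2≤σ) (ℕ.*-mono-≤ 1≤S 1≤Q)

    -- The quotient by the lines filled so far, without forming a quotient: `u` is a cheap basis of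
    -- a complement, the filled part is the common kernel of `γ`, and `rest` says that `N` is
    -- already small there.
    record Frame (k K : ℕ) : Set where
      field
        γ u   : Fin k → V d
        dual  : Dual γ u
        cheap : ∀ i → N (u i) ≤ ν
        rest  : ∀ x → σ * N (x -ᵛ project γ u x) ≤ K * (p * ν)

    -- As `q` and `h` are bounded, `c·a` takes one of boundedly many values `h/q` modulo `p`.
    NearHyperplane : V d → V d → Set
    NearHyperplane c a = Σ ℕ λ q → Σ ℤ λ h → 1 ≤ q × q ≤ Q × ∣ h ∣ ≤ E × + q ⊗ dot c a ≈ h

    -- The vector `w` certifies that the form `c` is not zero modulo `p`.
    Slab : List (V d) → Set
    Slab as = Σ (V d) λ c → (Σ (V d) λ w → dot c w ≈ 1ℤ) × All (NearHyperplane c) as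

    module Fill {k K : ℕ} (k<d : suc k ≤ d) (F : Frame (suc k) K) (a : V d) (Na : N a ≤ ν)
                (q : ℕ) (q≤Q : q ≤ Q) (w m : Fin (suc k) → ℤ)
                (qa : ∀ i → + q ⊗ dot (Frame.γ F i) a ≡ w i ⊕ m i ⊗ + p) (w-small : ∀ i → L * ∣ w i ∣ ≤ p)
                (i₀ : Fin (suc k)) (w-max : ∀ i → ∣ w i ∣ ≤ ∣ w i₀ ∣) (E≤W : E ≤ ∣ w i₀ ∣) where
      open Frame F
      W = ∣ w i₀ ∣

      1≤W : 1 ≤ W
      1≤W = ℕ.≤-trans 1≤E E≤W

      private instance
        nz-W : NonZero W
        nz-W = ℕ.>-nonZero 1≤W

      -- With modulus `W` this approximates the real direction `w / W`, of maximum norm 1, by the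
      -- rational direction `v / s`.
      approx = dirichlet (suc k) σ W w
      s = proj₁ approx
      1≤s = proj₁ (proj₂ approx)
      s≤S : s ≤ S
      s≤S = ℕ.≤-trans (proj₁ (proj₂ (proj₂ approx))) (S-bound k<d)
      err = proj₁ (proj₂ (proj₂ (proj₂ approx)))
      v = proj₁ (proj₂ (proj₂ (proj₂ (proj₂ approx))))
      sw : ∀ i → + s ⊗ w i ≡ err i ⊕ v i ⊗ + W
      sw = proj₁ (proj₂ (proj₂ (proj₂ (proj₂ (proj₂ approx)))))
      err-small : ∀ i → σ * ∣ err i ∣ ≤ W
      err-small = proj₂ (proj₂ (proj₂ (proj₂ (proj₂ (proj₂ approx)))))

      v≤ : ∀ i → ∣ v i ∣ ≤ 2 * S
      v≤ i = ℕ.*-cancelʳ-≤ ∣ v i ∣ (2 * S) W (begin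
        ∣ v i ∣ * W               ≡⟨ sym (ℤ.abs-* (v i) (+ W)) ⟩
        ∣ v i ⊗ + W ∣             ≡⟨ cong ∣_∣ (trans (lem (err i) (v i ⊗ + W)) (cong (_⊝ err i) (sym (sw i)))) ⟩
        ∣ + s ⊗ w i ⊝ err i ∣     ≤⟨ ℤ.∣i-j∣≤∣i∣+∣j∣ (+ s ⊗ w i) (err i) ⟩
        ∣ + s ⊗ w i ∣ + ∣ err i ∣ ≡⟨ cong (_+ ∣ err i ∣) (ℤ.abs-* (+ s) (w i)) ⟩
        s * ∣ w i ∣ + ∣ err i ∣   ≤⟨ ℕ.+-mono-≤ (ℕ.*-mono-≤ s≤S (w-max i)) (ℕ.≤-trans (ℕ.m≤n*m ∣ err i ∣ σ) (err-small i)) ⟩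
        S * W + W                 ≤⟨ ℕ.+-monoʳ-≤ (S * W) (ℕ.≤-trans (ℕ.≤-reflexive (sym (ℕ.*-identityˡ W))) (ℕ.*-monoˡ-≤ W 1≤S)) ⟩
        S * W + S * W             ≡⟨ lem′ S W ⟩
        2 * S * W                 ∎)
        where
        open ℕ.≤-Reasoning
        lem : ∀ e t → t ≡ (e ⊕ t) ⊝ e
        lem = solve-∀
        lem′ : ∀ S W → S * W + S * W ≡ 2 * S * W
        lem′ = ℕ-Ring.solve-∀

      -- Otherwise `s w i₀` would be pure error, and `W ≤ s W ≤ W / σ ≤ W / 2`. Together with
      -- `∣ v i₀ ∣ ≤ 2 * S < p` this makes `v i₀` invertible, so that `u i₀` can be exchanged.
      v≢0 : 0 < ∣ v i₀ ∣
      v≢0 with ∣ v i₀ ∣ in eq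
      ... | suc _ = s≤s z≤n
      ... | zero = contradiction (begin-strict
        W                       <⟨ ℕ.m<m*n W 2 (s≤s (s≤s z≤n)) ⟩
        W * 2                   ≤⟨ ℕ.*-mono-≤ (ℕ.≤-trans (ℕ.≤-reflexive (sym (ℕ.*-identityˡ W))) (ℕ.*-monoˡ-≤ W 1≤s)) 2≤σ ⟩
        s * W * σ               ≡⟨ ℕ.*-comm (s * W) σ ⟩
        σ * (s * W)             ≡⟨ cong (σ *_) (trans (sym (ℤ.abs-* (+ s) (w i₀))) (cong ∣_∣ sw≡err)) ⟩
        σ * ∣ err i₀ ∣          ≤⟨ err-small i₀ ⟩
        W                       ∎) (ℕ.<-irrefl refl)
        where
        open ℕ.≤-Reasoning
        sw≡err : + s ⊗ w i₀ ≡ err i₀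
        sw≡err = trans (sw i₀) (trans (cong (λ t → err i₀ ⊕ t ⊗ + W) (ℤ.∣i∣≡0⇒i≡0 {v i₀} eq)) (trans (cong (err i₀ ⊕_) (ℤ.*-zeroˡ (+ W))) (ℤ.+-identityʳ (err i₀))))

      y,vy = inverse pp (v i₀) (small≉0 pp v≢0 (ℕ.≤-<-trans (v≤ i₀) 2S<p))
      module X = Exchange γ u dual v i₀ (proj₁ y,vy) (proj₂ y,vy)

      -- The numbers `n w` are the coordinates of `nq a` modulo `p`, so the combination is `nq a`
      -- less its part outside the span of `u`. The first costs `nq ν`, the second is covered by
      -- `rest`.
      N-multiple : ∀ n → σ * N (comb (λ i → + n ⊗ w i) u) ≤ σ * (n * q) * ν + K * (p * ν)
      N-multiple n = begin
        σ * N (comb (λ i → + n ⊗ w i) u)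
          ≡⟨ cong (σ *_) (N-cong (λ i → ≈-trans (comb-congˡ u coord i) (≡⇒≈ (lem (x i) (project γ u x i))))) ⟩
        σ * N (x +ᵛ -ᵛ (x -ᵛ project γ u x))
          ≤⟨ ℕ.*-monoʳ-≤ σ (N-+ x (-ᵛ (x -ᵛ project γ u x))) ⟩
        σ * (N x + N (-ᵛ (x -ᵛ project γ u x)))
          ≡⟨ trans (cong (λ t → σ * (N x + t)) (N-neg (x -ᵛ project γ u x))) (ℕ.*-distribˡ-+ σ (N x) _) ⟩
        σ * N x + σ * N (x -ᵛ project γ u x)
          ≤⟨ ℕ.+-mono-≤ (ℕ.*-monoʳ-≤ σ (ℕ.≤-trans (N-ℕ* norm (n * q) a) (ℕ.*-monoʳ-≤ (n * q) Na))) (rest x) ⟩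
        σ * (n * q * ν) + K * (p * ν)
          ≡⟨ cong (_+ K * (p * ν)) (sym (ℕ.*-assoc σ (n * q) ν)) ⟩
        σ * (n * q) * ν + K * (p * ν) ∎
        where
        open ℕ.≤-Reasoning
        x : V d
        x = + (n * q) *ᵛ a
        lem : ∀ x t → t ≡ x ⊕ ⊖ (x ⊝ t)
        lem = solve-∀
        coord : ∀ i → + n ⊗ w i ≈ dot (γ i) x
        coord i = ≈-sym (mod (+ n ⊗ m i) (≡.begin
          dot (γ i) x                     ≡.≡⟨ dot-*ʳ (γ i) (+ (n * q)) a ⟩
          + (n * q) ⊗ dot (γ i) a         ≡.≡⟨ trans (cong (_⊗ dot (γ i) a) (ℤ.pos-* n q)) (ℤ.*-assoc (+ n) (+ q) (dot (γ i) a)) ⟩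
          + n ⊗ (+ q ⊗ dot (γ i) a)       ≡.≡⟨ cong (+ n ⊗_) (qa i) ⟩
          + n ⊗ (w i ⊕ m i ⊗ + p)         ≡.≡⟨ lem′ (+ n) (w i) (m i) (+ p) ⟩
          + n ⊗ w i ⊕ + n ⊗ m i ⊗ + p     ≡.∎))
          where
          module ≡ = ≡-Reasoning
          lem′ : ∀ n w m p → n ⊗ (w ⊕ m ⊗ p) ≡ n ⊗ w ⊕ n ⊗ m ⊗ p
          lem′ = solve-∀

      -- Division with remainder n = r + jW, and Wv = sw - err.
      N-line-ℕ : ∀ n → n < p → σ * N (+ n *ᵛ comb v u) ≤ K * (p * ν) + (2 * d + 1) * (p * ν)
      N-line-ℕ n n<p = begin
        σ * N (+ n *ᵛ comb v u)
          ≡⟨ cong (σ *_) (N-cong (≡⇒≋ split)) ⟩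
        σ * N (A +ᵛ (B +ᵛ C))
          ≤⟨ ℕ.*-monoʳ-≤ σ (ℕ.≤-trans (N-+ A (B +ᵛ C)) (ℕ.+-monoʳ-≤ (N A) (N-+ B C))) ⟩
        σ * (N A + (N B + N C))
          ≡⟨ dist σ (N A) (N B) (N C) ⟩
        σ * N A + (σ * N B + σ * N C)
          ≤⟨ ℕ.+-mono-≤ (N-comb norm σ p ν (λ i → + r ⊗ v i) u A-small cheap)
               (ℕ.+-mono-≤ (N-multiple (j * s)) (N-comb norm σ p ν (λ i → + j ⊗ (⊖ err i)) u C-small cheap)) ⟩
        suc k * (p * ν) + ((σ * (j * s * q) * ν + K * (p * ν)) + suc k * (p * ν))
          ≤⟨ ℕ.+-mono-≤ (ℕ.*-monoˡ-≤ (p * ν) k<d) (ℕ.+-mono-≤ (ℕ.+-monoˡ-≤ (K * (p * ν)) (ℕ.*-monoˡ-≤ ν B-small)) (ℕ.*-monoˡ-≤ (p * ν) k<d)) ⟩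
        d * (p * ν) + ((p * ν + K * (p * ν)) + d * (p * ν))
          ≡⟨ collect d K (p * ν) ⟩
        K * (p * ν) + (2 * d + 1) * (p * ν) ∎
        where
        open ℕ.≤-Reasoning
        r = n % W
        j = n / W
        jW≤p : j * W ≤ p
        jW≤p = ℕ.≤-trans (m/n*n≤m n W) (ℕ.<⇒≤ n<p)
        A B C : V d
        A = comb (λ i → + r ⊗ v i) u
        B = comb (λ i → + (j * s) ⊗ w i) u
        C = comb (λ i → + j ⊗ (⊖ err i)) u
        dist : ∀ s a b c → s * (a + (b + c)) ≡ s * a + (s * b + s * c)
        dist = ℕ-Ring.solve-∀
        collect : ∀ d K t → d * t + ((t + K * t) + d * t) ≡ K * t + (2 * d + 1) * t
        collect = ℕ-Ring.solve-∀
        coeff : ∀ i → + n ⊗ v i ≡ + r ⊗ v i ⊕ (+ (j * s) ⊗ w i ⊕ + j ⊗ (⊖ err i))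
        coeff i = ≡.begin
          + n ⊗ v i                                                 ≡.≡⟨ cong (_⊗ v i) (trans (cong +_ (m≡m%n+[m/n]*n n W)) (trans (ℤ.pos-+ r (j * W)) (cong (+ r ⊕_) (ℤ.pos-* j W)))) ⟩
          (+ r ⊕ + j ⊗ + W) ⊗ v i                                   ≡.≡⟨ lem (+ r) (+ j) (+ W) (v i) (err i) ⟩
          + r ⊗ v i ⊕ (+ j ⊗ (err i ⊕ v i ⊗ + W) ⊕ + j ⊗ (⊖ err i)) ≡.≡⟨ cong (λ t → + r ⊗ v i ⊕ (+ j ⊗ t ⊕ + j ⊗ (⊖ err i))) (sym (sw i)) ⟩
          + r ⊗ v i ⊕ (+ j ⊗ (+ s ⊗ w i) ⊕ + j ⊗ (⊖ err i))         ≡.≡⟨ cong (λ t → + r ⊗ v i ⊕ (t ⊕ + j ⊗ (⊖ err i))) (trans (sym (ℤ.*-assoc (+ j) (+ s) (w i))) (cong (_⊗ w i) (sym (ℤ.pos-* j s)))) ⟩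
          + r ⊗ v i ⊕ (+ (j * s) ⊗ w i ⊕ + j ⊗ (⊖ err i))           ≡.∎
          where
          module ≡ = ≡-Reasoning
          lem : ∀ r j W v e → (r ⊕ j ⊗ W) ⊗ v ≡ r ⊗ v ⊕ (j ⊗ (e ⊕ v ⊗ W) ⊕ j ⊗ (⊖ e))
          lem = solve-∀
        split : ∀ l → + n ⊗ comb v u l ≡ A l ⊕ (B l ⊕ C l)
        split l = ≡.begin
          + n ⊗ comb v u l                        ≡.≡⟨ sum-* (+ n) (λ i → v i ⊗ u i l) ⟩
          sum (λ i → + n ⊗ (v i ⊗ u i l))         ≡.≡⟨ sum-cong-≗ (λ i → trans (sym (ℤ.*-assoc (+ n) (v i) (u i l))) (trans (cong (_⊗ u i l) (coeff i)) (lem (+ r ⊗ v i) (+ (j * s) ⊗ w i) (+ j ⊗ (⊖ err i)) (u i l)))) ⟩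
          sum (λ i → + r ⊗ v i ⊗ u i l ⊕ (+ (j * s) ⊗ w i ⊗ u i l ⊕ + j ⊗ (⊖ err i) ⊗ u i l))
            ≡.≡⟨ trans (sum-+ (λ i → + r ⊗ v i ⊗ u i l) (λ i → + (j * s) ⊗ w i ⊗ u i l ⊕ + j ⊗ (⊖ err i) ⊗ u i l))
                       (cong (A l ⊕_) (sum-+ (λ i → + (j * s) ⊗ w i ⊗ u i l) (λ i → + j ⊗ (⊖ err i) ⊗ u i l))) ⟩
          A l ⊕ (B l ⊕ C l) ≡.∎
          where
          module ≡ = ≡-Reasoning
          lem : ∀ a b c u → (a ⊕ (b ⊕ c)) ⊗ u ≡ a ⊗ u ⊕ (b ⊗ u ⊕ c ⊗ u)
          lem = solve-∀
        A-small : ∀ i → σ * ∣ + r ⊗ v i ∣ ≤ p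
        A-small i = begin
          σ * ∣ + r ⊗ v i ∣     ≡⟨ cong (σ *_) (ℤ.abs-* (+ r) (v i)) ⟩
          σ * (r * ∣ v i ∣)     ≤⟨ ℕ.*-monoʳ-≤ σ (ℕ.*-mono-≤ (ℕ.<⇒≤ (m%n<n n W)) (v≤ i)) ⟩
          σ * (W * (2 * S))     ≡⟨ lem σ W S ⟩
          L * W                 ≤⟨ w-small i₀ ⟩
          p                     ∎
          where
          lem : ∀ σ W S → σ * (W * (2 * S)) ≡ 2 * (σ * S) * W
          lem = ℕ-Ring.solve-∀
        B-small : σ * (j * s * q) ≤ p
        B-small = begin
          σ * (j * s * q)    ≤⟨ ℕ.*-monoʳ-≤ σ (ℕ.*-mono-≤ (ℕ.*-monoʳ-≤ j s≤S) q≤Q) ⟩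
          σ * (j * S * Q)    ≡⟨ lem σ j S Q ⟩
          j * E              ≤⟨ ℕ.*-monoʳ-≤ j E≤W ⟩
          j * W              ≤⟨ jW≤p ⟩
          p                  ∎
          where
          lem : ∀ σ j S Q → σ * (j * S * Q) ≡ j * (σ * (S * Q))
          lem = ℕ-Ring.solve-∀
        C-small : ∀ i → σ * ∣ + j ⊗ (⊖ err i) ∣ ≤ p
        C-small i = begin
          σ * ∣ + j ⊗ (⊖ err i) ∣  ≡⟨ cong (σ *_) (trans (ℤ.abs-* (+ j) (⊖ err i)) (cong (j *_) (ℤ.∣-i∣≡∣i∣ (err i)))) ⟩
          σ * (j * ∣ err i ∣)      ≡⟨ lem σ j ∣ err i ∣ ⟩
          j * (σ * ∣ err i ∣)      ≤⟨ ℕ.*-monoʳ-≤ j (err-small i) ⟩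
          j * W                    ≤⟨ jW≤p ⟩
          p                        ∎
          where
          lem : ∀ σ j e → σ * (j * e) ≡ j * (σ * e)
          lem = ℕ-Ring.solve-∀

      N-line : ∀ t → σ * N (t *ᵛ X.u′ i₀) ≤ K * (p * ν) + (2 * d + 1) * (p * ν)
      N-line t = subst (λ e → σ * e ≤ _) (N-cong λ i → ≈-sym (≈-trans (⊗-congˡ t (X.u′-new i)) (⊗-congʳ (comb v u i) t≈)))
                   (N-line-ℕ (t %ℕ p) (n%ℕd<d t p))
        where
        t≈ : t ≈ + (t %ℕ p)
        t≈ = mod (t /ℕ p) (a≡a%ℕn+[a/ℕn]*n t p)

      -- The filled direction replaces `u i₀` and is then dropped. As the exchange preserves the
      -- projection, the remainder of `x` grows only by a multiple of that direction, where `N` is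
      -- small.
      filled : Frame k (step d K)
      filled .Frame.γ = X.γ′ ∘ punchIn i₀
      filled .Frame.u = X.u′ ∘ punchIn i₀
      filled .Frame.dual = drop-dual i₀ X.dual′
      filled .Frame.cheap j = subst (_≤ ν) (sym (N-cong (X.u′-old (Fin.punchInᵢ≢i i₀ j)))) (cheap (punchIn i₀ j))
      filled .Frame.rest x = begin
        σ * N (x -ᵛ project (X.γ′ ∘ punchIn i₀) (X.u′ ∘ punchIn i₀) x)
          ≡⟨ cong (σ *_) (N-cong eq) ⟩
        σ * N ((x -ᵛ project γ u x) +ᵛ t *ᵛ X.u′ i₀)
          ≤⟨ ℕ.*-monoʳ-≤ σ (N-+ (x -ᵛ project γ u x) (t *ᵛ X.u′ i₀)) ⟩
        σ * (N (x -ᵛ project γ u x) + N (t *ᵛ X.u′ i₀))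
          ≡⟨ ℕ.*-distribˡ-+ σ (N (x -ᵛ project γ u x)) (N (t *ᵛ X.u′ i₀)) ⟩
        σ * N (x -ᵛ project γ u x) + σ * N (t *ᵛ X.u′ i₀)
          ≤⟨ ℕ.+-mono-≤ (rest x) (N-line t) ⟩
        K * (p * ν) + (K * (p * ν) + (2 * d + 1) * (p * ν))
          ≡⟨ lem K d (p * ν) ⟩
        step d K * (p * ν) ∎
        where
        open ℕ.≤-Reasoning
        t = dot (X.γ′ i₀) x
        lem : ∀ K d t → K * t + (K * t + (2 * d + 1) * t) ≡ (K + (K + (2 * d + 1))) * t
        lem = ℕ-Ring.solve-∀
        eq : x -ᵛ project (X.γ′ ∘ punchIn i₀) (X.u′ ∘ punchIn i₀) x ≋ (x -ᵛ project γ u x) +ᵛ t *ᵛ X.u′ i₀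
        eq i = ≈-trans (≡⇒≈ (trans (lem′ (x i) P (t ⊗ X.u′ i₀ i)) (cong (λ e → (x i ⊝ e) ⊕ t ⊗ X.u′ i₀ i) (sym (sum-remove (λ j → dot (X.γ′ j) x ⊗ X.u′ j i) i₀)))))
                 (⊕-cong (⊝-congˡ (x i) (X.project′ x i)) (≈-refl {t ⊗ X.u′ i₀ i}))
          where
          P = project (X.γ′ ∘ punchIn i₀) (X.u′ ∘ punchIn i₀) x i
          lem′ : ∀ x P e → x ⊝ P ≡ (x ⊝ (e ⊕ P)) ⊕ e
          lem′ = solve-∀

    -- Some `q ≤ Q` always makes all coordinates of `qa` at most `p / L`. If the largest reaches
    -- `E`, a line can be filled; if not, all coordinates are bounded. Reporting the coordinate of
    -- index 0 makes the form the same for every `a`.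
    fill-or-near : ∀ {k K} → suc k ≤ d → (F : Frame (suc k) K) → ∀ a → N a ≤ ν →
                   Frame k (step d K) ⊎ NearHyperplane (Frame.γ F Fin.zero) a
    fill-or-near {k} k<d F a Na =
      let open Frame F
          q , 1≤q , q≤ , w , m , qa , w-small = dirichlet (suc k) L p (λ i → dot (γ i) a)
          i₀ , w-max = argmax (λ i → ∣ w i ∣)
          q≤Q = ℕ.≤-trans q≤ (Q-bound k<d)
      in [ (λ E≤W → inj₁ (Fill.filled k<d F a Na q q≤Q w m qa w-small i₀ w-max E≤W))
         , (λ W≤E → inj₂ (q , w Fin.zero , 1≤q , q≤Q , ℕ.≤-trans (w-max Fin.zero) W≤E , mod (m Fin.zero) (qa Fin.zero)))
         ]′ (ℕ.≤-total E ∣ w i₀ ∣)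

    fill-or-slab : ∀ {k K} → suc k ≤ d → Frame (suc k) K → ∀ {as} → All (λ a → N a ≤ ν) as →
                   Frame k (step d K) ⊎ Slab as
    fill-or-slab {k} {K} k<d F Nas = Sum.map₂ (λ near → γ Fin.zero , (u Fin.zero , normalised) , near) (search Nas)
      where
      open Frame F
      normalised : dot (γ Fin.zero) (u Fin.zero) ≈ 1ℤ
      normalised = ≈-trans (pairing dual Fin.zero Fin.zero) (≡⇒≈ (δ-refl {suc k} Fin.zero))
      search : ∀ {as} → All (λ a → N a ≤ ν) as → Frame k (step d K) ⊎ All (NearHyperplane (γ Fin.zero)) as
      search [] = inj₂ []
      search (Na ∷ Nas) with fill-or-near k<d F _ Na
      ... | inj₁ F′ = inj₁ F′
      ... | inj₂ near = Sum.map₂ (near ∷_) (search Nas)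

    fill-all : ∀ k {K} → k ≤ d → Frame k K → ∀ {as} → All (λ a → N a ≤ ν) as → Frame 0 (steps d k K) ⊎ Slab as
    fill-all zero    k≤d F Nas = inj₁ F
    fill-all (suc k) k<d F Nas with fill-or-slab k<d F Nas
    ... | inj₁ F′ = fill-all k (ℕ.<⇒≤ k<d) F′ Nas
    ... | inj₂ slab = inj₂ slab

    -- The basis is complete at every stage, starting from the standard one, and only its first `n`
    -- vectors are cheap. The form dual to the next vector vanishes on these, so an element on which
    -- it does not vanish can enter; if there is none, all elements lie in its kernel.
    record PartialBasis (n : ℕ) : Set where
      field
        γ u   : Fin d → V d
        dual  : Dual γ u
        spans : ∀ x → project γ u x ≋ x
        cheap : ∀ i → toℕ i < n → N (u i) ≤ ν

    exchange-or-slab : ∀ {n} → n < d → PartialBasis n → ∀ {as} → All (λ a → N a ≤ ν) as → PartialBasis (suc n) ⊎ Slab as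
    exchange-or-slab {n} n<d B Nas = Sum.map₂ (λ near → γ i₀ , (u i₀ , normalised) , near) (search Nas)
      where
      open PartialBasis B
      i₀ = fromℕ< n<d
      normalised : dot (γ i₀) (u i₀) ≈ 1ℤ
      normalised = ≈-trans (pairing dual i₀ i₀) (≡⇒≈ (δ-refl i₀))
      exchange : ∀ a → N a ≤ ν → ¬ (dot (γ i₀) a ≈ 0ℤ) → PartialBasis (suc n)
      exchange a Na a≉0 = record
        { γ = X.γ′ ; u = X.u′ ; dual = X.dual′
        ; spans = λ x → ≋-trans (X.project′ x) (spans x)
        ; cheap = cheap′ }
        where
        y,vy = inverse pp (dot (γ i₀) a) a≉0
        module X = Exchange γ u dual (λ j → dot (γ j) a) i₀ (proj₁ y,vy) (proj₂ y,vy)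
        cheap′ : ∀ i → toℕ i < suc n → N (X.u′ i) ≤ ν
        cheap′ i i≤n = go (i Fin.≟ i₀)
          where
          go : Dec (i ≡ i₀) → N (X.u′ i) ≤ ν
          go (yes refl) = subst (_≤ ν) (sym (N-cong (≋-trans X.u′-new (spans a)))) Na
          go (no i≢i₀) = subst (_≤ ν) (sym (N-cong (X.u′-old i≢i₀)))
            (cheap i (ℕ.≤∧≢⇒< (ℕ.≤-pred i≤n) (λ i≡n → i≢i₀ (Fin.toℕ-injective (trans i≡n (sym (Fin.toℕ-fromℕ< n<d)))))))
      search : ∀ {as} → All (λ a → N a ≤ ν) as → PartialBasis (suc n) ⊎ All (NearHyperplane (γ i₀)) as
      search [] = inj₂ []
      search {a ∷ _} (Na ∷ Nas) with ≈0? (dot (γ i₀) a)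
      ... | no a≉0 = inj₁ (exchange a Na a≉0)
      ... | yes a≈0 = Sum.map₂ ((1 , 0ℤ , ℕ.≤-refl , 1≤Q , z≤n , ≈-trans (≡⇒≈ (ℤ.*-identityˡ (dot (γ i₀) a))) a≈0) ∷_) (search Nas)

    basis-or-slab : ∀ n → n ≤ d → ∀ {as} → All (λ a → N a ≤ ν) as → PartialBasis n ⊎ Slab as
    basis-or-slab zero n≤d Nas = inj₁ record
      { γ = δ ; u = δ
      ; dual = mkDual λ i j → ≡⇒≈ (trans (dot-δ i (δ j)) (δ-sym j i))
      ; spans = λ x i → ≈-trans (comb-congˡ δ (λ j → ≡⇒≈ (dot-δ j x)) i) (≡⇒≈ (comb-δ x i))
      ; cheap = λ _ () }
    basis-or-slab (suc n) n<d Nas with basis-or-slab n (ℕ.<⇒≤ n<d) Nas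
    ... | inj₁ B = exchange-or-slab n<d B Nas
    ... | inj₂ slab = inj₂ slab

    cover-or-slab : ∀ {as} → All (λ a → N a ≤ ν) as → (∀ x → σ * N x ≤ steps d d 0 * (p * ν)) ⊎ Slab as
    cover-or-slab Nas with basis-or-slab d ℕ.≤-refl Nas
    ... | inj₂ slab = inj₂ slab
    ... | inj₁ B = Sum.map₁ covered (fill-all d ℕ.≤-refl frame Nas)
      where
      open PartialBasis B
      frame : Frame d 0
      frame = record
        { γ = γ ; u = u ; dual = dual ; cheap = λ i → cheap i (Fin.toℕ<n i)
        ; rest = λ x → ℕ.≤-reflexive (trans (cong (σ *_) (trans (N-cong (λ i → ≈-trans (⊝-congˡ (x i) (spans x i)) (≡⇒≈ (ℤ.+-inverseʳ (x i))))) N-0)) (ℕ.*-zeroʳ σ)) }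
      covered : Frame 0 (steps d d 0) → ∀ x → σ * N x ≤ steps d d 0 * (p * ν)
      covered F x = subst (λ t → σ * t ≤ steps d d 0 * (p * ν)) (N-cong (λ i → ≡⇒≈ (ℤ.+-identityʳ (x i)))) (Frame.rest F x)

-- Sums over (ℤ/p)ᵈ

Σ< : ℕ → (ℕ → ℕ) → ℕ
Σ< zero    g = 0
Σ< (suc n) g = Σ< n g + g n

Σ<-cong : ∀ n {f g : ℕ → ℕ} → (∀ i → f i ≡ g i) → Σ< n f ≡ Σ< n g
Σ<-cong zero    e = refl
Σ<-cong (suc n) e = cong₂ _+_ (Σ<-cong n e) (e n)

Σ<-mono : ∀ n {f g : ℕ → ℕ} → (∀ i → f i ≤ g i) → Σ< n f ≤ Σ< n g
Σ<-mono zero    e = z≤n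
Σ<-mono (suc n) e = ℕ.+-mono-≤ (Σ<-mono n e) (e n)

Σ<-+ : ∀ n (f g : ℕ → ℕ) → Σ< n (λ i → f i + g i) ≡ Σ< n f + Σ< n g
Σ<-+ zero    f g = refl
Σ<-+ (suc n) f g = trans (cong (_+ (f n + g n)) (Σ<-+ n f g)) (lem (Σ< n f) (Σ< n g) (f n) (g n))
  where
  lem : ∀ a b c d → a + b + (c + d) ≡ a + c + (b + d)
  lem = ℕ-Ring.solve-∀

Σ<-const : ∀ n c → Σ< n (λ _ → c) ≡ n * c
Σ<-const zero    c = refl
Σ<-const (suc n) c = trans (cong (_+ c) (Σ<-const n c)) (ℕ.+-comm (n * c) c)

Σ<-* : ∀ n c (f : ℕ → ℕ) → Σ< n (λ i → c * f i) ≡ c * Σ< n f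
Σ<-* zero    c f = sym (ℕ.*-zeroʳ c)
Σ<-* (suc n) c f = trans (cong (_+ c * f n) (Σ<-* n c f)) (sym (ℕ.*-distribˡ-+ c (Σ< n f) (f n)))

Σ<-rotate : ∀ n (g : ℕ → ℕ) → Σ< n (g ∘ suc) + g 0 ≡ Σ< n g + g n
Σ<-rotate zero    g = refl
Σ<-rotate (suc n) g = begin
  Σ< n (g ∘ suc) + g (suc n) + g 0   ≡⟨ lem (Σ< n (g ∘ suc)) (g (suc n)) (g 0) ⟩
  (Σ< n (g ∘ suc) + g 0) + g (suc n) ≡⟨ cong (_+ g (suc n)) (Σ<-rotate n g) ⟩
  Σ< n g + g n + g (suc n)           ∎
  where
  open ≡-Reasoning
  lem : ∀ a b c → a + b + c ≡ a + c + b
  lem = ℕ-Ring.solve-∀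

Σ<-exists : ∀ n (f g : ℕ → ℕ) → Σ< n f < Σ< n g → Σ ℕ λ i → f i < g i
Σ<-exists (suc n) f g lt with ℕ.<-≤-connex (f n) (g n)
... | inj₁ fn<gn = n , fn<gn
... | inj₂ gn≤fn = Σ<-exists n f g (ℕ.+-cancelʳ-< (f n) _ _ (ℕ.<-≤-trans lt (ℕ.+-monoʳ-≤ (Σ< n g) gn≤fn)))

cons : ∀ {d} → ℤ → V d → V (suc d)
cons a v Fin.zero    = a
cons a v (Fin.suc i) = v i

module Counting (p : ℕ) {{_ : NonZero p}} where
  open Mod p

  S : ∀ d → (V d → ℕ) → ℕ
  S zero    g = g 0ᵛ
  S (suc d) g = Σ< p (λ i → S d (λ v → g (cons (+ i) v)))

  S-cong : ∀ d {f g : V d → ℕ} → (∀ x → f x ≡ g x) → S d f ≡ S d g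
  S-cong zero    e = e 0ᵛ
  S-cong (suc d) e = Σ<-cong p (λ i → S-cong d (λ v → e (cons (+ i) v)))

  S-mono : ∀ d {f g : V d → ℕ} → (∀ x → f x ≤ g x) → S d f ≤ S d g
  S-mono zero    e = e 0ᵛ
  S-mono (suc d) e = Σ<-mono p (λ i → S-mono d (λ v → e (cons (+ i) v)))

  S-+ : ∀ d (f g : V d → ℕ) → S d (λ x → f x + g x) ≡ S d f + S d g
  S-+ zero    f g = refl
  S-+ (suc d) f g = trans (Σ<-cong p (λ i → S-+ d (λ v → f (cons (+ i) v)) (λ v → g (cons (+ i) v)))) (Σ<-+ p _ _)

  S-* : ∀ d c (f : V d → ℕ) → S d (λ x → c * f x) ≡ c * S d f
  S-* zero    c f = refl
  S-* (suc d) c f = trans (Σ<-cong p (λ i → S-* d c (λ v → f (cons (+ i) v)))) (Σ<-* p c _)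

  S-const : ∀ d c → S d (λ _ → c) ≡ p ^ d * c
  S-const zero    c = sym (ℕ.*-identityˡ c)
  S-const (suc d) c = trans (Σ<-cong p (λ _ → S-const d c)) (trans (Σ<-const p (p ^ d * c)) (sym (ℕ.*-assoc p (p ^ d) c)))

  S-Σ< : ∀ d n (f : ℕ → V d → ℕ) → S d (λ x → Σ< n (λ i → f i x)) ≡ Σ< n (λ i → S d (f i))
  S-Σ< d zero    f = trans (S-const d 0) (ℕ.*-zeroʳ (p ^ d))
  S-Σ< d (suc n) f = trans (S-+ d (λ x → Σ< n (λ i → f i x)) (f n)) (cong (_+ S d (f n)) (S-Σ< d n f))

  S-swap : ∀ d e (f : V d → V e → ℕ) → S d (λ x → S e (f x)) ≡ S e (λ y → S d (λ x → f x y))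
  S-swap zero    e f = refl
  S-swap (suc d) e f = trans (Σ<-cong p (λ i → S-swap d e (λ v → f (cons (+ i) v)))) (sym (S-Σ< e p _))

  S-exists : ∀ d (f g : V d → ℕ) → S d f < S d g → Σ (V d) λ x → f x < g x
  S-exists zero    f g lt = 0ᵛ , lt
  S-exists (suc d) f g lt with Σ<-exists p _ _ lt
  ... | i , lt′ with S-exists d _ _ lt′
  ... | v , lt″ = cons (+ i) v , lt″

  S-at-0 : ∀ d (g : V d → ℕ) → (∀ {x y} → x ≋ y → g x ≡ g y) → g 0ᵛ ≤ S d g
  S-at-0 zero    g g-cong = ℕ.≤-refl
  S-at-0 (suc d) g g-cong = ℕ.≤-trans
    (ℕ.≤-trans (ℕ.≤-reflexive (g-cong {0ᵛ} {cons 0ℤ 0ᵛ} (λ { Fin.zero → ≈-refl ; (Fin.suc i) → ≈-refl })))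
               (S-at-0 d (λ v → g (cons 0ℤ v)) (λ e → g-cong (λ { Fin.zero → ≈-refl ; (Fin.suc i) → e i }))))
    (head≤ p (λ i → S d (λ v → g (cons (+ i) v))))
    where
    head≤ : ∀ n {{_ : NonZero n}} h → h 0 ≤ Σ< n h
    head≤ (suc zero)    h = ℕ.≤-refl
    head≤ (suc (suc n)) h = ℕ.≤-trans (head≤ (suc n) h) (ℕ.m≤m+n (Σ< (suc n) h) (h (suc n)))

  -- A shift by one exchanges the term at 0 for the congruent term at `p`; an arbitrary shift is
  -- first replaced by its residue.
  Σ<-shift : (h : ℤ → ℕ) → (∀ {x y} → x ≈ y → h x ≡ h y) → ∀ z → Σ< p (λ i → h (+ i ⊕ z)) ≡ Σ< p (λ i → h (+ i))
  Σ<-shift h h-cong z = trans (Σ<-cong p (λ i → h-cong (⊕-congˡ (+ i) {z} {+ (z %ℕ p)} (mod (z /ℕ p) (a≡a%ℕn+[a/ℕn]*n z p))))) (natural (z %ℕ p))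
    where
    natural : ∀ n → Σ< p (λ i → h (+ i ⊕ + n)) ≡ Σ< p (λ i → h (+ i))
    natural zero = Σ<-cong p (λ i → cong h (ℤ.+-identityʳ (+ i)))
    natural (suc n) = trans (ℕ.+-cancelʳ-≡ (g 0) _ _ (begin
      Σ< p (λ i → h (+ i ⊕ + suc n)) + g 0  ≡⟨ cong (_+ g 0) (Σ<-cong p (λ i → cong h (cong +_ (ℕ.+-suc i n)))) ⟩
      Σ< p (g ∘ suc) + g 0                  ≡⟨ Σ<-rotate p g ⟩
      Σ< p g + g p                          ≡⟨ cong (λ t → Σ< p g + t) (h-cong (mod 1ℤ (lem (+ p) (+ n)))) ⟩
      Σ< p g + g 0                          ∎)) (natural n)
      where
      open ≡-Reasoning
      g : ℕ → ℕ
      g i = h (+ i ⊕ + n)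
      lem : ∀ p n → p ⊕ n ≡ (0ℤ ⊕ n) ⊕ 1ℤ ⊗ p
      lem = solve-∀

  S-shift : ∀ d (g : V d → ℕ) → (∀ {x y} → x ≋ y → g x ≡ g y) → ∀ z → S d (λ x → g (x +ᵛ z)) ≡ S d g
  S-shift zero    g g-cong z = g-cong (λ ())
  S-shift (suc d) g g-cong z = begin
    Σ< p (λ i → S d (λ v → g (cons (+ i) v +ᵛ z)))
      ≡⟨ Σ<-cong p (λ i → S-cong d (λ v → g-cong (λ { Fin.zero → ≈-refl ; (Fin.suc j) → ≈-refl }))) ⟩
    Σ< p (λ i → S d (λ v → g (cons (+ i ⊕ z Fin.zero) (v +ᵛ (z ∘ Fin.suc)))))
      ≡⟨ Σ<-cong p (λ i → S-shift d (λ v → g (cons (+ i ⊕ z Fin.zero) v)) (λ e → g-cong (λ { Fin.zero → ≈-refl ; (Fin.suc j) → e j })) (z ∘ Fin.suc)) ⟩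
    Σ< p (λ i → S d (λ v → g (cons (+ i ⊕ z Fin.zero) v)))
      ≡⟨ Σ<-shift (λ t → S d (λ v → g (cons t v))) (λ e → S-cong d (λ v → g-cong (λ { Fin.zero → e ; (Fin.suc j) → ≈-refl }))) (z Fin.zero) ⟩
    Σ< p (λ i → S d (λ v → g (cons (+ i) v))) ∎
    where open ≡-Reasoning

  -- Subsets of (ℤ/p)ᵈ

  [_] : Bool → ℕ
  [ true ]  = 1
  [ false ] = 0

  record Subset (d : ℕ) : Set where
    field
      mem : V d → Bool
      mem-cong : ∀ {x y} → x ≋ y → mem x ≡ mem y

  open Subset public

  size : ∀ {d} → Subset d → ℕ
  size {d} Y = S d (λ x → [ mem Y x ])

  module _ {d} (Y : Subset d) where

    leaving staying : V d → ℕ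
    leaving z = S d (λ x → [ mem Y x ∧ not (mem Y (x +ᵛ z)) ])
    staying z = S d (λ x → [ mem Y x ∧ mem Y (x +ᵛ z) ])

    leaving+staying : ∀ z → leaving z + staying z ≡ size Y
    leaving+staying z = trans (sym (S-+ d _ _)) (S-cong d (λ x → lem (mem Y x) (mem Y (x +ᵛ z))))
      where
      lem : ∀ a b → [ a ∧ not b ] + [ a ∧ b ] ≡ [ a ]
      lem false _     = refl
      lem true  false = refl
      lem true  true  = refl

    mem-cong₂ : (f : Bool → Bool → ℕ) (a b : V d) → ∀ {x y} → x ≋ y → f (mem Y (x +ᵛ a)) (mem Y (x +ᵛ b)) ≡ f (mem Y (y +ᵛ a)) (mem Y (y +ᵛ b))
    mem-cong₂ f a b e = cong₂ f (mem-cong Y (λ i → ⊕-cong (e i) ≈-refl)) (mem-cong Y (λ i → ⊕-cong (e i) ≈-refl))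

    S-shift₂ : (f : Bool → Bool → ℕ) (a b c a′ b′ : V d) → a +ᵛ c ≋ a′ → b +ᵛ c ≋ b′ →
               S d (λ x → f (mem Y (x +ᵛ a)) (mem Y (x +ᵛ b))) ≡ S d (λ x → f (mem Y (x +ᵛ a′)) (mem Y (x +ᵛ b′)))
    S-shift₂ f a b c a′ b′ ea eb = trans (sym (S-shift d _ (mem-cong₂ f a b) c))
      (S-cong d (λ x → cong₂ f (mem-cong Y (λ i → ≈-trans (≡⇒≈ (lem (x i) (c i) (a i))) (⊕-congˡ (x i) (ea i))))
                               (mem-cong Y (λ i → ≈-trans (≡⇒≈ (lem (x i) (c i) (b i))) (⊕-congˡ (x i) (eb i))))))
      where
      lem : ∀ x c a → (x ⊕ c) ⊕ a ≡ x ⊕ (a ⊕ c)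
      lem = solve-∀

    mem-0 : ∀ x → mem Y (x +ᵛ 0ᵛ) ≡ mem Y x
    mem-0 x = mem-cong Y (λ i → ≡⇒≈ (ℤ.+-identityʳ (x i)))

    size-0 : (f : Bool → Bool → ℕ) (b : V d) → S d (λ x → f (mem Y (x +ᵛ 0ᵛ)) (mem Y (x +ᵛ b))) ≡ S d (λ x → f (mem Y x) (mem Y (x +ᵛ b)))
    size-0 f b = S-cong d (λ x → cong (λ t → f t (mem Y (x +ᵛ b))) (mem-0 x))

    staying-neg : ∀ z → staying (-ᵛ z) ≡ staying z
    staying-neg z = begin
      S d (λ x → [ mem Y x ∧ mem Y (x +ᵛ -ᵛ z) ])                ≡⟨ sym (size-0 (λ a b → [ a ∧ b ]) (-ᵛ z)) ⟩
      S d (λ x → [ mem Y (x +ᵛ 0ᵛ) ∧ mem Y (x +ᵛ -ᵛ z) ])        ≡⟨ S-shift₂ (λ a b → [ a ∧ b ]) 0ᵛ (-ᵛ z) z z 0ᵛ (λ i → ≡⇒≈ (ℤ.+-identityˡ (z i))) (λ i → ≡⇒≈ (ℤ.+-inverseˡ (z i))) ⟩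
      S d (λ x → [ mem Y (x +ᵛ z) ∧ mem Y (x +ᵛ 0ᵛ) ])           ≡⟨ S-cong d (λ x → cong [_] (trans (∧-comm (mem Y (x +ᵛ z)) _) (cong (_∧ mem Y (x +ᵛ z)) (mem-0 x)))) ⟩
      S d (λ x → [ mem Y x ∧ mem Y (x +ᵛ z) ])                   ∎
      where open ≡-Reasoning

    leaving-cong : ∀ {x y} → x ≋ y → leaving x ≡ leaving y
    leaving-cong e = S-cong d (λ x → cong (λ t → [ mem Y x ∧ not t ]) (mem-cong Y (λ i → ⊕-congˡ (x i) (e i))))

    leaving-neg : ∀ z → leaving (-ᵛ z) ≡ leaving z
    leaving-neg z = ℕ.+-cancelʳ-≡ (staying z) _ _ (trans (cong (λ t → leaving (-ᵛ z) + t) (sym (staying-neg z))) (trans (leaving+staying (-ᵛ z)) (sym (leaving+staying z))))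

    leaving-0 : leaving 0ᵛ ≡ 0
    leaving-0 = trans (S-cong d (λ x → trans (cong (λ t → [ mem Y x ∧ not t ]) (mem-0 x)) (cong [_] (∧-inverseʳ (mem Y x))))) (trans (S-const d 0) (ℕ.*-zeroʳ (p ^ d)))

    -- A point that is outside `Y` after moving by `a + b` left either during the move by `a`, or
    -- during the move by `b` that starts at `x + a`. Translation by `a` turns the second count into
    -- `leaving b`.
    leaving-+ : ∀ a b → leaving (a +ᵛ b) ≤ leaving a + leaving b
    leaving-+ a b = begin
      leaving (a +ᵛ b)
        ≤⟨ S-mono d (λ x → lem (mem Y x) (mem Y (x +ᵛ a)) (mem Y (x +ᵛ (a +ᵛ b)))) ⟩
      S d (λ x → [ mem Y x ∧ not (mem Y (x +ᵛ a)) ] + [ mem Y (x +ᵛ a) ∧ not (mem Y (x +ᵛ (a +ᵛ b))) ])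
        ≡⟨ S-+ d _ _ ⟩
      leaving a + S d (λ x → [ mem Y (x +ᵛ a) ∧ not (mem Y (x +ᵛ (a +ᵛ b))) ])
        ≡⟨ cong (λ t → leaving a + t) (trans (sym (S-shift₂ f 0ᵛ b a a (a +ᵛ b) (λ i → ≡⇒≈ (ℤ.+-identityˡ (a i))) (λ i → ≡⇒≈ (ℤ.+-comm (b i) (a i))))) (size-0 f b)) ⟩
      leaving a + leaving b ∎
      where
      open ℕ.≤-Reasoning
      f : Bool → Bool → ℕ
      f s t = [ s ∧ not t ]
      lem : ∀ s t r → [ s ∧ not r ] ≤ [ s ∧ not t ] + [ t ∧ not r ]
      lem false t     r     = z≤n
      lem true  false false = s≤s z≤n
      lem true  false true  = z≤n
      lem true  true  r     = ℕ.≤-refl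

    translates : V d → V d → Subset d
    mem (translates a b) x = mem Y (x -ᵛ a) ∨ mem Y (x -ᵛ b)
    mem-cong (translates a b) e = cong₂ _∨_ (mem-cong Y (λ i → ⊝-cong (e i) ≈-refl)) (mem-cong Y (λ i → ⊝-cong (e i) ≈-refl))

    -- After a translation by `a`, the new points are those outside `Y` reached from `Y` by `b - a`;
    -- moving them back gives the points of `Y` that leave it under `b - a`.
    size-translates : ∀ a b → size (translates a b) ≡ size Y + leaving (b -ᵛ a)
    size-translates a b = begin
      S d (λ x → [ mem Y (x +ᵛ -ᵛ a) ∨ mem Y (x +ᵛ -ᵛ b) ])
        ≡⟨ S-shift₂ (λ s t → [ s ∨ t ]) (-ᵛ a) (-ᵛ b) a 0ᵛ (a -ᵛ b) (λ i → ≡⇒≈ (ℤ.+-inverseˡ (a i))) (λ i → ≡⇒≈ (ℤ.+-comm (⊖ b i) (a i))) ⟩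
      S d (λ x → [ mem Y (x +ᵛ 0ᵛ) ∨ mem Y (x +ᵛ (a -ᵛ b)) ])
        ≡⟨ size-0 (λ s t → [ s ∨ t ]) (a -ᵛ b) ⟩
      S d (λ x → [ mem Y x ∨ mem Y (x +ᵛ (a -ᵛ b)) ])
        ≡⟨ S-cong d (λ x → lem (mem Y x) (mem Y (x +ᵛ (a -ᵛ b)))) ⟩
      S d (λ x → [ mem Y x ] + [ mem Y (x +ᵛ (a -ᵛ b)) ∧ not (mem Y x) ])
        ≡⟨ S-+ d _ _ ⟩
      size Y + S d (λ x → [ mem Y (x +ᵛ (a -ᵛ b)) ∧ not (mem Y x) ])
        ≡⟨ cong (λ t → size Y + t) (trans (sym (size-0 g (a -ᵛ b)))
             (trans (S-shift₂ g 0ᵛ (a -ᵛ b) (b -ᵛ a) (b -ᵛ a) 0ᵛ (λ i → ≡⇒≈ (ℤ.+-identityˡ ((b -ᵛ a) i))) (λ i → ≡⇒≈ (lem′ (a i) (b i))))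
                    (S-cong d (λ x → cong (λ t → [ t ∧ not (mem Y (x +ᵛ (b -ᵛ a))) ]) (mem-0 x))))) ⟩
      size Y + leaving (b -ᵛ a) ∎
      where
      open ≡-Reasoning
      g : Bool → Bool → ℕ
      g s t = [ t ∧ not s ]
      lem : ∀ s t → [ s ∨ t ] ≡ [ s ] + [ t ∧ not s ]
      lem false false = refl
      lem false true  = refl
      lem true  false = refl
      lem true  true  = refl
      lem′ : ∀ a b → (a ⊝ b) ⊕ (b ⊝ a) ≡ 0ℤ
      lem′ = solve-∀

    -- Averaging over z: the mean of staying is (size Y)²/pᵈ.
    sum-staying : S d staying ≡ size Y * size Y
    sum-staying = begin
      S d (λ z → S d (λ x → [ mem Y x ∧ mem Y (x +ᵛ z) ]))
        ≡⟨ S-swap d d _ ⟩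
      S d (λ x → S d (λ z → [ mem Y x ∧ mem Y (x +ᵛ z) ]))
        ≡⟨ S-cong d (λ x → S-cong d (λ z → lem (mem Y x) (mem Y (x +ᵛ z)))) ⟩
      S d (λ x → S d (λ z → [ mem Y x ] * [ mem Y (x +ᵛ z) ]))
        ≡⟨ S-cong d (λ x → S-* d [ mem Y x ] (λ z → [ mem Y (x +ᵛ z) ])) ⟩
      S d (λ x → [ mem Y x ] * S d (λ z → [ mem Y (x +ᵛ z) ]))
        ≡⟨ S-cong d (λ x → cong ([ mem Y x ] *_) (translate x)) ⟩
      S d (λ x → [ mem Y x ] * size Y)
        ≡⟨ S-cong d (λ x → ℕ.*-comm [ mem Y x ] (size Y)) ⟩
      S d (λ x → size Y * [ mem Y x ])
        ≡⟨ S-* d (size Y) _ ⟩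
      size Y * size Y ∎
      where
      open ≡-Reasoning
      lem : ∀ a b → [ a ∧ b ] ≡ [ a ] * [ b ]
      lem false b = refl
      lem true  b = sym (ℕ.*-identityˡ [ b ])
      translate : ∀ x → S d (λ z → [ mem Y (x +ᵛ z) ]) ≡ size Y
      translate x = trans (S-cong d (λ z → cong [_] (mem-cong Y (λ i → ≡⇒≈ (ℤ.+-comm (x i) (z i))))))
                          (S-shift d (λ z → [ mem Y z ]) (λ e → cong [_] (mem-cong Y e)) x)

    -- If fewer than half of the points left under every `z`, then `staying` would always exceed
    -- `size Y / 2`; but its mean is `size Y` times the density of `Y`, which is at most one half.
    not-all-leaving-small : 2 * size Y ≤ p ^ d → 1 ≤ size Y → ¬ (∀ z → 2 * leaving z < size Y)
    not-all-leaving-small 2Y≤ 1≤Y small = ℕ.<-irrefl refl (begin-strict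
      p ^ d * size Y               ≡⟨ sym (S-const d (size Y)) ⟩
      S d (λ _ → size Y)           <⟨ S-strict ⟩
      S d (λ z → 2 * staying z)    ≡⟨ S-* d 2 staying ⟩
      2 * S d staying              ≡⟨ trans (cong (2 *_) sum-staying) (sym (ℕ.*-assoc 2 (size Y) (size Y))) ⟩
      2 * size Y * size Y          ≤⟨ ℕ.*-monoˡ-≤ (size Y) 2Y≤ ⟩
      p ^ d * size Y               ∎)
      where
      open ℕ.≤-Reasoning
      pointwise : ∀ z → suc (size Y) ≤ 2 * staying z
      pointwise z = ℕ.+-cancelˡ-< (2 * leaving z) _ _ (begin-strict
        2 * leaving z + size Y              <⟨ ℕ.+-monoˡ-< (size Y) (small z) ⟩
        size Y + size Y                     ≡⟨ cong (λ t → t + t) (sym (leaving+staying z)) ⟩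
        (leaving z + staying z) + (leaving z + staying z) ≡⟨ lem (leaving z) (staying z) ⟩
        2 * leaving z + 2 * staying z       ∎)
        where
        lem : ∀ a b → (a + b) + (a + b) ≡ 2 * a + 2 * b
        lem = ℕ-Ring.solve-∀
      S-strict : S d (λ _ → size Y) < S d (λ z → 2 * staying z)
      S-strict = begin-strict
        S d (λ _ → size Y)           ≡⟨ S-const d (size Y) ⟩
        p ^ d * size Y               <⟨ ℕ.*-monoʳ-< (p ^ d) {{ℕ.m^n≢0 p d}} (ℕ.n<1+n (size Y)) ⟩
        p ^ d * suc (size Y)         ≡⟨ sym (S-const d (suc (size Y))) ⟩
        S d (λ _ → suc (size Y))     ≤⟨ S-mono d pointwise ⟩
        S d (λ z → 2 * staying z)    ∎

-- Sums and permutations of lists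

vsum : ∀ {X : Set} {d} → (X → V d) → List X → V d
vsum f []      = 0ᵛ
vsum f (x ∷ T) = f x +ᵛ vsum f T

vsum-++ : ∀ {X : Set} {d} (f : X → V d) T U i → vsum f (T ++ U) i ≡ vsum f T i ⊕ vsum f U i
vsum-++ f []      U i = sym (ℤ.+-identityˡ (vsum f U i))
vsum-++ f (x ∷ T) U i = trans (cong (f x i ⊕_) (vsum-++ f T U i)) (sym (ℤ.+-assoc (f x i) (vsum f T i) (vsum f U i)))

vsum-neg : ∀ {X : Set} {d} (f : X → V d) T i → vsum (-ᵛ_ ∘ f) T i ≡ ⊖ vsum f T i
vsum-neg f []      i = refl
vsum-neg f (x ∷ T) i = trans (cong (⊖ f x i ⊕_) (vsum-neg f T i)) (sym (ℤ.neg-distrib-+ (f x i) (vsum f T i)))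

vsum-punchIn : ∀ {X : Set} {d} (f : X → V (suc d)) k T i → vsum (λ x → f x ∘ punchIn k) T i ≡ vsum f T (punchIn k i)
vsum-punchIn f k []      i = refl
vsum-punchIn f k (x ∷ T) i = cong (f x (punchIn k i) ⊕_) (vsum-punchIn f k T i)

length-split : ∀ {X : Set} {A T R : List X} → A ↭ T ++ R → length A ≡ length T + length R
length-split {T = T} e = trans (↭-length e) (List.length-++ T)

partition-labels : ∀ {X : Set} {M} {P : X → Fin (suc M) → Set} {as} → All (λ a → Σ (Fin (suc M)) (P a)) as →
                   Σ (List X) λ B → Σ (List X) λ C → as ↭ B ++ C ×
                   All (λ a → P a Fin.zero) B × All (λ a → Σ (Fin M) (P a ∘ Fin.suc)) C
partition-labels [] = [] , [] , ↭-refl , [] , []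
partition-labels {as = a ∷ _} ((t , pt) ∷ labels) with partition-labels labels
... | B , C , e , PB , PC with t
... | Fin.zero  = a ∷ B , C , ↭-prep a e , pt ∷ PB , PC
... | Fin.suc t′ = B , a ∷ C , ↭-trans (↭-prep a e) (↭-sym (shift a B C)) , PB , (t′ , pt) ∷ PC

pigeonhole-labels : ∀ {X : Set} M ℓ {P : X → Fin M → Set} {as} → All (λ a → Σ (Fin M) (P a)) as → M * ℓ < length as →
                    Σ (Fin M) λ t → Σ (List X) λ B → Σ (List X) λ R → as ↭ B ++ R × ℓ < length B × All (λ a → P a t) B
pigeonhole-labels zero ℓ ((() , _) ∷ _) lt
pigeonhole-labels (suc M) ℓ labels lt with partition-labels labels
... | B , C , e , PB , PC with ℕ.<-≤-connex ℓ (length B)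
... | inj₁ ℓ<B = Fin.zero , B , C , e , ℓ<B , PB
... | inj₂ B≤ℓ with pigeonhole-labels M ℓ PC (ℕ.+-cancelˡ-< ℓ (M * ℓ) (length C)
                     (ℕ.<-≤-trans lt (ℕ.≤-trans (ℕ.≤-reflexive (length-split {T = B} e)) (ℕ.+-monoˡ-≤ (length C) B≤ℓ))))
... | t , B′ , R , e′ , ℓ<B′ , PB′ = Fin.suc t , B′ , B ++ R , ↭-trans e (↭-trans (++⁺ˡ B e′) (shifts B B′)) , ℓ<B′ , PB′

-- Zero-sum subsequences of length p (Erdős–Ginzburg–Ziv)

module Blocks (p : ℕ) where
  open Mod p

  Block : ∀ {X : Set} {d} → (X → V d) → List X → Set
  Block {X} f A = Σ (List X) λ T → Σ (List X) λ R → A ↭ T ++ R × length T ≡ p × vsum f T ≋ 0ᵛ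

  -- Terms are labels of any type `X`, with vectors attached by `f`. Thus the same list can be
  -- reread with a coordinate deleted or with signs reversed, and whole blocks can serve as terms of
  -- a new sequence.
  EGZ : ℕ → ℕ → Set₁
  EGZ d ℓ = ∀ {X : Set} (f : X → V d) A → ℓ ≤ length A → Block f A

  Block-mono : ∀ {X : Set} {d} {f : X → V d} {A B R} → A ↭ B ++ R → Block f B → Block f A
  Block-mono {R = R} e (T , R′ , e′ , len , zero-sum) =
    T , R′ ++ R , ↭-trans e (↭-trans (++⁺ʳ R e′) (↭-reflexive (List.++-assoc T R′ R))) , len , zero-sum

  Block-neg : ∀ {X : Set} {d} {f : X → V d} {A} → Block (-ᵛ_ ∘ f) A → Block f A
  Block-neg {f = f} (T , R , e , len , zero-sum) =
    T , R , e , len , λ i → ≈-trans (≡⇒≈ (trans (sym (ℤ.neg-involutive (vsum f T i))) (cong ⊖_ (sym (vsum-neg f T i))))) (⊖-cong (zero-sum i))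

  dot-vsum : ∀ {X : Set} {d} (f : X → V d) (c : V d) q h {T} → All (λ x → q ⊗ dot c (f x) ≈ h) T →
             q ⊗ dot c (vsum f T) ≈ + length T ⊗ h
  dot-vsum f c q h [] = ≡⇒≈ (trans (cong (q ⊗_) (sum-zero (λ i → c i ⊗ 0ℤ) (λ i → ℤ.*-zeroʳ (c i)))) (trans (ℤ.*-zeroʳ q) (sym (ℤ.*-zeroˡ h))))
  dot-vsum f c q h {x ∷ T} (e ∷ es) = begin
    q ⊗ dot c (f x +ᵛ vsum f T)              ≡⟨ trans (cong (q ⊗_) (dot-+ʳ c (f x) (vsum f T))) (ℤ.*-distribˡ-+ q (dot c (f x)) (dot c (vsum f T))) ⟩
    q ⊗ dot c (f x) ⊕ q ⊗ dot c (vsum f T)   ≈⟨ ⊕-cong e (dot-vsum f c q h es) ⟩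
    h ⊕ + length T ⊗ h                       ≡⟨ sym (ℤ.suc-* (+ length T) h) ⟩
    + suc (length T) ⊗ h                     ∎
    where open ≈-Reasoning

  -- The sum s of p elements of the hyperplane satisfies q(c·s) ≡ ph ≡ 0, so its k-th coordinate vanishes with the others if c k ≢ 0.
  hyperplane-block : Prime p → ∀ {d ℓ} → EGZ d ℓ → ∀ {X : Set} (f : X → V (suc d)) (c w : V (suc d)) → dot c w ≈ 1ℤ →
                     ∀ q → 1 ≤ q → q < p → ∀ h B → ℓ ≤ length B → All (λ x → + q ⊗ dot c (f x) ≈ h) B → Block f B
  hyperplane-block pp {d} egz f c w cw q 1≤q q<p h B ℓ≤ onPlane = lift (egz (λ x → f x ∘ punchIn k) B ℓ≤)
    where
    nonzero : Σ (Fin (suc d)) λ i → ¬ (c i ≈ 0ℤ)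
    nonzero = Fin.¬∀⟶∃¬ (suc d) (λ i → c i ≈ 0ℤ) (λ i → ≈0? (c i))
      λ c≈0 → 1≉0 pp (≈-trans (≈-sym cw) (≈-trans (sum-cong {g = λ _ → 0ℤ} (λ i → ≈-trans (⊗-congʳ (w i) (c≈0 i)) (≡⇒≈ (ℤ.*-zeroˡ (w i))))) (≡⇒≈ (sum-zero {suc d} (λ _ → 0ℤ) (λ _ → refl)))))
    k = proj₁ nonzero
    lift : Block (λ x → f x ∘ punchIn k) B → Block f B
    lift (T , R , e , len , zero-sum) = T , R , e , len , zero-sum′
      where
      s = vsum f T
      others : ∀ i → s (punchIn k i) ≈ 0ℤ
      others i = ≈-trans (≡⇒≈ (sym (vsum-punchIn f k T i))) (zero-sum i)
      product≈0 : + q ⊗ (c k ⊗ s k) ≈ 0ℤ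
      product≈0 = begin
        + q ⊗ (c k ⊗ s k)         ≡⟨ cong (+ q ⊗_) (sym (ℤ.+-identityʳ (c k ⊗ s k))) ⟩
        + q ⊗ (c k ⊗ s k ⊕ 0ℤ)    ≈⟨ ⊗-congˡ (+ q) (⊕-congˡ (c k ⊗ s k) (≈-sym rest≈0)) ⟩
        + q ⊗ (c k ⊗ s k ⊕ sum (λ i → c (punchIn k i) ⊗ s (punchIn k i)))
                                  ≡⟨ cong (+ q ⊗_) (sym (sum-remove (λ i → c i ⊗ s i) k)) ⟩
        + q ⊗ dot c s             ≈⟨ dot-vsum f c (+ q) h (All.++⁻ˡ T (All-resp-↭ e onPlane)) ⟩
        + length T ⊗ h            ≈⟨ mod h (trans (cong (λ t → + t ⊗ h) len) (trans (ℤ.*-comm (+ p) h) (sym (ℤ.+-identityˡ (h ⊗ + p))))) ⟩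
        0ℤ                        ∎
        where
        open ≈-Reasoning
        rest≈0 : sum (λ i → c (punchIn k i) ⊗ s (punchIn k i)) ≈ 0ℤ
        rest≈0 = ≈-trans (sum-cong {g = λ _ → 0ℤ} (λ i → ≈-trans (⊗-congˡ (c (punchIn k i)) (others i)) (≡⇒≈ (ℤ.*-zeroʳ (c (punchIn k i))))))
                         (≡⇒≈ (sum-zero {d} (λ _ → 0ℤ) (λ _ → refl)))
      sk≈0 : s k ≈ 0ℤ
      sk≈0 = [ (λ q≈0 → contradiction q≈0 (small≉0 pp {+ q} 1≤q q<p))
             , (λ cs≈0 → [ (λ ck≈0 → contradiction ck≈0 (proj₂ nonzero)) , id ]′ (⊗≈0 pp (c k) (s k) cs≈0))
             ]′ (⊗≈0 pp (+ q) (c k ⊗ s k) product≈0)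
      zero-sum′ : s ≋ 0ᵛ
      zero-sum′ i = go (k Fin.≟ i)
        where
        go : Dec (k ≡ i) → s i ≈ 0ℤ
        go (yes refl) = sk≈0
        go (no k≢i) = subst (λ j → s j ≈ 0ℤ) (Fin.punchIn-punchOut k≢i) (others (Fin.punchOut k≢i))

-- Growing a set of subset sums

module Greedy
  (p : ℕ) (pp : Prime p) (d : ℕ)
  (σ S Q : ℕ) (2≤σ : 2 ≤ σ) (1≤Q : 1 ≤ Q)
  (S-bound : ∀ {k} → k ≤ suc d → σ ^ k ≤ S) (Q-bound : ∀ {k} → k ≤ suc d → (2 * (σ * S)) ^ k ≤ Q)
  (2S<p : 2 * S < p) (Q<p : Q < p)
  (κ n : ℕ) (1≤κ : 1 ≤ κ) (κ-small : κ * suc (steps (suc d) (suc d) 0) ≤ σ) (2p≤κn : 2 * p ≤ κ * n)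
  (ℓ : ℕ) (egz : Blocks.EGZ p d ℓ)
  where

  private
    D : ℕ
    D = suc d
    instance
      nz-p : NonZero p
      nz-p = prime⇒nonZero pp
      nz-κ : NonZero κ
      nz-κ = ℕ.>-nonZero 1≤κ

  open Mod p
  open Blocks p
  open Counting p hiding (S)

  -- `M` counts the pairs `(q, h)` with `0 ≤ q ≤ Q` and `-E ≤ h ≤ E`, hence bounds the number of
  -- hyperplanes of a slab.
  E M : ℕ
  E = σ * (S * Q)
  M = suc Q * suc (2 * E)

  module C = Covering p pp D

  -- The factor `2p` clears the denominator of the growth rate `κ / 2p`: a difference yields too
  -- little growth exactly if this norm is below `κ * size Y`.
  leavingNorm : Subset D → C.Norm
  leavingNorm Y = record
    { N = λ x → 2 * p * leaving Y x
    ; N-cong = λ e → cong (2 * p *_) (leaving-cong Y e)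
    ; N-0 = trans (cong (2 * p *_) (leaving-0 Y)) (ℕ.*-zeroʳ (2 * p))
    ; N-+ = λ x y → ℕ.≤-trans (ℕ.*-monoʳ-≤ (2 * p) (leaving-+ Y x y)) (ℕ.≤-reflexive (ℕ.*-distribˡ-+ (2 * p) (leaving Y x) (leaving Y y)))
    ; N-neg = λ x → cong (2 * p *_) (leaving-neg Y x) }

  Near : V D → V D → Set
  Near c a = Σ ℕ λ q → Σ ℤ λ h → 1 ≤ q × q ≤ Q × ∣ h ∣ ≤ E × + q ⊗ dot c a ≈ h

  shifted : ∀ h → ∣ h ∣ ≤ E → Σ (Fin (suc (2 * E))) λ t → h ≡ + toℕ t ⊝ + E
  shifted (+ m) m≤E = fromℕ< bound , trans (lem (+ m) (+ E)) (cong (λ t → + t ⊝ + E) (sym (Fin.toℕ-fromℕ< bound)))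
    where
    bound : m + E < suc (2 * E)
    bound = s≤s (ℕ.≤-trans (ℕ.+-monoˡ-≤ E m≤E) (ℕ.≤-reflexive (cong (λ t → E + t) (sym (ℕ.+-identityʳ E)))))
    lem : ∀ m e → m ≡ (m ⊕ e) ⊝ e
    lem = solve-∀
  shifted -[1+ m ] m≤E = fromℕ< bound ,
    trans (lem -[1+ m ] (+ E)) (cong (_⊝ + E) (trans (ℤ.⊖-≥ m≤E) (cong +_ (sym (Fin.toℕ-fromℕ< bound)))))
    where
    bound : E ∸ suc m < suc (2 * E)
    bound = s≤s (ℕ.≤-trans (ℕ.m∸n≤m E (suc m)) (ℕ.m≤n*m E 2))
    lem : ∀ m e → m ≡ (e ⊕ m) ⊝ e
    lem = solve-∀

  module _ {X : Set} where

    dot-difference : ∀ (c x y : V D) → dot c x ≡ dot c (x -ᵛ y) ⊕ dot c y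
    dot-difference c x y = trans (sum-cong-≗ (λ i → cong (c i ⊗_) (lem (x i) (y i)))) (dot-+ʳ c (x -ᵛ y) y)
      where
      lem : ∀ x y → x ≡ (x ⊝ y) ⊕ y
      lem = solve-∀

    slab-block : (f : X → V D) (a : X) (c w : V D) → dot c w ≈ 1ℤ → ∀ {B} → All (λ b → Near c (f b -ᵛ f a)) B →
                 M * ℓ < length B → Block f B
    slab-block f a c w cw {B} near long =
      let t , B₁ , R₁ , e₁ , long₁ , near₁ = pigeonhole-labels (suc Q) (suc (2 * E) * ℓ) (All.map label-q near)
                                               (subst (_< length B) (ℕ.*-assoc (suc Q) (suc (2 * E)) ℓ) long)
          t′ , B₂ , R₂ , e₂ , long₂ , near₂ = pigeonhole-labels (suc (2 * E)) ℓ (All.map (label-h t) near₁) long₁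
          h = (+ toℕ t′ ⊝ + E) ⊕ + toℕ t ⊗ dot c (f a)
      in Block-mono e₁ (Block-mono e₂ (hyperplane-block pp egz f c w cw (toℕ t) (positive long₁ near₁)
           (ℕ.≤-<-trans (Fin.toℕ≤pred[n] t) Q<p) h B₂ (ℕ.<⇒≤ long₂) (All.map (on-plane t t′) near₂)))
      where
      Near-q : X → Fin (suc Q) → Set
      Near-q b t = 1 ≤ toℕ t × Σ ℤ λ h → ∣ h ∣ ≤ E × + toℕ t ⊗ dot c (f b -ᵛ f a) ≈ h
      Near-h : Fin (suc Q) → X → Fin (suc (2 * E)) → Set
      Near-h t b t′ = + toℕ t ⊗ dot c (f b -ᵛ f a) ≈ + toℕ t′ ⊝ + E
      label-q : ∀ {b} → Near c (f b -ᵛ f a) → Σ (Fin (suc Q)) (Near-q b)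
      label-q {b} (q , h , 1≤q , q≤Q , h≤E , e) =
        fromℕ< (s≤s q≤Q) , subst (λ t → 1 ≤ t × Σ ℤ λ h → ∣ h ∣ ≤ E × + t ⊗ dot c (f b -ᵛ f a) ≈ h) (sym (Fin.toℕ-fromℕ< (s≤s q≤Q))) (1≤q , h , h≤E , e)
      label-h : ∀ t {b} → Near-q b t → Σ (Fin (suc (2 * E))) (Near-h t b)
      label-h t (_ , h , h≤E , e) = proj₁ (shifted h h≤E) , ≈-trans e (≡⇒≈ (proj₂ (shifted h h≤E)))
      -- Labels start at 0, but each member of a class carries `1 ≤ q`, and the popular class has a
      -- member.
      positive : ∀ {t B₁ m} → m < length B₁ → All (λ b → Near-q b t) B₁ → 1 ≤ toℕ t
      positive _ ((1≤t , _) ∷ _) = 1≤t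
      on-plane : ∀ t t′ {b} → Near-h t b t′ → + toℕ t ⊗ dot c (f b) ≈ (+ toℕ t′ ⊝ + E) ⊕ + toℕ t ⊗ dot c (f a)
      on-plane t t′ {b} e = ≈-trans (≡⇒≈ (trans (cong (+ toℕ t ⊗_) (dot-difference c (f b) (f a))) (ℤ.*-distribˡ-+ (+ toℕ t) (dot c (f b -ᵛ f a)) (dot c (f a)))))
                                    (⊕-cong e (≈-refl {+ toℕ t ⊗ dot c (f a)}))

    find : (f : X → V D) (Y : Subset D) (a : X) (B : List X) →
           (Σ X λ b → Σ (List X) λ R → B ↭ b ∷ R × κ * size Y ≤ 2 * p * leaving Y (f b -ᵛ f a)) ⊎
           All (λ b → 2 * p * leaving Y (f b -ᵛ f a) < κ * size Y) B
    find f Y a [] = inj₂ []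
    find f Y a (b ∷ B) with ℕ.≤-<-connex (κ * size Y) (2 * p * leaving Y (f b -ᵛ f a))
    ... | inj₁ large = inj₁ (b , B , ↭-refl , large)
    ... | inj₂ small with find f Y a B
    ... | inj₁ (b′ , R , e , large) = inj₁ (b′ , b ∷ R , ↭-trans (↭-prep b e) (↭-swap b b′ ↭-refl) , large)
    ... | inj₂ smalls = inj₂ (small ∷ smalls)

    expand-or-block : (f : X → V D) (Y : Subset D) → 1 ≤ size Y → 2 * size Y ≤ p ^ D → (a : X) (B : List X) → M * ℓ < length B →
                      (Σ X λ b → Σ (List X) λ R → B ↭ b ∷ R × κ * size Y ≤ 2 * p * leaving Y (f b -ᵛ f a)) ⊎ Block f B
    expand-or-block f Y 1≤Y 2Y≤ a B long with find f Y a B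
    ... | inj₁ found = inj₁ found
    ... | inj₂ smalls = [ (λ all-small → contradiction (λ z → leaving-small z (all-small z)) (not-all-leaving-small Y 2Y≤ 1≤Y))
                        , (λ { (c , (w , cw) , near) → inj₂ (slab-block f a c w cw (All.map⁻ near) long) })
                        ]′ (C.cover-or-slab (leavingNorm Y) (ℕ.pred (κ * size Y)) σ S Q 2≤σ 1≤Q S-bound Q-bound 2S<p
                             (All.map⁺ (All.map ℕ.<⇒≤pred smalls)))
      where
      s = steps D D 0
      1≤κY : 1 ≤ κ * size Y
      1≤κY = ℕ.*-mono-≤ 1≤κ 1≤Y
      -- The norm is at most `s p ν / σ` with `ν = κ size Y - 1`, and `κ (s + 1) ≤ σ` brings
      -- `2 κ leaving` down to `ν`.
      leaving-small : ∀ z → σ * (2 * p * leaving Y z) ≤ s * (p * ℕ.pred (κ * size Y)) → 2 * leaving Y z < size Y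
      leaving-small z le = ℕ.*-cancelˡ-< κ _ _ (ℕ.≤-<-trans scaled pred<)
        where
        open ℕ.≤-Reasoning
        pred< : ℕ.pred (κ * size Y) < κ * size Y
        pred< = ℕ.≤-reflexive (ℕ.suc-pred (κ * size Y) {{ℕ.>-nonZero 1≤κY}})
        lem : ∀ κ s p l → suc s * p * (κ * (2 * l)) ≡ κ * suc s * (2 * p * l)
        lem = ℕ-Ring.solve-∀
        scaled : κ * (2 * leaving Y z) ≤ ℕ.pred (κ * size Y)
        scaled = ℕ.*-cancelˡ-≤ (suc s * p) {{ℕ.m*n≢0 (suc s) p}} (begin
          suc s * p * (κ * (2 * leaving Y z))   ≡⟨ lem κ s p (leaving Y z) ⟩
          κ * suc s * (2 * p * leaving Y z)     ≤⟨ ℕ.*-monoˡ-≤ (2 * p * leaving Y z) κ-small ⟩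
          σ * (2 * p * leaving Y z)             ≤⟨ le ⟩
          s * (p * ℕ.pred (κ * size Y))         ≤⟨ ℕ.*-monoˡ-≤ (p * ℕ.pred (κ * size Y)) (ℕ.n≤1+n s) ⟩
          suc s * (p * ℕ.pred (κ * size Y))     ≡⟨ sym (ℕ.*-assoc (suc s) p _) ⟩
          suc s * p * ℕ.pred (κ * size Y)       ∎)

    module _ (f : X → V D) (A : List X) where

      -- After `i` pairs, each point of `sums` is the sum of exactly `i` of the `2i` used elements,
      -- one from each pair.
      record State (i : ℕ) : Set where
        field
          sums       : Subset D
          used rest  : List X
          split      : A ↭ used ++ rest
          length-used : length used ≡ i + i
          sound      : ∀ x → mem sums x ≡ true → Σ (List X) λ T → Σ (List X) λ T′ →
                       used ↭ T ++ T′ × length T ≡ i × vsum f T ≋ x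

      open State

      -- Measuring `n * size` makes growth linear within a doubling: while the size is at least
      -- `2 ^ j`, each pair adds at least `2 ^ j` to it, so `n` pairs lead from `2 ^ j * n` to
      -- `2 ^ suc j * n`. No power of `1 + 1/n` has to be estimated.
      Grown : ∀ {i} → State i → ℕ → Set
      Grown s v = p ^ D < 2 * size (sums s) ⊎ v ≤ n * size (sums s)

      start : State 0
      sums start = record
        { mem = λ x → does (Fin.all? (λ i → ≈0? (x i)))
        ; mem-cong = λ e → does-⇔ (mk⇔ (λ x≈0 i → ≈-trans (≈-sym (e i)) (x≈0 i)) (λ y≈0 i → ≈-trans (e i) (y≈0 i)))
                             (Fin.all? (λ i → ≈0? _)) (Fin.all? (λ i → ≈0? _)) }
      used start = []
      rest start = A
      split start = ↭-refl
      length-used start = refl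
      sound start x x∈ = [] , [] , ↭-refl , refl , λ i → ≈-sym (decided (Fin.all? (λ i → ≈0? (x i))) x∈ i)
        where
        decided : ∀ {P : Set} (P? : Dec P) → does P? ≡ true → P
        decided (yes P) _ = P

      start-grown : Grown start n
      start-grown = inj₂ (ℕ.≤-trans (ℕ.≤-reflexive (sym (ℕ.*-identityʳ n))) (ℕ.*-monoʳ-≤ n
        (ℕ.≤-trans (ℕ.≤-reflexive (sym at-0)) (S-at-0 D _ (λ e → cong [_] (mem-cong (sums start) e))))))
        where
        at-0 : [ mem (sums start) 0ᵛ ] ≡ 1
        at-0 = cong [_] (dec-true (Fin.all? (λ i → ≈0? (0ᵛ {D} i))) (λ i → ≈-refl))

      select : ∀ {i} (s : State i) a b R → rest s ↭ a ∷ b ∷ R → State (suc i)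
      select s a b R e .sums = translates (sums s) (f a) (f b)
      select s a b R e .used = a ∷ b ∷ used s
      select s a b R e .rest = R
      select s a b R e .split = ↭-trans (split s) (↭-trans (++⁺ˡ (used s) e) (shifts (used s) (a ∷ b ∷ [])))
      select {i} s a b R e .length-used = cong suc (trans (cong suc (length-used s)) (sym (ℕ.+-suc i i)))
      select {i} s a b R e .sound x x∈ with mem (sums s) (x -ᵛ f a) in eq
      ... | true = let T , T′ , e′ , len , sum≋ = sound s (x -ᵛ f a) eq
                   in a ∷ T , b ∷ T′ , ↭-trans (↭-prep a (↭-prep b e′)) (↭-prep a (↭-sym (shift b T T′))) , cong suc len ,
                      λ i → ≈-trans (⊕-congˡ (f a i) (sum≋ i)) (≡⇒≈ (lem (f a i) (x i)))
        where
        lem : ∀ a x → a ⊕ (x ⊝ a) ≡ x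
        lem = solve-∀
      ... | false = let T , T′ , e′ , len , sum≋ = sound s (x -ᵛ f b) x∈
                    in b ∷ T , a ∷ T′ , ↭-trans (↭-swap a b ↭-refl) (↭-trans (↭-prep b (↭-prep a e′)) (↭-prep b (↭-sym (shift a T T′)))) , cong suc len ,
                       λ i → ≈-trans (⊕-congˡ (f b i) (sum≋ i)) (≡⇒≈ (lem (f b i) (x i)))
        where
        lem : ∀ a x → a ⊕ (x ⊝ a) ≡ x
        lem = solve-∀

      size-select : ∀ {i} (s : State i) a b R e → size (sums (select s a b R e)) ≡ size (sums s) + leaving (sums s) (f b -ᵛ f a)
      size-select s a b R e = size-translates (sums s) (f a) (f b)

      advance : ∀ {i} j t (s : State i) → Grown s (2 ^ j * (n + t)) → 1 ≤ n → M * ℓ + 2 ≤ length (rest s) →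
                Block f A ⊎ Σ (State (suc i)) λ s′ → Grown s′ (2 ^ j * (n + suc t))
      advance {i} j t s grown 1≤n long = go (rest s) refl
        where
        instance
          nz-n : NonZero n
          nz-n = ℕ.>-nonZero 1≤n
        Y = sums s
        go : ∀ rs → rest s ≡ rs → Block f A ⊎ Σ (State (suc i)) λ s′ → Grown s′ (2 ^ j * (n + suc t))
        go [] eq = contradiction (subst (λ r → M * ℓ + 2 ≤ length r) eq long) (ℕ.<⇒≱ (ℕ.≤-trans (s≤s z≤n) (ℕ.m≤n+m 2 (M * ℓ))))
        go (a ∷ []) eq = contradiction (subst (λ r → M * ℓ + 2 ≤ length r) eq long) (ℕ.<⇒≱ (ℕ.m≤n+m 2 (M * ℓ)))
        go (a ∷ b ∷ R) eq = [ done , (λ v≤ → [ continue v≤ , done ]′ (ℕ.≤-<-connex (2 * size Y) (p ^ D))) ]′ grown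
          where
          -- Beyond one half the size only must not drop, which holds for any pair; pairs are still
          -- consumed so that both halves end with the same number of them.
          done : p ^ D < 2 * size Y → Block f A ⊎ Σ (State (suc i)) λ s′ → Grown s′ (2 ^ j * (n + suc t))
          done big = inj₂ (s′ , inj₁ (ℕ.<-≤-trans big (ℕ.*-monoʳ-≤ 2 (ℕ.≤-trans (ℕ.m≤m+n (size Y) _) (ℕ.≤-reflexive (sym (size-select s a b R e)))))))
            where
            e = ↭-reflexive eq
            s′ = select s a b R e
          continue : 2 ^ j * (n + t) ≤ n * size Y → 2 * size Y ≤ p ^ D → Block f A ⊎ Σ (State (suc i)) λ s′ → Grown s′ (2 ^ j * (n + suc t))
          continue v≤ 2Y≤ = [ grow , (λ blk → inj₁ (Block-mono (↭-trans (split s) (++-comm (used s) (rest s))) (subst (Block f) (sym eq) (Block-mono (++-comm (a ∷ []) (b ∷ R)) blk)))) ]′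
                              (expand-or-block f Y 1≤Y 2Y≤ a (b ∷ R) long′)
            where
            long′ : M * ℓ < length (b ∷ R)
            long′ = ℕ.≤-pred (ℕ.≤-trans (ℕ.≤-reflexive (ℕ.+-comm 2 (M * ℓ))) (subst (λ r → M * ℓ + 2 ≤ length r) eq long))
            2^j≤Y : 2 ^ j ≤ size Y
            2^j≤Y = ℕ.*-cancelˡ-≤ n (ℕ.≤-trans (ℕ.≤-reflexive (ℕ.*-comm n (2 ^ j))) (ℕ.≤-trans (ℕ.*-monoʳ-≤ (2 ^ j) (ℕ.m≤m+n n t)) v≤))
            1≤Y : 1 ≤ size Y
            1≤Y = ℕ.≤-trans (ℕ.m^n>0 2 j) 2^j≤Y
            grow : (Σ X λ b′ → Σ (List X) λ R′ → b ∷ R ↭ b′ ∷ R′ × κ * size Y ≤ 2 * p * leaving Y (f b′ -ᵛ f a)) →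
                   Block f A ⊎ Σ (State (suc i)) λ s′ → Grown s′ (2 ^ j * (n + suc t))
            grow (b′ , R′ , e , large) = inj₂ (s′ , inj₂ (begin
              2 ^ j * (n + suc t)                       ≡⟨ lem (2 ^ j) n t ⟩
              2 ^ j * (n + t) + 2 ^ j                   ≤⟨ ℕ.+-mono-≤ v≤ (ℕ.≤-trans 2^j≤Y Y≤) ⟩
              n * size Y + n * leaving Y (f b′ -ᵛ f a)  ≡⟨ sym (ℕ.*-distribˡ-+ n (size Y) _) ⟩
              n * (size Y + leaving Y (f b′ -ᵛ f a))    ≡⟨ cong (n *_) (sym (size-select s a b′ R′ e′)) ⟩
              n * size (sums s′)                        ∎))
              where
              open ℕ.≤-Reasoning
              e′ = ↭-trans (↭-reflexive eq) (↭-prep a e)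
              s′ = select s a b′ R′ e′
              lem : ∀ x n t → x * (n + suc t) ≡ x * (n + t) + x
              lem = ℕ-Ring.solve-∀
              Y≤ : size Y ≤ n * leaving Y (f b′ -ᵛ f a)
              Y≤ = ℕ.*-cancelˡ-≤ κ (ℕ.≤-trans large (ℕ.≤-trans (ℕ.*-monoˡ-≤ (leaving Y (f b′ -ᵛ f a)) 2p≤κn) (ℕ.≤-reflexive (ℕ.*-assoc κ n _))))

      rest-length : ∀ {i} (s : State i) → length A ≡ i + i + length (rest s)
      rest-length s = trans (length-split {T = used s} (split s)) (cong (_+ length (rest s)) (length-used s))

      double : 1 ≤ n → ∀ {i} j t (s : State i) → Grown s (2 ^ j * n) → M * ℓ + 2 * (t + i) ≤ length A →
               Block f A ⊎ Σ (State (t + i)) λ s′ → Grown s′ (2 ^ j * (n + t))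
      double 1≤n j zero s grown long = inj₂ (s , subst (λ v → Grown s (2 ^ j * v)) (sym (ℕ.+-identityʳ n)) grown)
      double 1≤n {i} j (suc t) s grown long =
        [ inj₁ , (λ { (s′ , grown′) → advance j t s′ grown′ 1≤n (room s′) }) ]′
          (double 1≤n j t s grown (ℕ.≤-trans (ℕ.+-monoʳ-≤ (M * ℓ) (ℕ.*-monoʳ-≤ 2 (ℕ.n≤1+n (t + i)))) long))
        where
        room : (s′ : State (t + i)) → M * ℓ + 2 ≤ length (rest s′)
        room s′ = ℕ.+-cancelˡ-≤ (t + i + (t + i)) _ _ (begin
          t + i + (t + i) + (M * ℓ + 2)    ≡⟨ lem (t + i) (M * ℓ) ⟩
          M * ℓ + 2 * suc (t + i)          ≤⟨ long ⟩
          length A                         ≡⟨ rest-length s′ ⟩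
          t + i + (t + i) + length (rest s′) ∎)
          where
          open ℕ.≤-Reasoning
          lem : ∀ x m → x + x + (m + 2) ≡ m + 2 * suc x
          lem = ℕ-Ring.solve-∀

      saturate : 1 ≤ n → ∀ j → M * ℓ + 2 * (j * n) ≤ length A → Block f A ⊎ Σ (State (j * n)) λ s → Grown s (2 ^ j * n)
      saturate 1≤n zero long = inj₂ (start , subst (Grown start) (sym (ℕ.*-identityˡ n)) start-grown)
      saturate 1≤n (suc j) long =
        [ inj₁ , (λ { (s , grown) → Sum.map₂ (λ { (s′ , grown′) → s′ , subst (Grown s′) (lem (2 ^ j) n) grown′ }) (double 1≤n j n s grown long) }) ]′
          (saturate 1≤n j (ℕ.≤-trans (ℕ.+-monoʳ-≤ (M * ℓ) (ℕ.*-monoʳ-≤ 2 (ℕ.m≤n+m (j * n) n))) long))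
        where
        lem : ∀ x n → x * (n + n) ≡ 2 * x * n
        lem = ℕ-Ring.solve-∀

  private
    open State

    regroup : ∀ {X : Set} (T₁ U₁ T₂ U₂ Z R : List X) →
              (T₁ ++ U₁) ++ ((T₂ ++ U₂) ++ (Z ++ R)) ↭ (T₁ ++ (T₂ ++ Z)) ++ (U₁ ++ (U₂ ++ R))
    regroup {X} T₁ U₁ T₂ U₂ Z R = prove 6
      ((var (# 0) ⊙ var (# 1)) ⊙ ((var (# 2) ⊙ var (# 3)) ⊙ (var (# 4) ⊙ var (# 5))))
      ((var (# 0) ⊙ (var (# 2) ⊙ var (# 4))) ⊙ (var (# 1) ⊙ (var (# 3) ⊙ var (# 5))))
      (T₁ ∷ᵛ U₁ ∷ᵛ T₂ ∷ᵛ U₂ ∷ᵛ Z ∷ᵛ R ∷ᵛ []ᵛ)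
      where open CommutativeMonoidSolver (++-commutativeMonoid {A = X}) renaming (_⊕_ to _⊙_)

  big : ∀ {X : Set} (f : X → V D) A {i} (s : State f A i) J → 1 ≤ n → p ^ D < 2 ^ J → Grown f A s (2 ^ J * n) → p ^ D < 2 * size (sums s)
  big f A s J 1≤n p<2^J (inj₁ large) = large
  big f A s J 1≤n p<2^J (inj₂ le) = ℕ.<-≤-trans p<2^J (ℕ.≤-trans (ℕ.*-cancelˡ-≤ n {{ℕ.>-nonZero 1≤n}} (ℕ.≤-trans (ℕ.≤-reflexive (ℕ.*-comm n (2 ^ J))) le)) (ℕ.m≤n*m _ 2))

  meet : (Y₁ Y₂ : Subset D) → p ^ D < 2 * size Y₁ → p ^ D < 2 * size Y₂ → ∀ z →
         Σ (V D) λ y → mem Y₁ y ≡ true × mem Y₂ (y +ᵛ z) ≡ true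
  meet Y₁ Y₂ big₁ big₂ z =
    let y , lt = S-exists D (λ _ → 1) (λ y → [ mem Y₁ y ] + [ mem Y₂ (y +ᵛ z) ]) crowded
    in y , both (mem Y₁ y) (mem Y₂ (y +ᵛ z)) lt
    where
    open ℕ.≤-Reasoning
    both : ∀ a b → 1 < [ a ] + [ b ] → a ≡ true × b ≡ true
    both true true lt = refl , refl
    both true false (s≤s ())
    both false true (s≤s ())
    crowded : Counting.S p D (λ _ → 1) < Counting.S p D (λ y → [ mem Y₁ y ] + [ mem Y₂ (y +ᵛ z) ])
    crowded = ℕ.*-cancelˡ-< 2 _ _ (begin-strict
      2 * Counting.S p D (λ _ → 1)       ≡⟨ cong (2 *_) (trans (S-const D 1) (ℕ.*-identityʳ (p ^ D))) ⟩
      2 * p ^ D                          ≡⟨ cong (λ t → p ^ D + t) (ℕ.+-identityʳ (p ^ D)) ⟩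
      p ^ D + p ^ D                      <⟨ ℕ.+-mono-< big₁ big₂ ⟩
      2 * size Y₁ + 2 * size Y₂          ≡⟨ sym (ℕ.*-distribˡ-+ 2 (size Y₁) (size Y₂)) ⟩
      2 * (size Y₁ + size Y₂)            ≡⟨ cong (λ t → 2 * (size Y₁ + t)) (sym (S-shift D (λ y → [ mem Y₂ y ]) (λ e → cong [_] (mem-cong Y₂ e)) z)) ⟩
      2 * (size Y₁ + Counting.S p D (λ y → [ mem Y₂ (y +ᵛ z) ])) ≡⟨ cong (2 *_) (sym (S-+ D (λ y → [ mem Y₁ y ]) (λ y → [ mem Y₂ (y +ᵛ z) ]))) ⟩
      2 * Counting.S p D (λ y → [ mem Y₁ y ] + [ mem Y₂ (y +ᵛ z) ]) ∎)

  -- The second set of sums is formed with -f, so that a translation of it meets the first set.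
  combine-halves : ∀ {X : Set} (f : X → V D) A {i} (s₁ : State f A i) (s₂ : State (-ᵛ_ ∘ f) (rest s₁) i) →
                   p ^ D < 2 * size (sums s₁) → p ^ D < 2 * size (sums s₂) → i + i ≤ p → p ≤ length (rest s₂) → Block f A
  combine-halves f A {i} s₁ s₂ big₁ big₂ 2i≤p long =
    -- `Z` pads the block to length exactly `p`. Its sum `z` is absorbed by the choice of the common
    -- point: the three parts sum to `y`, `-(y + z)` and `z`.
    let m = p ∸ (i + i)
        Z = take m (rest s₂)
        R = drop m (rest s₂)
        z = vsum f Z
        y , y∈ , y+z∈ = meet (sums s₁) (sums s₂) big₁ big₂ z
        T₁ , U₁ , e₁ , len₁ , sum₁ = sound s₁ y y∈
        T₂ , U₂ , e₂ , len₂ , sum₂ = sound s₂ (y +ᵛ z) y+z∈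
        lenZ = trans (List.length-take m (rest s₂)) (ℕ.m≤n⇒m⊓n≡m (ℕ.≤-trans (ℕ.m∸n≤m p (i + i)) long))
    in T₁ ++ (T₂ ++ Z) , U₁ ++ (U₂ ++ R) ,
       ↭-trans (split s₁) (↭-trans (++⁺ e₁ (↭-trans (split s₂) (++⁺ e₂ (↭-reflexive (sym (List.take++drop≡id m (rest s₂))))))) (regroup T₁ U₁ T₂ U₂ Z R)) ,
       trans (List.length-++ T₁) (trans (cong₂ _+_ len₁ (trans (List.length-++ T₂) (cong₂ _+_ len₂ lenZ)))
         (trans (sym (ℕ.+-assoc i i m)) (ℕ.m+[n∸m]≡n 2i≤p))) ,
       λ l → let t₂ = vsum f T₂ l in
         ≈-trans (≡⇒≈ (trans (vsum-++ f T₁ (T₂ ++ Z) l) (cong (vsum f T₁ l ⊕_) (vsum-++ f T₂ Z l))))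
           (≈-trans (⊕-cong (sum₁ l) (⊕-cong (≈-trans (≡⇒≈ (trans (sym (ℤ.neg-involutive t₂)) (cong ⊖_ (sym (vsum-neg f T₂ l))))) (⊖-cong (sum₂ l))) (≈-refl {z l})))
             (≡⇒≈ (cancel (y l) (z l))))
    where
    cancel : ∀ y z → y ⊕ ((⊖ (y ⊕ z)) ⊕ z) ≡ 0ℤ
    cancel = solve-∀

  -- The budget: at most `p` elements for the pairs of each half, at most `p` for the padding, and a
  -- reserve of `M * ℓ` so that at every pair a hyperplane containing `ℓ` elements can be found if
  -- growth fails.
  egz-suc : ∀ J → 1 ≤ n → 2 * (J * n) ≤ p → p ^ D < 2 ^ J → EGZ (suc d) (M * ℓ + 3 * p)
  egz-suc J 1≤n 2I≤p p<2^J f A long = [ id , second ]′ (saturate f A 1≤n J enough₁)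
    where
    open ℕ.≤-Reasoning
    I = J * n
    enough₁ : M * ℓ + 2 * I ≤ length A
    enough₁ = ℕ.≤-trans (ℕ.+-monoʳ-≤ (M * ℓ) (ℕ.≤-trans 2I≤p (ℕ.m≤n*m p 3))) long
    I+I≤p : I + I ≤ p
    I+I≤p = ℕ.≤-trans (ℕ.≤-reflexive (cong (λ t → I + t) (sym (ℕ.+-identityʳ I)))) 2I≤p
    second : (Σ (State f A I) λ s → Grown f A s (2 ^ J * n)) → Block f A
    second (s₁ , grown₁) = [ (λ blk → Block-mono (↭-trans (split s₁) (++-comm (used s₁) (rest s₁))) (Block-neg blk)) , third ]′
                           (saturate (-ᵛ_ ∘ f) (rest s₁) 1≤n J (ℕ.≤-trans (ℕ.+-monoʳ-≤ (M * ℓ) (ℕ.≤-trans 2I≤p (ℕ.m≤n*m p 2))) long₁))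
      where
      long₁ : M * ℓ + 2 * p ≤ length (rest s₁)
      long₁ = ℕ.+-cancelˡ-≤ (I + I) _ _ (begin
        I + I + (M * ℓ + 2 * p)        ≤⟨ ℕ.+-monoˡ-≤ _ I+I≤p ⟩
        p + (M * ℓ + 2 * p)            ≡⟨ lem p (M * ℓ) ⟩
        M * ℓ + 3 * p                  ≤⟨ long ⟩
        length A                       ≡⟨ rest-length f A s₁ ⟩
        I + I + length (rest s₁)       ∎)
        where
        lem : ∀ p m → p + (m + 2 * p) ≡ m + 3 * p
        lem = ℕ-Ring.solve-∀
      third : (Σ (State (-ᵛ_ ∘ f) (rest s₁) I) λ s → Grown (-ᵛ_ ∘ f) (rest s₁) s (2 ^ J * n)) → Block f A
      third (s₂ , grown₂) = combine-halves f A s₁ s₂ (big f A s₁ J 1≤n p<2^J grown₁) (big (-ᵛ_ ∘ f) (rest s₁) s₂ J 1≤n p<2^J grown₂) I+I≤p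
        (ℕ.+-cancelˡ-≤ (I + I) _ _ (begin
          I + I + p                    ≤⟨ ℕ.+-monoˡ-≤ p I+I≤p ⟩
          p + p                        ≤⟨ ℕ.≤-reflexive (cong (λ t → p + t) (sym (ℕ.+-identityʳ p))) ⟩
          2 * p                        ≤⟨ ℕ.m≤n+m (2 * p) (M * ℓ) ⟩
          M * ℓ + 2 * p                ≤⟨ long₁ ⟩
          length (rest s₁)             ≡⟨ rest-length (-ᵛ_ ∘ f) (rest s₁) s₂ ⟩
          I + I + length (rest s₂)     ∎))

-- EGZ for large primes

EGZ-mono : ∀ {p d ℓ ℓ′} → ℓ ≤ ℓ′ → Blocks.EGZ p d ℓ → Blocks.EGZ p d ℓ′
EGZ-mono ℓ≤ egz f A long = egz f A (ℕ.≤-trans ℓ≤ long)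

egz-0 : ∀ p → Blocks.EGZ p 0 p
egz-0 p f A long = take p A , drop p A , ↭-reflexive (sym (List.take++drop≡id p A)) ,
  trans (List.length-take p A) (ℕ.m≤n⇒m⊓n≡m long) , λ ()

-- A sum instead of a maximum: one constant that dominates the cost of covering in every dimension
-- up to `r`.
maxCost : ℕ → ℕ
maxCost zero    = 1
maxCost (suc D) = maxCost D + suc (steps (suc D) (suc D) 0)

steps≤maxCost : ∀ {d r} → suc d ≤ r → suc (steps (suc d) (suc d) 0) ≤ maxCost r
steps≤maxCost {d} {suc r} sd≤sr with ℕ.m≤n⇒m<n∨m≡n sd≤sr
... | inj₁ sd<sr = ℕ.≤-trans (steps≤maxCost (ℕ.≤-pred sd<sr)) (ℕ.m≤m+n (maxCost r) _)
... | inj₂ refl = ℕ.m≤n+m _ (maxCost r)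

1≤maxCost : ∀ r → 1 ≤ maxCost r
1≤maxCost zero    = ℕ.≤-refl
1≤maxCost (suc r) = ℕ.≤-trans (1≤maxCost r) (ℕ.m≤m+n (maxCost r) _)

module Thresholds (r z : ℕ) (2≤z : 2 ≤ z) where

  instance
    nz-z : NonZero z
    nz-z = ℕ.>-nonZero (ℕ.≤-trans (s≤s z≤n) 2≤z)

  -- The thresholds for `σ = z`, with the exponents taken at the largest dimension `r` so that they
  -- serve all smaller ones. Each is at most a power of `z` whose exponent depends on `r` alone.
  S Q E M : ℕ
  S = z ^ r
  Q = (2 * (z * S)) ^ r
  E = z * (S * Q)
  M = suc Q * suc (2 * E)

  private instance
    nz-S : NonZero S
    nz-S = ℕ.m^n≢0 z r
    nz-zS : NonZero (z * S)
    nz-zS = ℕ.m*n≢0 z S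
    nz-2zS : NonZero (2 * (z * S))
    nz-2zS = ℕ.m*n≢0 2 (z * S)
    nz-Q : NonZero Q
    nz-Q = ℕ.m^n≢0 (2 * (z * S)) r
    nz-SQ : NonZero (S * Q)
    nz-SQ = ℕ.m*n≢0 S Q
    nz-E : NonZero E
    nz-E = ℕ.m*n≢0 z (S * Q)

  1≤Q : 1 ≤ Q
  1≤Q = ℕ.>-nonZero⁻¹ Q

  Q<M+3 : Q < M + 3
  Q<M+3 = ℕ.≤-trans (ℕ.m≤m*n (suc Q) (suc (2 * E))) (ℕ.m≤m+n M 3)

  2S<M+3 : 2 * S < M + 3
  2S<M+3 = ℕ.≤-trans (s≤s (ℕ.*-monoʳ-≤ 2 (ℕ.≤-trans (ℕ.m≤m*n S Q) (ℕ.m≤n*m (S * Q) z))))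
                     (ℕ.≤-trans (ℕ.m≤n*m (suc (2 * E)) (suc Q)) (ℕ.m≤m+n M 3))

  -- The summands account for a numerical factor `9 ≤ z ^ 4`, for `Q`, and for `E`, each factor 2
  -- inside `Q` being bounded by `z`.
  exponent : ℕ
  exponent = 4 + ((2 + r) * r + (1 + (r + (2 + r) * r)))

  M+3≤ : M + 3 ≤ z ^ exponent
  M+3≤ = begin
    suc Q * suc (2 * E) + 3          ≤⟨ ℕ.+-mono-≤ (ℕ.*-mono-≤ (one-more Q) (one-more′ E)) (ℕ.*-monoʳ-≤ 3 {1} (ℕ.>-nonZero⁻¹ (Q * E) {{ℕ.m*n≢0 Q E}})) ⟩
    2 * Q * (3 * E) + 3 * (Q * E)    ≡⟨ lem Q E ⟩
    9 * (Q * E)                      ≤⟨ ℕ.*-mono-≤ {9} {z ^ 4} nine (ℕ.*-mono-≤ Q≤ E≤) ⟩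
    z ^ 4 * (z ^ ((2 + r) * r) * z ^ (1 + (r + (2 + r) * r)))
                                     ≡⟨ sym (trans (ℕ.^-distribˡ-+-* z 4 ((2 + r) * r + (1 + (r + (2 + r) * r)))) (cong (z ^ 4 *_) (ℕ.^-distribˡ-+-* z ((2 + r) * r) (1 + (r + (2 + r) * r))))) ⟩
    z ^ exponent                     ∎
    where
    open ℕ.≤-Reasoning
    lem : ∀ q e → 2 * q * (3 * e) + 3 * (q * e) ≡ 9 * (q * e)
    lem = ℕ-Ring.solve-∀
    one-more : ∀ x {{_ : NonZero x}} → suc x ≤ 2 * x
    one-more (suc x) = s≤s (ℕ.≤-trans (s≤s (ℕ.m≤m+n x (x + 0))) (ℕ.≤-reflexive (sym (ℕ.+-suc x (x + 0)))))
    one-more′ : ∀ x {{_ : NonZero x}} → suc (2 * x) ≤ 3 * x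
    one-more′ x = ℕ.+-monoˡ-≤ (2 * x) (ℕ.>-nonZero⁻¹ x)
    nine : 9 ≤ z ^ 4
    nine = ℕ.≤-trans (ℕ.m≤m+n 9 7) (ℕ.^-monoˡ-≤ 4 2≤z)
    Q≤ : Q ≤ z ^ ((2 + r) * r)
    Q≤ = begin
      (2 * (z * z ^ r)) ^ r   ≤⟨ ℕ.^-monoˡ-≤ r (ℕ.*-monoˡ-≤ (z * z ^ r) 2≤z) ⟩
      (z ^ (2 + r)) ^ r       ≡⟨ ℕ.^-*-assoc z (2 + r) r ⟩
      z ^ ((2 + r) * r)       ∎
    E≤ : E ≤ z ^ (1 + (r + (2 + r) * r))
    E≤ = ℕ.≤-trans (ℕ.*-monoʳ-≤ z (ℕ.*-monoʳ-≤ (z ^ r) Q≤)) (ℕ.≤-reflexive (cong (z *_) (sym (ℕ.^-distribˡ-+-* z r ((2 + r) * r)))))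

  -- Since `ℓ ≥ p`, the recursion from `ℓ` to `M * ℓ + 3 * p` costs at most a factor `M + 3` per
  -- dimension, starting from `p` in dimension 0.
  egz-power : ∀ p → Prime p → M + 3 ≤ p → ∀ κ n J → 1 ≤ κ → κ * maxCost r ≤ z → 2 * p ≤ κ * n → 1 ≤ n → 2 * (J * n) ≤ p → p ^ r < 2 ^ J →
              ∀ D → D ≤ r → Blocks.EGZ p D (p * (M + 3) ^ D)
  egz-power p pp M+3≤p κ n J 1≤κ κ-small 2p≤ 1≤n 2I≤p p<2^J zero D≤r = EGZ-mono (ℕ.≤-reflexive (sym (ℕ.*-identityʳ p))) (egz-0 p)
  egz-power p pp M+3≤p κ n J 1≤κ κ-small 2p≤ 1≤n 2I≤p p<2^J (suc D) D<r = EGZ-mono {ℓ = M * ℓ + 3 * p} bound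
    (Greedy.egz-suc p pp D z S Q 2≤z 1≤Q (λ k≤ → ℕ.^-monoʳ-≤ z (ℕ.≤-trans k≤ D<r)) (λ k≤ → ℕ.^-monoʳ-≤ (2 * (z * S)) (ℕ.≤-trans k≤ D<r))
      (ℕ.<-≤-trans 2S<M+3 M+3≤p) (ℕ.<-≤-trans Q<M+3 M+3≤p) κ n 1≤κ (ℕ.≤-trans (ℕ.*-monoʳ-≤ κ (steps≤maxCost D<r)) κ-small) 2p≤
      ℓ (egz-power p pp M+3≤p κ n J 1≤κ κ-small 2p≤ 1≤n 2I≤p p<2^J D (ℕ.<⇒≤ D<r)) J 1≤n 2I≤p
      (ℕ.≤-<-trans (ℕ.^-monoʳ-≤ p D<r) p<2^J))
    where
    instance
      nz-p : NonZero p
      nz-p = prime⇒nonZero pp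
      nz-M : NonZero (M + 3)
      nz-M = ℕ.>-nonZero (ℕ.≤-trans (s≤s z≤n) (ℕ.m≤n+m 3 M))
    ℓ = p * (M + 3) ^ D
    open ℕ.≤-Reasoning
    lem : ∀ M p x → M * (p * x) + 3 * (p * x) ≡ p * ((M + 3) * x)
    lem = ℕ-Ring.solve-∀
    bound : M * ℓ + 3 * p ≤ p * (M + 3) ^ suc D
    bound = begin
      M * ℓ + 3 * p    ≤⟨ ℕ.+-monoʳ-≤ (M * ℓ) (ℕ.*-monoʳ-≤ 3 (ℕ.m≤m*n p ((M + 3) ^ D) {{ℕ.m^n≢0 (M + 3) D}})) ⟩
      M * ℓ + 3 * ℓ    ≡⟨ lem M p ((M + 3) ^ D) ⟩
      p * (M + 3) ^ suc D ∎

suc≤2^ : ∀ b → suc b ≤ 2 ^ b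
suc≤2^ zero    = ℕ.≤-refl
suc≤2^ (suc b) = begin
  suc (suc b)        ≡⟨ ℕ.+-comm 1 (suc b) ⟩
  suc b + 1          ≤⟨ ℕ.+-mono-≤ (suc≤2^ b) (ℕ.≤-trans (ℕ.m^n>0 2 b) (ℕ.m≤m+n (2 ^ b) 0)) ⟩
  2 ^ b + (2 ^ b + 0) ∎
  where open ℕ.≤-Reasoning

bracket : ∀ (g : ℕ → ℕ) → (∀ x → x ≤ g x) → ∀ {B p} → g B ≤ p → Σ ℕ λ b → B ≤ b × g b ≤ p × p < g (suc b)
bracket g x≤g {B} {p} gB≤p = [ id , (λ g≤p → contradiction (ℕ.≤-trans (ℕ.m≤n+m (suc p) B) (ℕ.≤-trans (x≤g (B + suc p)) g≤p)) ℕ.1+n≰n) ]′ (search (suc p))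
  where
  search : ∀ k → (Σ ℕ λ b → B ≤ b × g b ≤ p × p < g (suc b)) ⊎ g (B + k) ≤ p
  search zero = inj₂ (subst (λ t → g t ≤ p) (sym (ℕ.+-identityʳ B)) gB≤p)
  search (suc k) with search k
  ... | inj₁ found = inj₁ found
  ... | inj₂ le with ℕ.<-≤-connex p (g (suc (B + k)))
  ... | inj₁ p<g = inj₁ (B + k , ℕ.m≤m+n B k , le , p<g)
  ... | inj₂ g≤p = inj₂ (subst (λ t → g t ≤ p) (sym (ℕ.+-suc B k)) g≤p)

-- For a prime p ≈ c·b^(2m), all thresholds are powers of z = b², while log₂ p grows only linearly in b.
egz-large : ∀ r c → 1 ≤ c → Σ ℕ λ P → ∀ p → Prime p → P ≤ p → Σ ℕ λ F → F * c ≤ p × Blocks.EGZ p r (p * F)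
egz-large r c 1≤c = g B , λ p pp P≤p → at p pp (bracket g x≤g P≤p)
  where
  -- `suc r` times the exponent of `M + 3`: it covers both `(M + 3) ^ r ≤ z ^ m` and, even for
  -- `r = 0`, `M + 3 ≤ z ^ m`.
  m : ℕ
  m = suc r * (4 + ((2 + r) * r + (1 + (r + (2 + r) * r))))
  -- Chosen so that `κ * maxCost r ≤ b * B`; then `B ≤ b` suffices for `κ * maxCost r ≤ b * b = z`.
  B : ℕ
  B = 6 * ((c + 2 * m) * r + 1) * maxCost r
  g : ℕ → ℕ
  g b = (b * b) ^ m * c
  instance
    nz-c : NonZero c
    nz-c = ℕ.>-nonZero 1≤c
    nz-m : NonZero m
    nz-m = ℕ.m*n≢0 (suc r) (4 + ((2 + r) * r + (1 + (r + (2 + r) * r))))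
  x≤x^ : ∀ x k {{_ : NonZero k}} → x ≤ x ^ k
  x≤x^ zero    k       = z≤n
  x≤x^ (suc x) (suc k) = ℕ.m≤m*n (suc x) (suc x ^ k) {{ℕ.m^n≢0 (suc x) k}}
  x≤x*x : ∀ x → x ≤ x * x
  x≤x*x zero    = z≤n
  x≤x*x (suc x) = ℕ.m≤m*n (suc x) (suc x)
  x≤g : ∀ x → x ≤ g x
  x≤g x = ℕ.≤-trans (x≤x*x x) (ℕ.≤-trans (x≤x^ (x * x) m) (ℕ.m≤m*n ((x * x) ^ m) c))
  6≤B : 6 ≤ B
  6≤B = ℕ.*-mono-≤ {6} {6 * ((c + 2 * m) * r + 1)} {1} (ℕ.*-monoʳ-≤ 6 {1} (ℕ.m≤n+m 1 ((c + 2 * m) * r))) (1≤maxCost r)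

  at : ∀ p → Prime p → (Σ ℕ λ b → B ≤ b × g b ≤ p × p < g (suc b)) → Σ ℕ λ F → F * c ≤ p × Blocks.EGZ p r (p * F)
  at p pp (b , B≤b , gb≤p , p<g) = z ^ m , gb≤p ,
    EGZ-mono (ℕ.*-monoʳ-≤ p M^r≤) (T.egz-power p pp M+3≤p κ n J 1≤κ κ-small 2p≤ (s≤s z≤n) 2I≤p p^r<2^J r ℕ.≤-refl)
    where
    open ℕ.≤-Reasoning
    z = b * b
    6≤b : 6 ≤ b
    6≤b = ℕ.≤-trans 6≤B B≤b
    instance
      nz-b : NonZero b
      nz-b = ℕ.>-nonZero (ℕ.≤-trans (s≤s z≤n) 6≤b)
      nz-zz : NonZero z
      nz-zz = ℕ.m*n≢0 b b
    2≤z : 2 ≤ z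
    2≤z = ℕ.≤-trans (ℕ.m≤m+n 2 4) (ℕ.≤-trans 6≤b (x≤x*x b))
    module T = Thresholds r z 2≤z
    z^m≤p : z ^ m ≤ p
    z^m≤p = ℕ.≤-trans (ℕ.m≤m*n (z ^ m) c) gb≤p
    M+3≤p : T.M + 3 ≤ p
    M+3≤p = ℕ.≤-trans T.M+3≤ (ℕ.≤-trans (ℕ.^-monoʳ-≤ z (ℕ.m≤n*m T.exponent (suc r))) z^m≤p)
    M^r≤ : (T.M + 3) ^ r ≤ z ^ m
    M^r≤ = begin
      (T.M + 3) ^ r          ≤⟨ ℕ.^-monoˡ-≤ r T.M+3≤ ⟩
      (z ^ T.exponent) ^ r   ≡⟨ ℕ.^-*-assoc z T.exponent r ⟩
      z ^ (T.exponent * r)   ≤⟨ ℕ.^-monoʳ-≤ z (ℕ.≤-trans (ℕ.≤-reflexive (ℕ.*-comm T.exponent r)) (ℕ.*-monoˡ-≤ T.exponent (ℕ.n≤1+n r))) ⟩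
      z ^ m                  ∎
    -- An upper bound for the binary logarithm of `p`, from `p < g (suc b)` and `suc b ≤ 2 ^ b`.
    a : ℕ
    a = c + b * (2 * m)
    -- `J` doublings pass `p ^ r`. Each gets `n`, just above `p / 3J`, pairs: then `6 J n ≥ 2p`,
    -- while `2 J n ≤ 2p/3 + 2J` stays below `p` because `6 J = κ ≤ p`.
    J κ n : ℕ
    J = a * r + 1
    κ = 6 * J
    n = suc (p / (3 * suc (a * r)))
    J≡ : J ≡ suc (a * r)
    J≡ = ℕ.+-comm (a * r) 1
    1≤κ : 1 ≤ κ
    1≤κ = ℕ.≤-trans (s≤s z≤n) (ℕ.*-monoʳ-≤ 6 {1} (ℕ.m≤n+m 1 (a * r)))
    J≤ : J ≤ b * ((c + 2 * m) * r + 1)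
    J≤ = begin
      (c + b * (2 * m)) * r + 1          ≤⟨ ℕ.+-mono-≤ (ℕ.*-monoˡ-≤ r (ℕ.+-monoˡ-≤ (b * (2 * m)) (ℕ.m≤n*m c b))) (ℕ.>-nonZero⁻¹ b) ⟩
      (b * c + b * (2 * m)) * r + b      ≡⟨ lem b c m r ⟩
      b * ((c + 2 * m) * r + 1)          ∎
      where
      lem : ∀ b c m r → (b * c + b * (2 * m)) * r + b ≡ b * ((c + 2 * m) * r + 1)
      lem = ℕ-Ring.solve-∀
    κ-small : κ * maxCost r ≤ z
    κ-small = begin
      6 * J * maxCost r                                   ≤⟨ ℕ.*-monoˡ-≤ (maxCost r) (ℕ.*-monoʳ-≤ 6 J≤) ⟩
      6 * (b * ((c + 2 * m) * r + 1)) * maxCost r         ≡⟨ lem b ((c + 2 * m) * r + 1) (maxCost r) ⟩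
      b * B                                               ≤⟨ ℕ.*-monoʳ-≤ b B≤b ⟩
      b * b                                               ∎
      where
      lem : ∀ b x y → 6 * (b * x) * y ≡ b * (6 * x * y)
      lem = ℕ-Ring.solve-∀
    κ≤p : κ ≤ p
    κ≤p = ℕ.≤-trans (ℕ.m≤m*n κ (maxCost r) {{ℕ.>-nonZero (1≤maxCost r)}}) (ℕ.≤-trans κ-small (ℕ.≤-trans (x≤x^ z m) z^m≤p))
    q = p / (3 * suc (a * r))
    2p≤ : 2 * p ≤ κ * n
    2p≤ = begin
      2 * p                                        ≡⟨ cong (2 *_) (m≡m%n+[m/n]*n p (3 * suc (a * r))) ⟩
      2 * (p % (3 * suc (a * r)) + q * (3 * suc (a * r)))
        ≤⟨ ℕ.*-monoʳ-≤ 2 (ℕ.+-monoˡ-≤ (q * (3 * suc (a * r))) (ℕ.<⇒≤ (m%n<n p (3 * suc (a * r))))) ⟩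
      2 * (3 * suc (a * r) + q * (3 * suc (a * r))) ≡⟨ lem (suc (a * r)) q ⟩
      6 * suc (a * r) * suc q                      ≡⟨ cong (λ t → 6 * t * n) (sym J≡) ⟩
      κ * n                                        ∎
      where
      lem : ∀ j q → 2 * (3 * j + q * (3 * j)) ≡ 6 * j * suc q
      lem = ℕ-Ring.solve-∀
    2I≤p : 2 * (J * n) ≤ p
    2I≤p = ℕ.*-cancelˡ-≤ 3 (begin
      3 * (2 * (J * suc q))                        ≡⟨ lem J q ⟩
      2 * (q * (3 * J)) + 6 * J                    ≤⟨ ℕ.+-mono-≤ (ℕ.*-monoʳ-≤ 2 (subst (λ t → q * (3 * t) ≤ p) (sym J≡) (m/n*n≤m p (3 * suc (a * r))))) κ≤p ⟩
      2 * p + p                                    ≡⟨ ℕ.+-comm (2 * p) p ⟩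
      3 * p                                        ∎)
      where
      lem : ∀ j q → 3 * (2 * (j * suc q)) ≡ 2 * (q * (3 * j)) + 6 * j
      lem = ℕ-Ring.solve-∀
    p≤2^a : p ≤ 2 ^ a
    p≤2^a = begin
      p                                ≤⟨ ℕ.<⇒≤ p<g ⟩
      (suc b * suc b) ^ m * c          ≤⟨ ℕ.*-mono-≤ (ℕ.^-monoˡ-≤ m (ℕ.*-mono-≤ (suc≤2^ b) (suc≤2^ b))) (ℕ.≤-trans (ℕ.n≤1+n c) (suc≤2^ c)) ⟩
      (2 ^ b * 2 ^ b) ^ m * 2 ^ c      ≡⟨ cong (λ t → t ^ m * 2 ^ c) (sym (ℕ.^-distribˡ-+-* 2 b b)) ⟩
      (2 ^ (b + b)) ^ m * 2 ^ c        ≡⟨ cong (_* 2 ^ c) (ℕ.^-*-assoc 2 (b + b) m) ⟩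
      2 ^ ((b + b) * m) * 2 ^ c        ≡⟨ sym (ℕ.^-distribˡ-+-* 2 ((b + b) * m) c) ⟩
      2 ^ ((b + b) * m + c)            ≡⟨ cong (2 ^_) (lem b m c) ⟩
      2 ^ a                            ∎
      where
      lem : ∀ b m c → (b + b) * m + c ≡ c + b * (2 * m)
      lem = ℕ-Ring.solve-∀
    p^r<2^J : p ^ r < 2 ^ J
    p^r<2^J = begin-strict
      p ^ r                ≤⟨ ℕ.^-monoˡ-≤ r p≤2^a ⟩
      (2 ^ a) ^ r          ≡⟨ ℕ.^-*-assoc 2 a r ⟩
      2 ^ (a * r)          <⟨ ℕ.^-monoʳ-< 2 (s≤s (s≤s z≤n)) (ℕ.n<1+n (a * r)) ⟩
      2 ^ suc (a * r)      ≡⟨ cong (2 ^_) (sym J≡) ⟩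
      2 ^ J                ∎

-- Olson's theorem for (ℤ/pᵃ)ʳ

nC0≡1 : ∀ n → n C 0 ≡ 1
nC0≡1 n = trans (nCk≡nC[n∸k] {n = n} z≤n) (nCn≡1 n)

absorption : ∀ n k → suc k * (suc n C suc k) ≡ suc n * (n C k)
absorption zero    zero    = refl
absorption zero    (suc k) = trans (cong (suc (suc k) *_) (k>n⇒nCk≡0 {1} {suc (suc k)} (s≤s (s≤s z≤n)))) (trans (ℕ.*-zeroʳ (suc (suc k))) (sym (trans (ℕ.*-identityˡ (0 C suc k)) (k>n⇒nCk≡0 {0} {suc k} (s≤s z≤n)))))
absorption (suc n) zero    = trans (ℕ.*-identityˡ (suc (suc n) C 1)) (trans (nC1≡n (suc (suc n))) (sym (trans (cong (suc (suc n) *_) (nC0≡1 (suc n))) (ℕ.*-identityʳ (suc (suc n))))))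
absorption (suc n) (suc k) = begin
  suc (suc k) * (suc (suc n) C suc (suc k))
    ≡⟨ cong (suc (suc k) *_) (sym (nCk+nC[k+1]≡[n+1]C[k+1] (suc n) (suc k))) ⟩
  suc (suc k) * (a + b)
    ≡⟨ lem k a b ⟩
  (suc k * a + suc (suc k) * b) + a
    ≡⟨ cong₂ (λ s t → s + t + a) (absorption n k) (absorption n (suc k)) ⟩
  (suc n * (n C k) + suc n * (n C suc k)) + a
    ≡⟨ cong (_+ a) (trans (sym (ℕ.*-distribˡ-+ (suc n) (n C k) (n C suc k))) (cong (suc n *_) (nCk+nC[k+1]≡[n+1]C[k+1] n k))) ⟩
  suc n * a + a
    ≡⟨ ℕ.+-comm (suc n * a) a ⟩
  suc (suc n) * a ∎
  where
  open ≡-Reasoning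
  a = suc n C suc k
  b = suc n C suc (suc k)
  lem : ∀ k a b → suc (suc k) * (a + b) ≡ (suc k * a + suc (suc k) * b) + a
  lem = ℕ-Ring.solve-∀

p∣pCk : ∀ {p} → Prime p → ∀ k → suc k < p → p ∣ p C suc k
p∣pCk {suc n} pp k k<p with euclidsLemma (suc k) (suc n C suc k) pp (divides (n C k) (trans (absorption n k) (ℕ.*-comm (suc n) (n C k))))
... | inj₁ p∣k = contradiction (∣.∣⇒≤ p∣k) (ℕ.<⇒≱ k<p)
... | inj₂ p∣C = p∣C

sumℕ : ∀ {r} → (Fin r → ℕ) → ℕ
sumℕ {zero}  n = 0
sumℕ {suc r} n = n Fin.zero + sumℕ (n ∘ Fin.suc)

sumℕ-const : ∀ r c → sumℕ {r} (λ _ → c) ≡ r * c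
sumℕ-const zero    c = refl
sumℕ-const (suc r) c = cong (λ t → c + t) (sumℕ-const r c)

sumℕ-≥ : ∀ {r} (n : Fin r → ℕ) → (∀ i → 1 ≤ n i) → r ≤ sumℕ n
sumℕ-≥ {zero}  n 1≤n = z≤n
sumℕ-≥ {suc r} n 1≤n = ℕ.+-mono-≤ (1≤n Fin.zero) (sumℕ-≥ (n ∘ Fin.suc) (1≤n ∘ Fin.suc))

decr : ∀ {r} → (Fin r → ℕ) → Fin r → Fin r → ℕ
decr n i j with j Fin.≟ i
... | yes _ = ℕ.pred (n j)
... | no  _ = n j

decr-suc : ∀ {r} (n : Fin (suc r) → ℕ) i j → decr n (Fin.suc i) (Fin.suc j) ≡ decr (n ∘ Fin.suc) i j
decr-suc n i j with j Fin.≟ i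
... | yes _ = refl
... | no  _ = refl

sumℕ-cong : ∀ {r} {m n : Fin r → ℕ} → (∀ i → m i ≡ n i) → sumℕ m ≡ sumℕ n
sumℕ-cong {zero}  e = refl
sumℕ-cong {suc r} e = cong₂ _+_ (e Fin.zero) (sumℕ-cong (e ∘ Fin.suc))

sumℕ-decr : ∀ {r} (n : Fin r → ℕ) i → 1 ≤ n i → sumℕ n ≡ suc (sumℕ (decr n i))
sumℕ-decr n Fin.zero 1≤n with n Fin.zero
... | suc _ = refl
sumℕ-decr n (Fin.suc i) 1≤n = trans (cong (λ t → n Fin.zero + t) (sumℕ-decr (n ∘ Fin.suc) i 1≤n))
  (trans (ℕ.+-suc (n Fin.zero) _) (cong (λ t → suc (n Fin.zero + t)) (sym (sumℕ-cong (decr-suc n i)))))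

-- Finite differences of functions on ℤʳ

module Differences {r : ℕ} where

  Ext : (V r → ℤ) → Set
  Ext φ = ∀ {x y : V r} → (∀ i → x i ≡ y i) → φ x ≡ φ y

  -- The action on functions of the element `[g] - 1` of the group ring; products in the
  -- augmentation ideal become the iterated differences `Δs`.
  Δ : V r → (V r → ℤ) → V r → ℤ
  Δ g φ x = φ (x +ᵛ g) ⊝ φ x

  Δs : List (V r) → (V r → ℤ) → V r → ℤ
  Δs []       φ = φ
  Δs (g ∷ gs) φ = Δ g (Δs gs φ)

  Δ^ : ℕ → V r → (V r → ℤ) → V r → ℤ
  Δ^ zero    e φ = φ
  Δ^ (suc n) e φ = Δ^ n e (Δ e φ)

  Δ-ext : ∀ {φ} g → Ext φ → Ext (Δ g φ)
  Δ-ext g ext e = cong₂ _⊝_ (ext (λ i → cong (_⊕ g i) (e i))) (ext e)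

  Δs-ext : ∀ {φ} gs → Ext φ → Ext (Δs gs φ)
  Δs-ext []       ext = ext
  Δs-ext (g ∷ gs) ext = Δ-ext g (Δs-ext gs ext)

  +ᵛ-swap : ∀ (x g h : V r) i → (x +ᵛ g +ᵛ h) i ≡ (x +ᵛ h +ᵛ g) i
  +ᵛ-swap x g h i = lem (x i) (g i) (h i)
    where
    lem : ∀ x g h → (x ⊕ g) ⊕ h ≡ (x ⊕ h) ⊕ g
    lem = solve-∀

  Δs-Δ : ∀ gs g {φ} → Ext φ → ∀ x → Δs gs (Δ g φ) x ≡ Δ g (Δs gs φ) x
  Δs-Δ []       g ext x = refl
  Δs-Δ (h ∷ gs) g {φ} ext x = begin
    Δs gs (Δ g φ) (x +ᵛ h) ⊝ Δs gs (Δ g φ) x  ≡⟨ cong₂ _⊝_ (Δs-Δ gs g ext (x +ᵛ h)) (Δs-Δ gs g ext x) ⟩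
    (ψ (x +ᵛ h +ᵛ g) ⊝ ψ (x +ᵛ h)) ⊝ (ψ (x +ᵛ g) ⊝ ψ x)
                                              ≡⟨ cong (λ t → (t ⊝ ψ (x +ᵛ h)) ⊝ (ψ (x +ᵛ g) ⊝ ψ x)) (Δs-ext gs ext (+ᵛ-swap x h g)) ⟩
    (ψ (x +ᵛ g +ᵛ h) ⊝ ψ (x +ᵛ h)) ⊝ (ψ (x +ᵛ g) ⊝ ψ x)
                                              ≡⟨ lem (ψ (x +ᵛ g +ᵛ h)) (ψ (x +ᵛ h)) (ψ (x +ᵛ g)) (ψ x) ⟩
    Δ g (Δ h ψ) x                             ∎
    where
    open ≡-Reasoning
    ψ = Δs gs φ
    lem : ∀ a b c d → (a ⊝ b) ⊝ (c ⊝ d) ≡ (a ⊝ c) ⊝ (b ⊝ d)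
    lem = solve-∀

  Δ^-Δ : ∀ n e g {φ} → Ext φ → ∀ x → Δ^ n e (Δ g φ) x ≡ Δ g (Δ^ n e φ) x
  Δ^-Δ zero    e g ext x = refl
  Δ^-Δ (suc n) e g {φ} ext x = trans (Δ^-cong n e (λ y → Δs-Δ (e ∷ []) g ext y) x) (Δ^-Δ n e g (Δ-ext e ext) x)
    where
    Δ^-cong : ∀ n e {φ ψ} → (∀ x → φ x ≡ ψ x) → ∀ x → Δ^ n e φ x ≡ Δ^ n e ψ x
    Δ^-cong zero    e eq x = eq x
    Δ^-cong (suc n) e eq x = Δ^-cong n e (λ y → cong₂ _⊝_ (eq (y +ᵛ e)) (eq y)) x

  Δ^-+ : ∀ m n e φ x → Δ^ (m + n) e φ x ≡ Δ^ n e (Δ^ m e φ) x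
  Δ^-+ zero    n e φ x = refl
  Δ^-+ (suc m) n e φ x = Δ^-+ m n e (Δ e φ) x

  rangeSum : ℕ → (ℕ → ℤ) → ℤ
  rangeSum zero    h = 0ℤ
  rangeSum (suc N) h = h 0 ⊕ rangeSum N (h ∘ suc)

  rangeSum-+ : ∀ N f g → rangeSum N (λ j → f j ⊕ g j) ≡ rangeSum N f ⊕ rangeSum N g
  rangeSum-+ zero    f g = refl
  rangeSum-+ (suc N) f g = trans (cong (f 0 ⊕ g 0 ⊕_) (rangeSum-+ N (f ∘ suc) (g ∘ suc))) (lem (f 0) (g 0) (rangeSum N (f ∘ suc)) (rangeSum N (g ∘ suc)))
    where
    lem : ∀ a b c d → (a ⊕ b) ⊕ (c ⊕ d) ≡ (a ⊕ c) ⊕ (b ⊕ d)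
    lem = solve-∀

  rangeSum-cong : ∀ N {f g} → (∀ j → f j ≡ g j) → rangeSum N f ≡ rangeSum N g
  rangeSum-cong zero    e = refl
  rangeSum-cong (suc N) e = cong₂ _⊕_ (e 0) (rangeSum-cong N (e ∘ suc))

  -- (1 + Δ)ᵏ is the translation by k e.
  translation : ∀ k e {φ} → Ext φ → ∀ x N → k < N → φ (x +ᵛ + k *ᵛ e) ≡ rangeSum N (λ j → + (k C j) ⊗ Δ^ j e φ x)
  translation zero e {φ} ext x (suc N) _ = begin
    φ (x +ᵛ + 0 *ᵛ e)   ≡⟨ ext (λ i → trans (cong (x i ⊕_) (ℤ.*-zeroˡ (e i))) (ℤ.+-identityʳ (x i))) ⟩
    φ x                 ≡⟨ sym (trans (ℤ.+-identityʳ (1ℤ ⊗ φ x)) (ℤ.*-identityˡ (φ x))) ⟩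
    1ℤ ⊗ φ x ⊕ 0ℤ       ≡⟨ cong (1ℤ ⊗ φ x ⊕_) (sym (zeros N (λ j → + (0 C suc j) ⊗ Δ^ j e (Δ e φ) x) (λ j → trans (cong (λ t → + t ⊗ Δ^ j e (Δ e φ) x) (k>n⇒nCk≡0 {0} {suc j} (s≤s z≤n))) (ℤ.*-zeroˡ (Δ^ j e (Δ e φ) x))))) ⟩
    1ℤ ⊗ φ x ⊕ rangeSum N (λ j → + (0 C suc j) ⊗ Δ^ j e (Δ e φ) x) ∎
    where
    open ≡-Reasoning
    zeros : ∀ N h → (∀ j → h j ≡ 0ℤ) → rangeSum N h ≡ 0ℤ
    zeros zero    h e = refl
    zeros (suc N) h e = cong₂ _⊕_ (e 0) (zeros N (h ∘ suc) (e ∘ suc))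
  translation (suc k) e {φ} ext x (suc N) (s≤s k<N) = begin
    φ (x +ᵛ + suc k *ᵛ e)
      ≡⟨ ext (λ i → trans (cong (x i ⊕_) (ℤ.suc-* (+ k) (e i))) (lem (x i) (e i) (+ k ⊗ e i))) ⟩
    φ (x +ᵛ + k *ᵛ e +ᵛ e)
      ≡⟨ lem′ (φ (x +ᵛ + k *ᵛ e +ᵛ e)) (φ (x +ᵛ + k *ᵛ e)) ⟩
    φ (x +ᵛ + k *ᵛ e) ⊕ Δ e φ (x +ᵛ + k *ᵛ e)
      ≡⟨ cong₂ _⊕_ (translation k e ext x (suc N) (ℕ.m<n⇒m<1+n k<N)) (translation k e (Δ-ext e ext) x N k<N) ⟩
    (+ (k C 0) ⊗ φ x ⊕ rangeSum N (λ j → + (k C suc j) ⊗ D j)) ⊕ rangeSum N (λ j → + (k C j) ⊗ D j)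
      ≡⟨ lem″ (+ (k C 0) ⊗ φ x) (rangeSum N (λ j → + (k C suc j) ⊗ D j)) (rangeSum N (λ j → + (k C j) ⊗ D j)) ⟩
    + (k C 0) ⊗ φ x ⊕ (rangeSum N (λ j → + (k C j) ⊗ D j) ⊕ rangeSum N (λ j → + (k C suc j) ⊗ D j))
      ≡⟨ cong₂ _⊕_ (cong (λ t → + t ⊗ φ x) (trans (nC0≡1 k) (sym (nC0≡1 (suc k))))) (sym (rangeSum-+ N (λ j → + (k C j) ⊗ D j) (λ j → + (k C suc j) ⊗ D j))) ⟩
    + (suc k C 0) ⊗ φ x ⊕ rangeSum N (λ j → + (k C j) ⊗ D j ⊕ + (k C suc j) ⊗ D j)
      ≡⟨ cong (+ (suc k C 0) ⊗ φ x ⊕_) (rangeSum-cong N (λ j → trans (sym (ℤ.*-distribʳ-+ (D j) (+ (k C j)) (+ (k C suc j)))) (cong (λ t → + t ⊗ D j) (nCk+nC[k+1]≡[n+1]C[k+1] k j)))) ⟩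
    + (suc k C 0) ⊗ φ x ⊕ rangeSum N (λ j → + (suc k C suc j) ⊗ D j) ∎
    where
    open ≡-Reasoning
    D : ℕ → ℤ
    D j = Δ^ j e (Δ e φ) x
    lem : ∀ x e t → x ⊕ (e ⊕ t) ≡ (x ⊕ t) ⊕ e
    lem = solve-∀
    lem′ : ∀ a b → a ≡ b ⊕ (a ⊝ b)
    lem′ = solve-∀
    lem″ : ∀ a b c → (a ⊕ b) ⊕ c ≡ a ⊕ (c ⊕ b)
    lem″ = solve-∀

  -- `Δs` expands into a signed sum of the values `φ (x + Σ T)` over all sublists `T`; if it is not
  -- zero, some term is not.
  hit-or-zero : ∀ {X : Set} (f : X → V r) {φ} → Ext φ → ∀ A x →
                (Σ (List X) λ T → T ⊆ A × φ (x +ᵛ vsum f T) ≢ 0ℤ) ⊎ Δs (map f A) φ x ≡ 0ℤ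
  hit-or-zero f {φ} ext [] x with φ x ℤ.≟ 0ℤ
  ... | yes φ≡0 = inj₂ φ≡0
  ... | no φ≢0 = inj₁ ([] , [] , φ≢0 ∘ trans (ext (λ i → sym (ℤ.+-identityʳ (x i)))))
  hit-or-zero f {φ} ext (a ∷ A) x with hit-or-zero f ext A (x +ᵛ f a) | hit-or-zero f ext A x
  ... | inj₁ (T , T⊆ , hit) | _ = inj₁ (a ∷ T , refl ∷ T⊆ , hit ∘ trans (ext (λ i → ℤ.+-assoc (x i) (f a i) (vsum f T i))))
  ... | inj₂ _ | inj₁ (T , T⊆ , hit) = inj₁ (T , a ∷ʳ T⊆ , hit)
  ... | inj₂ z | inj₂ z′ = inj₂ (cong₂ _⊝_ z z′)

  -- In the same expansion, if all terms with non-empty `T` vanish, only the empty one is left, with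
  -- value `φ x` up to sign.
  hit-or-unit : ∀ {X : Set} (f : X → V r) {φ} → Ext φ → ∀ A x →
                (Σ (List X) λ T → T ⊆ A × T ≢ [] × φ (x +ᵛ vsum f T) ≢ 0ℤ) ⊎ ∣ Δs (map f A) φ x ∣ ≡ ∣ φ x ∣
  hit-or-unit f ext [] x = inj₂ refl
  hit-or-unit f {φ} ext (a ∷ A) x with hit-or-zero f ext A (x +ᵛ f a) | hit-or-unit f ext A x
  ... | inj₁ (T , T⊆ , hit) | _ = inj₁ (a ∷ T , refl ∷ T⊆ , (λ ()) , hit ∘ trans (ext (λ i → ℤ.+-assoc (x i) (f a i) (vsum f T i))))
  ... | inj₂ _ | inj₁ (T , T⊆ , T≢[] , hit) = inj₁ (T , a ∷ʳ T⊆ , T≢[] , hit)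
  ... | inj₂ z | inj₂ e = inj₂ (trans (cong ∣_∣ (trans (cong (_⊝ Δs (map f A) φ x) z) (ℤ.+-identityˡ (⊖ Δs (map f A) φ x)))) (trans (ℤ.∣-i∣≡∣i∣ (Δs (map f A) φ x)) e))

module Olson (p : ℕ) (pp : Prime p) {r : ℕ} where
  open Mod p
  open Differences {r}

  Δ^-cong : ∀ n e {φ ψ} → (∀ x → φ x ≈ ψ x) → ∀ x → Δ^ n e φ x ≈ Δ^ n e ψ x
  Δ^-cong zero    e eq x = eq x
  Δ^-cong (suc n) e eq x = Δ^-cong n e (λ y → ⊝-cong (eq (y +ᵛ e)) (eq y)) x

  Δs-zero : ∀ gs {φ} → (∀ x → φ x ≈ 0ℤ) → ∀ x → Δs gs φ x ≈ 0ℤ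
  Δs-zero []       eq x = eq x
  Δs-zero (g ∷ gs) eq x = ⊝-cong (Δs-zero gs eq (x +ᵛ g)) (Δs-zero gs eq x)

  invariant : ∀ {ψ} → Ext ψ → (∀ i x → ψ (x +ᵛ δ i) ≈ ψ x) → ∀ g x → ψ (x +ᵛ g) ≈ ψ x
  invariant {ψ} ext unit g x = ≈-trans (≡⇒≈ (ext (λ i → cong (x i ⊕_) (sym (comb-δ g i))))) (combination g δ (λ j a y → multiple a j y) x)
    where
    natural : ∀ n i x → ψ (x +ᵛ + n *ᵛ δ i) ≈ ψ x
    natural zero    i x = ≡⇒≈ (ext (λ l → trans (cong (x l ⊕_) (ℤ.*-zeroˡ (δ i l))) (ℤ.+-identityʳ (x l))))
    natural (suc n) i x = ≈-trans (≡⇒≈ (ext (λ l → trans (cong (x l ⊕_) (ℤ.suc-* (+ n) (δ i l))) (lem (x l) (δ i l) (+ n ⊗ δ i l)))))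
                                  (≈-trans (unit i (x +ᵛ + n *ᵛ δ i)) (natural n i x))
      where
      lem : ∀ x e t → x ⊕ (e ⊕ t) ≡ (x ⊕ t) ⊕ e
      lem = solve-∀
    multiple : ∀ a i x → ψ (x +ᵛ a *ᵛ δ i) ≈ ψ x
    multiple (+ n) i x = natural n i x
    multiple -[1+ n ] i x = ≈-sym (≈-trans (≡⇒≈ (ext (λ l → lem (x l) (+ suc n) (δ i l)))) (natural (suc n) i (x +ᵛ -[1+ n ] *ᵛ δ i)))
      where
      lem : ∀ x n e → x ≡ (x ⊕ (⊖ n) ⊗ e) ⊕ n ⊗ e
      lem = solve-∀
    combination : ∀ {k} (γ : Fin k → ℤ) (u : Fin k → V r) → (∀ j a x → ψ (x +ᵛ a *ᵛ u j) ≈ ψ x) → ∀ x → ψ (x +ᵛ comb γ u) ≈ ψ x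
    combination {zero}  γ u inv x = ≡⇒≈ (ext (λ l → ℤ.+-identityʳ (x l)))
    combination {suc k} γ u inv x = ≈-trans (≡⇒≈ (ext (λ l → sym (ℤ.+-assoc (x l) _ _))))
      (≈-trans (combination (γ ∘ Fin.suc) (u ∘ Fin.suc) (inv ∘ Fin.suc) (x +ᵛ γ Fin.zero *ᵛ u Fin.zero)) (inv Fin.zero (γ Fin.zero) x))

  -- In the group ring, Σ(nᵢ - 1) + 1 elements of the augmentation ideal multiply to zero on functions killed by every Δ_{eᵢ}^{nᵢ}.
  kill : ∀ m (n : Fin r → ℕ) {φ} → Ext φ → (∀ i x → Δ^ (n i) (δ i) φ x ≈ 0ℤ) → sumℕ n < m + r →
         ∀ gs → length gs ≡ m → ∀ x → Δs gs φ x ≈ 0ℤ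
  kill m n {φ} ext nil bound gs len x = go (Fin.any? (λ i → n i ℕ.≟ 0)) m gs len bound
    where
    go : Dec (Σ (Fin r) λ i → n i ≡ 0) → ∀ m gs → length gs ≡ m → sumℕ n < m + r → Δs gs φ x ≈ 0ℤ
    go (yes (i , ni≡0)) m gs len bound = Δs-zero gs (λ y → subst (λ t → Δ^ t (δ i) φ y ≈ 0ℤ) ni≡0 (nil i y)) x
    go (no none) zero gs len bound = contradiction (sumℕ-≥ n (λ i → ℕ.n≢0⇒n>0 (λ ni≡0 → none (i , ni≡0)))) (ℕ.<⇒≱ bound)
    go (no none) (suc m) (g ∷ gs) len bound =
      ≈-trans (⊝-cong (invariant (Δs-ext gs ext) unit g x) ≈-refl) (≡⇒≈ (ℤ.+-inverseʳ (Δs gs φ x)))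
      where
      1≤n : ∀ i → 1 ≤ n i
      1≤n i = ℕ.n≢0⇒n>0 (λ ni≡0 → none (i , ni≡0))
      nil′ : ∀ i j y → Δ^ (decr n i j) (δ j) (Δ (δ i) φ) y ≈ 0ℤ
      nil′ i j y with j Fin.≟ i
      ... | yes refl = subst (λ t → Δ^ t (δ i) φ y ≈ 0ℤ) (sym (ℕ.suc-pred (n i) {{ℕ.>-nonZero (1≤n i)}})) (nil i y)
      ... | no _ = ≈-trans (≡⇒≈ (Δ^-Δ (n j) (δ j) (δ i) ext y)) (⊝-cong (nil j (y +ᵛ δ i)) (nil j y))
      -- Differences commute, so the change along `δ i` is `Δs gs` applied to `Δ (δ i) φ`, for which
      -- one exponent, and hence the sum of them, is smaller by one.
      unit : ∀ i y → Δs gs φ (y +ᵛ δ i) ≈ Δs gs φ y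
      unit i y = ⊝≈0⇒≈ (≈-trans (≡⇒≈ (sym (Δs-Δ gs (δ i) ext y)))
        (kill m (decr n i) (Δ-ext (δ i) ext) (nil′ i) (ℕ.≤-pred (subst (_< suc m + r) (sumℕ-decr n i (1≤n i)) bound)) gs (ℕ.suc-injective len) y))

  rangeSum-last : ∀ N h → (∀ j → j < N → h j ≈ 0ℤ) → rangeSum (suc N) h ≈ h N
  rangeSum-last zero    h zeros = ≡⇒≈ (ℤ.+-identityʳ (h 0))
  rangeSum-last (suc N) h zeros = ≈-trans (⊕-cong (zeros 0 (s≤s z≤n)) (rangeSum-last N (h ∘ suc) (λ j j<N → zeros (suc j) (s≤s j<N)))) (≡⇒≈ (ℤ.+-identityˡ (h (suc N))))

  -- In the binomial expansion of `(1 + Δ)` to the power `p`, which is translation by `p e`, all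
  -- middle coefficients vanish modulo `p`.
  frobenius-prime : ∀ e {φ} → Ext φ → ∀ x → Δ^ p e φ x ≈ Δ (+ p *ᵛ e) φ x
  frobenius-prime e {φ} ext x = ≈-sym (≈-trans (⊝-cong (≈-trans (≡⇒≈ (translation p e ext x (suc p) ℕ.≤-refl)) sum≈) (≈-refl {φ x})) (≡⇒≈ (lem (φ x) (Δ^ p e φ x))))
    where
    lem : ∀ a b → (a ⊕ b) ⊝ a ≡ b
    lem = solve-∀
    h : ℕ → ℤ
    h j = + (p C j) ⊗ Δ^ j e φ x
    head-term : h 0 ≡ φ x
    head-term = trans (cong (λ t → + t ⊗ φ x) (nC0≡1 p)) (ℤ.*-identityˡ (φ x))
    last-term : h p ≡ Δ^ p e φ x
    last-term = trans (cong (λ t → + t ⊗ Δ^ p e φ x) (nCn≡1 p)) (ℤ.*-identityˡ (Δ^ p e φ x))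
    middle : ∀ j → suc j < p → h (suc j) ≈ 0ℤ
    middle j j<p = ≈-trans (⊗-congʳ (Δ^ (suc j) e φ x) (∣⇒≈0 {+ (p C suc j)} (p∣pCk pp j j<p))) (≡⇒≈ (ℤ.*-zeroˡ (Δ^ (suc j) e φ x)))
    sum≈ : rangeSum (suc p) h ≈ φ x ⊕ Δ^ p e φ x
    sum≈ = tail p refl
      where
      tail : ∀ q → q ≡ p → h 0 ⊕ rangeSum q (h ∘ suc) ≈ φ x ⊕ Δ^ p e φ x
      tail zero q≡p = contradiction (subst Prime (sym q≡p) pp) ¬prime[0]
      tail (suc q) q≡p = ⊕-cong (≡⇒≈ head-term) (≈-trans (rangeSum-last q (h ∘ suc) (λ j j<q → middle j (subst (suc j <_) q≡p (s≤s j<q))))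
        (≡⇒≈ (trans (cong h q≡p) last-term)))

  frobenius : ∀ a e {φ} → Ext φ → ∀ x → Δ^ (p ^ a) e φ x ≈ Δ (+ (p ^ a) *ᵛ e) φ x
  frobenius zero e {φ} ext x = ≡⇒≈ (cong (_⊝ φ x) (ext (λ i → cong (x i ⊕_) (sym (ℤ.*-identityˡ (e i))))))
  frobenius (suc a) e {φ} ext x = ≈-trans (blocks p ext x) (≈-trans (frobenius-prime (+ m *ᵛ e) ext x)
    (≡⇒≈ (cong (_⊝ φ x) (ext (λ i → cong (x i ⊕_) (trans (sym (ℤ.*-assoc (+ p) (+ m) (e i))) (cong (_⊗ e i) (sym (ℤ.pos-* p m)))))))))
    where
    m = p ^ a
    blocks : ∀ k {φ} → Ext φ → ∀ x → Δ^ (k * m) e φ x ≈ Δ^ k (+ m *ᵛ e) φ x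
    blocks zero ext x = ≈-refl
    blocks (suc k) {φ} ext x = ≈-trans (≡⇒≈ (Δ^-+ m (k * m) e φ x))
      (≈-trans (Δ^-cong (k * m) e (frobenius a e ext) x) (blocks k (Δ-ext (+ m *ᵛ e) ext) x))

  module _ (a : ℕ) where
    private
      q = p ^ a
      module Q = Mod q

    indicator : V r → ℤ
    indicator x = if does (Fin.all? (λ i → Q.≈0? (x i))) then 1ℤ else 0ℤ

    indicator-cong : ∀ {x y} → x Q.≋ y → indicator x ≡ indicator y
    indicator-cong {x} {y} e = cong (λ b → if b then 1ℤ else 0ℤ)
      (does-⇔ (mk⇔ (λ x≈0 i → Q.≈-trans (Q.≈-sym (e i)) (x≈0 i)) (λ y≈0 i → Q.≈-trans (e i) (y≈0 i)))
        (Fin.all? (λ i → Q.≈0? (x i))) (Fin.all? (λ i → Q.≈0? (y i))))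

    -- The hypothesis says that the length exceeds `r(q - 1)`. The indicator of `qℤʳ` satisfies
    -- `Δ^q = Δ (q e) = 0` modulo `p` for each unit vector `e`, so that many differences annihilate
    -- it modulo `p`. Without a non-empty zero-sum sublist the result at 0 would be 1 or -1.
    olson : ∀ {X : Set} (f : X → V r) A → r * q < length A + r → Σ (List X) λ T → T ⊆ A × T ≢ [] × (vsum f T Q.≋ 0ᵛ)
    olson f A long = [ (λ { (T , T⊆ , T≢[] , hit) → T , T⊆ , T≢[] , in-support T hit }) , (λ e → contradiction (vanishes e) (1≉0 pp)) ]′
                     (hit-or-unit f ext A 0ᵛ)
      where
      ext : Ext indicator
      ext e = indicator-cong (Q.≡⇒≋ e)
      periodic : ∀ i x → Δ^ q (δ i) indicator x ≈ 0ℤ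
      periodic i x = ≈-trans (frobenius a (δ i) ext x) (≡⇒≈ (trans (cong (_⊝ indicator x) (indicator-cong {x +ᵛ + q *ᵛ δ i} {x} (λ l → Q.mod (δ i l) (cong (x l ⊕_) (ℤ.*-comm (+ q) (δ i l)))))) (ℤ.+-inverseʳ (indicator x))))
      killed : Δs (map f A) indicator 0ᵛ ≈ 0ℤ
      killed = kill (length A) (λ _ → q) ext periodic (subst (_< length A + r) (sym (sumℕ-const r q)) long) (map f A) (List.length-map f A) 0ᵛ
      at-0 : indicator 0ᵛ ≡ 1ℤ
      at-0 = cong (λ b → if b then 1ℤ else 0ℤ) (dec-true (Fin.all? (λ i → Q.≈0? (0ᵛ {r} i))) (λ i → Q.≈-refl))
      vanishes : ∣ Δs (map f A) indicator 0ᵛ ∣ ≡ ∣ indicator 0ᵛ ∣ → 1ℤ ≈ 0ℤ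
      vanishes e = ∣⇒≈0 (subst (p ∣_) (trans e (cong ∣_∣ at-0)) (≈0⇒∣ killed))
      in-support : ∀ T → indicator (0ᵛ +ᵛ vsum f T) ≢ 0ℤ → vsum f T Q.≋ 0ᵛ
      in-support T hit i = Q.≈-trans (Q.≡⇒≈ (sym (ℤ.+-identityˡ (vsum f T i)))) (decided (Fin.all? (λ i → Q.≈0? ((0ᵛ +ᵛ vsum f T) i))) hit i)
        where
        decided : ∀ {P : Set} (P? : Dec P) → (if does P? then 1ℤ else 0ℤ) ≢ 0ℤ → P
        decided (yes P) _ = P
        decided (no _) hit = contradiction refl hit

-- Zero-sum sequences over Cₙʳ

-- A popular value of the first coordinate cuts out a hyperplane and lowers the dimension. The
-- factor `suc p` in place of `p` makes the pigeonhole inequality strict.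
egz-small : ∀ p → Prime p → ∀ d → Blocks.EGZ p d (p * suc p ^ d)
egz-small p pp zero = EGZ-mono (ℕ.≤-reflexive (sym (ℕ.*-identityʳ p))) (egz-0 p)
egz-small p pp (suc d) f A long =
  let t , B , R , e , longB , onPlane = pigeonhole-labels p ℓ (All.tabulate {xs = A} (λ {x} _ → label x)) long′
  in Block-mono e (hyperplane-block pp (egz-small p pp d) f (δ Fin.zero) (δ Fin.zero) (≡⇒≈ (dot-δ {suc d} Fin.zero (δ Fin.zero)))
       1 ℕ.≤-refl (ℕ.nonTrivial⇒n>1 p {{prime⇒nonTrivial pp}}) (+ toℕ t) B (ℕ.<⇒≤ longB) onPlane)
  where
  open Mod p
  open Blocks p
  instance
    nz-p : NonZero p
    nz-p = prime⇒nonZero pp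
    nz-^ : NonZero (suc p ^ d)
    nz-^ = ℕ.m^n≢0 (suc p) d
  ℓ = p * suc p ^ d
  long′ : p * ℓ < length A
  long′ = ℕ.<-≤-trans (ℕ.m<n+m (p * ℓ) (ℕ.>-nonZero⁻¹ ℓ {{ℕ.m*n≢0 p (suc p ^ d)}})) (ℕ.≤-trans (ℕ.≤-reflexive (lem p (suc p ^ d))) long)
    where
    lem : ∀ p x → p * x + p * (p * x) ≡ p * (suc p * x)
    lem = ℕ-Ring.solve-∀
  label : ∀ x → Σ (Fin p) λ t → 1ℤ ⊗ dot (δ Fin.zero) (f x) ≈ + toℕ t
  label x = fromℕ< (n%ℕd<d (f x Fin.zero) p) ,
    mod (f x Fin.zero /ℕ p) (trans (trans (ℤ.*-identityˡ (dot (δ Fin.zero) (f x))) (dot-δ Fin.zero (f x)))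
      (trans (a≡a%ℕn+[a/ℕn]*n (f x Fin.zero) p) (cong (λ t → + t ⊕ f x Fin.zero /ℕ p ⊗ + p) (sym (Fin.toℕ-fromℕ< (n%ℕd<d (f x Fin.zero) p))))))

-- F = o(Q), uniformly in the primes p ≤ Q
egz-uniform : ∀ r c → 1 ≤ c → Σ ℕ λ Q₀ → ∀ Q → Q₀ ≤ Q → Σ ℕ λ F → F * c ≤ Q × (∀ p → Prime p → p ≤ Q → Blocks.EGZ p r (p * F))
egz-uniform r c 1≤c = P ^ r * c , λ Q Q₀≤Q → Q / c , m/n*n≤m Q c , at Q Q₀≤Q
  where
  instance
    nz-c : NonZero c
    nz-c = ℕ.>-nonZero 1≤c
  P = proj₁ (egz-large r c 1≤c)
  weaken : ∀ {p F Q} → F * c ≤ Q → Blocks.EGZ p r (p * F) → Blocks.EGZ p r (p * (Q / c))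
  weaken {p} {F} {Q} F*c≤Q = EGZ-mono (ℕ.*-monoʳ-≤ p (ℕ.≤-trans (ℕ.≤-reflexive (sym (m*n/n≡m F c))) (/-monoˡ-≤ c F*c≤Q)))
  at : ∀ Q → P ^ r * c ≤ Q → ∀ p → Prime p → p ≤ Q → Blocks.EGZ p r (p * (Q / c))
  at Q Q₀≤Q p pp p≤Q with ℕ.<-≤-connex p P
  -- Here `F = suc p ^ r` is at most `P ^ r`, which `Q₀` exceeds by the factor `c`.
  ... | inj₁ p<P = weaken (ℕ.≤-trans (ℕ.*-monoˡ-≤ c (ℕ.^-monoˡ-≤ r p<P)) Q₀≤Q) (egz-small p pp r)
  ... | inj₂ P≤p = let F , F*c≤p , egz = proj₂ (egz-large r c 1≤c) p pp P≤p in weaken (ℕ.≤-trans F*c≤p p≤Q) egz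

-- Disjoint zero-sum blocks, one prime factor at a time

concat-↭ : ∀ {X : Set} {xss yss : List (List X)} → xss ↭ yss → concat xss ↭ concat yss
concat-↭ ↭.refl = ↭-refl
concat-↭ (↭.prep xs e) = ++⁺ˡ xs (concat-↭ e)
concat-↭ (↭.swap xs ys e) = ↭-trans (shifts xs ys) (++⁺ˡ ys (++⁺ˡ xs (concat-↭ e)))
concat-↭ (↭.trans e f) = ↭-trans (concat-↭ e) (concat-↭ f)

DisjointBlocks : ∀ {X : Set} {r} → (X → V r) → ℕ → List X → ℕ → Set
DisjointBlocks {X} f m A t = Σ (List (List X)) λ Bs → Σ (List X) λ R →
  A ↭ concat Bs ++ R × length Bs ≡ t × All (λ B → B ≢ [] × Mod._≋_ m (vsum f B) 0ᵛ) Bs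

extract : ∀ {X : Set} {r} p → Prime p → ∀ {F} → Blocks.EGZ p r (p * F) → (f : X → V r) → ∀ u A → p * u + p * F ≤ length A → DisjointBlocks f p A u
extract p pp egz f zero A long = [] , A , ↭-refl , refl , []
extract {X} p pp {F} egz f (suc u) A long =
  let T , R , e , len , zero-sum = egz f A (ℕ.≤-trans (ℕ.m≤n+m (p * F) (p * suc u)) long)
      Bs , R′ , e′ , len′ , good = extract p pp egz f u R (shorter {T} {R} e len)
  in T ∷ Bs , R′ , ↭-trans e (↭-trans (++⁺ˡ T e′) (↭-reflexive (sym (List.++-assoc T (concat Bs) R′)))) , cong suc len′ , (nonempty T len , zero-sum) ∷ good
  where
  nonempty : ∀ (T : List X) → length T ≡ p → T ≢ []
  nonempty [] len refl = ¬prime[0] (subst Prime (sym len) pp)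
  shorter : ∀ {T R} → A ↭ T ++ R → length T ≡ p → p * u + p * F ≤ length R
  shorter {T} {R} e len = ℕ.+-cancelˡ-≤ p _ _ (begin
    p + (p * u + p * F)     ≡⟨ lem p u (p * F) ⟩
    p * suc u + p * F       ≤⟨ long ⟩
    length A                ≡⟨ trans (length-split {T = T} e) (cong (_+ length R) len) ⟩
    p + length R            ∎)
    where
    open ℕ.≤-Reasoning
    lem : ∀ p u x → p + (p * u + x) ≡ p * suc u + x
    lem = ℕ-Ring.solve-∀

div : ∀ {X : Set} {r} (m : ℕ) .{{_ : NonZero m}} → (X → V r) → List X → V r
div m f B i = vsum f B i /ℕ m

div-exact : ∀ {X : Set} {r} m .{{_ : NonZero m}} (f : X → V r) {B} → Mod._≋_ m (vsum f B) 0ᵛ → ∀ i → vsum f B i ≡ + m ⊗ div m f B i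
div-exact m f {B} e i = trans (a≡a%ℕn+[a/ℕn]*n v m) (trans (cong (λ t → + t ⊕ v /ℕ m ⊗ + m) rem≡0) (trans (ℤ.+-identityˡ _) (ℤ.*-comm (v /ℕ m) (+ m))))
  where
  open Mod m
  v = vsum f B i
  rem≈0 : + (v %ℕ m) ≈ 0ℤ
  rem≈0 = ≈-trans (≈-sym (mod (v /ℕ m) (a≡a%ℕn+[a/ℕn]*n v m))) (e i)
  rem≡0 : v %ℕ m ≡ 0
  rem≡0 with v %ℕ m | n%ℕd<d v m | rem≈0
  ... | zero  | _  | _ = refl
  ... | suc t | lt | e′ = contradiction (∣.∣⇒≤ (≈0⇒∣ e′)) (ℕ.<⇒≱ lt)

vsum-concat : ∀ {X : Set} {r} m .{{_ : NonZero m}} (f : X → V r) {Bs} → All (λ B → B ≢ [] × Mod._≋_ m (vsum f B) 0ᵛ) Bs →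
              ∀ i → vsum f (concat Bs) i ≡ + m ⊗ vsum (div m f) Bs i
vsum-concat m f [] i = sym (ℤ.*-zeroʳ (+ m))
vsum-concat m f {B ∷ Bs} ((_ , e) ∷ good) i =
  trans (vsum-++ f B (concat Bs) i) (trans (cong₂ _⊕_ (div-exact m f {B} e i) (vsum-concat m f good i)) (sym (ℤ.*-distribˡ-+ (+ m) (div m f B i) (vsum (div m f) Bs i))))

concat-good : ∀ {X : Set} {r} m m′ .{{_ : NonZero m}} (f : X → V r) {Bs} → All (λ B → B ≢ [] × Mod._≋_ m (vsum f B) 0ᵛ) Bs →
              Bs ≢ [] → Mod._≋_ m′ (vsum (div m f) Bs) 0ᵛ → concat Bs ≢ [] × Mod._≋_ (m * m′) (vsum f (concat Bs)) 0ᵛ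
concat-good m m′ f {Bs} good Bs≢[] e = nonempty good Bs≢[] , zero-sum
  where
  nonempty : ∀ {Bs} → All (λ B → B ≢ [] × Mod._≋_ m (vsum f B) 0ᵛ) Bs → Bs ≢ [] → concat Bs ≢ []
  nonempty [] Bs≢[] _ = Bs≢[] refl
  nonempty {[] ∷ _} ((B≢[] , _) ∷ _) _ _ = B≢[] refl
  nonempty {(x ∷ B) ∷ _} _ _ ()
  zero-sum : Mod._≋_ (m * m′) (vsum f (concat Bs)) 0ᵛ
  zero-sum i with e i
  ... | Mod.mod q eq = Mod.mod q (trans (vsum-concat m f good i) (trans (cong (+ m ⊗_) eq) (trans (lem (+ m) q (+ m′)) (cong (λ t → 0ℤ ⊕ q ⊗ t) (sym (ℤ.pos-* m m′))))))
    where
    lem : ∀ m q m′ → m ⊗ (0ℤ ⊕ q ⊗ m′) ≡ 0ℤ ⊕ q ⊗ (m ⊗ m′)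
    lem = solve-∀

-- The surplus needed beyond `product ps * t`: grouping modulo `p` needs a reserve of `pF` elements,
-- and each surplus block demanded by the later primes consists of `p` elements.
loss : ℕ → List ℕ → ℕ
loss F []       = 0
loss F (p ∷ ps) = p * (loss F ps + F)

-- The summand `2 * F` on the left lets the induction close: as `p ≥ 2`, it is at most `p F`, and
-- `p (l + F) + p F = p (l + 2F)`.
loss≤ : ∀ F {ps} → All Prime ps → loss F ps + 2 * F ≤ 2 * F * product ps
loss≤ F [] = ℕ.≤-reflexive (sym (ℕ.*-identityʳ (2 * F)))
loss≤ F {p ∷ ps} (pp ∷ primes) = begin
  p * (loss F ps + F) + 2 * F         ≤⟨ ℕ.+-monoʳ-≤ (p * (loss F ps + F)) (ℕ.*-monoˡ-≤ F (ℕ.nonTrivial⇒n>1 p {{prime⇒nonTrivial pp}})) ⟩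
  p * (loss F ps + F) + p * F         ≡⟨ lem p (loss F ps) F ⟩
  p * (loss F ps + 2 * F)             ≤⟨ ℕ.*-monoʳ-≤ p (loss≤ F primes) ⟩
  p * (2 * F * product ps)            ≡⟨ lem′ p (2 * F) (product ps) ⟩
  2 * F * (p * product ps)            ∎
  where
  open ℕ.≤-Reasoning
  lem : ∀ p l F → p * (l + F) + p * F ≡ p * (l + 2 * F)
  lem = ℕ-Ring.solve-∀
  lem′ : ∀ p a b → p * (a * b) ≡ a * (p * b)
  lem′ = ℕ-Ring.solve-∀

-- Each prime factor in turn groups the blocks obtained so far, after dividing their sums by the primes already used.
chain : ∀ {r F} ps → All Prime ps → (∀ {p} → p ∈ ps → Blocks.EGZ p r (p * F)) → ∀ {X : Set} (f : X → V r) A t →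
        product ps * t + loss F ps ≤ length A → DisjointBlocks f (product ps) A t
chain [] primes egz f A t long =
  map (λ x → x ∷ []) (take t A) , drop t A ,
  ↭-reflexive (sym (trans (cong (_++ drop t A) (List.concat-map-[ take t A ])) (List.take++drop≡id t A))) ,
  trans (List.length-map _ (take t A)) (trans (List.length-take t A) (ℕ.m≤n⇒m⊓n≡m (ℕ.≤-trans (ℕ.≤-reflexive (sym (trans (ℕ.+-identityʳ (1 * t)) (ℕ.*-identityˡ t)))) long))) ,
  All.map⁺ (All.tabulate {xs = take t A} (λ {x} _ → (λ ()) , λ i → Mod.∣⇒≈0 1 (∣.1∣ _)))
chain {F = F} (p ∷ ps) (pp ∷ primes) egz f A t long =
  let Bs , R , e , len , good = extract p pp (egz (here refl)) f u A long′
      Cs , R′ , e′ , len′ , good′ = chain ps primes (λ p∈ → egz (there p∈)) (div p f) Bs t (ℕ.≤-reflexive (sym len))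
      goodC = All.concat⁻ (All.++⁻ˡ (concat Cs) (All-resp-↭ e′ good))
  in map concat Cs , concat R′ ++ R ,
     ↭-trans e (↭-trans (++⁺ʳ R (concat-↭ e′)) (↭-reflexive (trans (cong (_++ R) (sym (List.concat-++ (concat Cs) R′)))
       (trans (List.++-assoc (concat (concat Cs)) (concat R′) R) (cong (_++ (concat R′ ++ R)) (sym (List.concat-concat Cs))))))) ,
     trans (List.length-map concat Cs) len′ ,
     All.map⁺ (All.zipWith (λ { (gs , (C≢[] , e″)) → concat-good p (product ps) f gs C≢[] e″ }) (goodC , good′))
  where
  instance
    nz-p : NonZero p
    nz-p = prime⇒nonZero pp
  u = product ps * t + loss F ps
  long′ : p * u + p * F ≤ length A
  long′ = ℕ.≤-trans (ℕ.≤-reflexive (lem p (product ps) t (loss F ps) F)) long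
    where
    lem : ∀ p m t l F → p * (m * t + l) + p * F ≡ p * m * t + p * (l + F)
    lem = ℕ-Ring.solve-∀

-- Blocks are found up to rearrangement, whereas `HasZeroSumSubseq` asks for a sublist in the given
-- order; this restores the order.
⊆-resp-↭ : ∀ {X : Set} {xs ys zs : List X} → xs ⊆ ys → ys ↭ zs → Σ (List X) λ xs′ → xs′ ⊆ zs × xs ↭ xs′
⊆-resp-↭ s ↭.refl = _ , s , ↭-refl
⊆-resp-↭ (y ∷ʳ s) (↭.prep _ e) = let _ , s′ , e′ = ⊆-resp-↭ s e in _ , y ∷ʳ s′ , e′
⊆-resp-↭ (refl ∷ s) (↭.prep x e) = let _ , s′ , e′ = ⊆-resp-↭ s e in _ , refl ∷ s′ , ↭-prep x e′
⊆-resp-↭ (_ ∷ʳ _ ∷ʳ s) (↭.swap x y e) = let _ , s′ , e′ = ⊆-resp-↭ s e in _ , y ∷ʳ x ∷ʳ s′ , e′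
⊆-resp-↭ (_ ∷ʳ refl ∷ s) (↭.swap x y e) = let _ , s′ , e′ = ⊆-resp-↭ s e in _ , refl ∷ x ∷ʳ s′ , ↭-prep y e′
⊆-resp-↭ (refl ∷ _ ∷ʳ s) (↭.swap x y e) = let _ , s′ , e′ = ⊆-resp-↭ s e in _ , y ∷ʳ refl ∷ s′ , ↭-prep x e′
⊆-resp-↭ (refl ∷ refl ∷ s) (↭.swap x y e) = let _ , s′ , e′ = ⊆-resp-↭ s e in _ , refl ∷ refl ∷ s′ , ↭-swap x y e′
⊆-resp-↭ s (↭.trans e f) = let _ , s′ , e′ = ⊆-resp-↭ s e
                               _ , s″ , e″ = ⊆-resp-↭ s′ f
                           in _ , s″ , ↭-trans e′ e″

concat-⊆ : ∀ {X : Set} {xss yss : List (List X)} → xss ⊆ yss → concat xss ⊆ concat yss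
concat-⊆ [] = []
concat-⊆ (ys ∷ʳ s) = Sub.++⁺ˡ ys (concat-⊆ s)
concat-⊆ (refl ∷ s) = Sub.++⁺ ⊆-refl (concat-⊆ s)

lift : ∀ {n r} → Elem n r → V r
lift g i = + toℕ (g i)

vsum-lift : ∀ {n r} (s : Seq n r) i → vsum lift s i ≡ + ℕList.sum (map (λ g → toℕ (g i)) s)
vsum-lift []      i = refl
vsum-lift (g ∷ s) i = trans (cong (lift g i ⊕_) (vsum-lift s i)) (sym (ℤ.pos-+ (toℕ (g i)) _))

zero-sum-upper : ∀ {r F p a ps n} → Prime p → All Prime ps → (∀ {p} → p ∈ ps → Blocks.EGZ p r (p * F)) → n ≡ product ps * p ^ a →
                 ∀ (s : Seq n r) → product ps * (suc (r * p ^ a) ∸ r) + loss F ps ≤ length s → HasZeroSumSubseq n r s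
zero-sum-upper {r} {F} {p} {a} {ps} {n} pp primes egz n≡ s long =
  let Bs , R , e , len , good = chain ps primes egz lift s t long
      Cs , Cs⊆ , Cs≢[] , zero-sum = Olson.olson p pp a (div m lift) Bs (subst (λ l → r * q < l + r) (sym len) enough)
      T≢[] , T≋0 = concat-good m q lift (Sub.All-resp-⊆ Cs⊆ good) Cs≢[] zero-sum
      T , T⊆ , e′ = ⊆-resp-↭ (Sub.++⁺ʳ R (concat-⊆ Cs⊆)) (↭-sym e)
  in T , T⊆ , (λ T≡[] → T≢[] (↭-empty-inv (subst (concat Cs ↭_) T≡[] e′))) ,
     zero-sum-↭ (concat Cs) T e′ T≋0
  where
  m = product ps
  q = p ^ a
  -- Olson's value `r(q - 1) + 1` for the group of `r`-tuples modulo `q`.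
  t = suc (r * q) ∸ r
  instance
    nz-p : NonZero p
    nz-p = prime⇒nonZero pp
    nz-m : NonZero m
    nz-m = productOfPrimes≢0 primes
  zero-sum-↭ : ∀ (T T′ : Seq n r) → T ↭ T′ → Mod._≋_ (m * q) (vsum lift T) 0ᵛ → ZeroSum n r T′
  zero-sum-↭ T T′ e T≋0 i = subst (_∣ weight′ T′) (sym n≡) (subst (m * q ∣_) (trans (cong ∣_∣ (vsum-lift T i)) (sum-↭ (↭-map⁺ (λ g → toℕ (g i)) e))) (Mod.≈0⇒∣ (m * q) (T≋0 i)))
    where
    weight′ : Seq n r → ℕ
    weight′ s = ℕList.sum (map (λ g → toℕ (g i)) s)
  enough : r * q < t + r
  enough = ℕ.≤-reflexive (sym (ℕ.m∸n+n≡m (ℕ.≤-trans (ℕ.m≤m*n r q {{ℕ.m^n≢0 p a}}) (ℕ.n≤1+n (r * q)))))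

-- Prime power factors of a large integer

maximum : ∀ x xs → Σ ℕ λ m → Σ (List ℕ) λ R → (x ∷ xs) ↭ m ∷ R × All (_≤ m) R
maximum x [] = x , [] , ↭-refl , []
maximum x (y ∷ ys) with maximum y ys
... | m , R , e , max with ℕ.≤-total x m
... | inj₁ x≤m = m , x ∷ R , ↭-trans (↭-prep x e) (↭-swap x m ↭-refl) , x≤m ∷ max
... | inj₂ m≤x = x , m ∷ R , ↭-prep x e , m≤x ∷ All.map (λ y≤m → ℕ.≤-trans y≤m m≤x) max

product-const : ∀ {c xs} → All (_≡ c) xs → product xs ≡ c ^ length xs
product-const [] = refl
product-const {c} (refl ∷ es) = cong (c *_) (product-const es)

product-≤ : ∀ {c xs} → All (_≤ c) xs → product xs ≤ c ^ length xs
product-≤ [] = ℕ.≤-refl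
product-≤ (x≤c ∷ es) = ℕ.*-mono-≤ x≤c (product-≤ es)

PrimePowerSplit : ℕ → ℕ → Set
PrimePowerSplit Q₀ n = Σ ℕ λ p → Σ ℕ λ a → Σ (List ℕ) λ ps →
  Prime p × All Prime ps × n ≡ product ps * p ^ a × Q₀ ≤ p ^ a × All (_≤ p ^ a) ps

-- A largest prime factor of at least `Q₀` serves with `a = 1`. Otherwise all prime factors are
-- below `Q₀`, the size of `n` forces more than `Q₀ * Q₀` of them, and some prime occurs more than
-- `Q₀` times; the corresponding power exceeds `Q₀`, hence every prime factor.
prime-power-split : ∀ Q₀ → 2 ≤ Q₀ → ∀ n → Q₀ ^ suc (Q₀ * Q₀) ≤ n → PrimePowerSplit Q₀ n
prime-power-split Q₀ 2≤Q₀ n large = go (PF.factors F) (PF.isFactorisation F) (PF.factorsPrime F)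
  where
  module PF = PrimeFactorisation
  instance
    nz-Q₀ : NonZero Q₀
    nz-Q₀ = ℕ.>-nonZero (ℕ.≤-trans (s≤s z≤n) 2≤Q₀)
    nz-n : NonZero n
    nz-n = ℕ.>-nonZero (ℕ.≤-trans (ℕ.m^n>0 Q₀ (suc (Q₀ * Q₀))) large)
  F = factorise n

  smooth : ∀ fs → n ≡ product fs → All Prime fs → All (_< Q₀) fs → PrimePowerSplit Q₀ n
  smooth fs n≡ primes small =
    let t , B , R , e , longB , equal = pigeonhole-labels Q₀ Q₀ {P = λ x t → x ≡ toℕ t} (All.map (λ {x} x<Q₀ → fromℕ< x<Q₀ , sym (Fin.toℕ-fromℕ< x<Q₀)) small) many
        primes′ = All-resp-↭ e primes
        pp = head-prime longB equal (All.++⁻ˡ B primes′)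
        power = power-large pp longB
    in toℕ t , length B , R , pp , All.++⁻ʳ B primes′ ,
       trans n≡ (trans (product-↭ e) (trans (product-++ B R) (trans (cong (_* product R) (product-const equal)) (ℕ.*-comm (toℕ t ^ length B) (product R))))) ,
       power , All.map (λ x<Q₀ → ℕ.≤-trans (ℕ.<⇒≤ x<Q₀) power) (All.++⁻ʳ B (All-resp-↭ e small))
    where
    many : Q₀ * Q₀ < length fs
    many = ℕ.≰⇒> λ few → ℕ.<⇒≱ (ℕ.^-monoʳ-< Q₀ 2≤Q₀ (ℕ.n<1+n (Q₀ * Q₀))) (begin
      Q₀ ^ suc (Q₀ * Q₀)    ≤⟨ large ⟩
      n                     ≡⟨ n≡ ⟩
      product fs            ≤⟨ product-≤ (All.map ℕ.<⇒≤ small) ⟩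
      Q₀ ^ length fs        ≤⟨ ℕ.^-monoʳ-≤ Q₀ few ⟩
      Q₀ ^ (Q₀ * Q₀)        ∎)
      where open ℕ.≤-Reasoning
    head-prime : ∀ {c m B} → m < length B → All (_≡ c) B → All Prime B → Prime c
    head-prime _ (refl ∷ _) (pp ∷ _) = pp
    power-large : ∀ {p m} → Prime p → Q₀ < m → Q₀ ≤ p ^ m
    power-large {p} {m} pp Q₀<m = ℕ.≤-trans (ℕ.<⇒≤ Q₀<m) (ℕ.≤-trans (ℕ.n≤1+n m) (ℕ.≤-trans (suc≤2^ m) (ℕ.^-monoˡ-≤ m (ℕ.nonTrivial⇒n>1 p {{prime⇒nonTrivial pp}}))))

  go : ∀ fs → n ≡ product fs → All Prime fs → PrimePowerSplit Q₀ n
  go [] n≡1 primes = contradiction (subst (Q₀ ^ suc (Q₀ * Q₀) ≤_) n≡1 large)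
    (ℕ.<⇒≱ (ℕ.<-≤-trans 2≤Q₀ (ℕ.m≤m*n Q₀ (Q₀ ^ (Q₀ * Q₀)) {{ℕ.m^n≢0 Q₀ (Q₀ * Q₀)}})))
  go (x ∷ xs) n≡ primes with maximum x xs
  ... | p , R , e , max with All-resp-↭ e primes | ℕ.<-≤-connex p Q₀
  ... | pp ∷ primesR | inj₂ Q₀≤p = p , 1 , R , pp , primesR ,
    trans n≡ (trans (product-↭ e) (trans (ℕ.*-comm p (product R)) (cong (product R *_) (sym (ℕ.*-identityʳ p))))) ,
    subst (Q₀ ≤_) (sym (ℕ.*-identityʳ p)) Q₀≤p , subst (λ q → All (_≤ q) R) (sym (ℕ.*-identityʳ p)) max
  ... | _ | inj₁ p<Q₀ = smooth (x ∷ xs) n≡ primes (All-resp-↭ (↭-sym e) (p<Q₀ ∷ All.map (λ y≤p → ℕ.≤-<-trans y≤p p<Q₀) max))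

-- The lower bound: n - 1 copies of each basis vector

spread : ∀ {A : Set} {k} → ℕ → (Fin k → A) → List A
spread {k = zero}  N g = []
spread {k = suc k} N g = replicate N (g Fin.zero) ++ spread N (g ∘ Fin.suc)

length-spread : ∀ {A : Set} {k} N (g : Fin k → A) → length (spread N g) ≡ k * N
length-spread {k = zero}  N g = refl
length-spread {k = suc k} N g = trans (List.length-++ (replicate N (g Fin.zero))) (cong₂ _+_ (List.length-replicate N) (length-spread N (g ∘ Fin.suc)))

All-spread : ∀ {A : Set} {P : A → Set} {k} N (g : Fin k → A) → (∀ j → P (g j)) → All P (spread N g)
All-spread {k = zero}  N g Pg = []
All-spread {k = suc k} N g Pg = All.++⁺ (All.replicate⁺ N (Pg Fin.zero)) (All-spread N (g ∘ Fin.suc) (Pg ∘ Fin.suc))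

weight : ∀ {A : Set} → (A → ℕ) → List A → ℕ
weight h s = ℕList.sum (map h s)

weight-++ : ∀ {A : Set} (h : A → ℕ) s t → weight h (s ++ t) ≡ weight h s + weight h t
weight-++ h s t = trans (cong ℕList.sum (List.map-++ h s t)) (sum-++ (map h s) (map h t))

weight-replicate : ∀ {A : Set} (h : A → ℕ) N x → weight h (replicate N x) ≡ N * h x
weight-replicate h zero    x = refl
weight-replicate h (suc N) x = cong (λ t → h x + t) (weight-replicate h N x)

weight-⊆ : ∀ {A : Set} (h : A → ℕ) {s t : List A} → s ⊆ t → weight h s ≤ weight h t
weight-⊆ h [] = z≤n
weight-⊆ h (y ∷ʳ s) = ℕ.≤-trans (weight-⊆ h s) (ℕ.m≤n+m _ (h y))
weight-⊆ h (refl ∷ s) = ℕ.+-monoʳ-≤ (h _) (weight-⊆ h s)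

weight-spread : ∀ {A : Set} {k} N (h : A → ℕ) (g : Fin k → A) i → h (g i) ≤ 1 → (∀ j → j ≢ i → h (g j) ≡ 0) → weight h (spread N g) ≤ N
weight-spread {k = suc k} N h g i h≤1 h≡0 = ℕ.≤-trans (ℕ.≤-reflexive (trans (weight-++ h (replicate N (g Fin.zero)) (spread N (g ∘ Fin.suc))) (cong (_+ weight h (spread N (g ∘ Fin.suc))) (weight-replicate h N (g Fin.zero))))) (go i h≤1 h≡0)
  where
  vanish : ∀ {k} (g : Fin k → _) → (∀ j → h (g j) ≡ 0) → weight h (spread N g) ≡ 0
  vanish {zero}  g z = refl
  vanish {suc k} g z = trans (weight-++ h (replicate N (g Fin.zero)) (spread N (g ∘ Fin.suc)))
    (cong₂ _+_ (trans (weight-replicate h N (g Fin.zero)) (trans (cong (N *_) (z Fin.zero)) (ℕ.*-zeroʳ N))) (vanish (g ∘ Fin.suc) (z ∘ Fin.suc)))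
  go : ∀ i → h (g i) ≤ 1 → (∀ j → j ≢ i → h (g j) ≡ 0) → N * h (g Fin.zero) + weight h (spread N (g ∘ Fin.suc)) ≤ N
  go Fin.zero h≤1 h≡0 = ℕ.≤-trans (ℕ.+-mono-≤ (ℕ.*-monoʳ-≤ N h≤1) (ℕ.≤-reflexive (vanish (g ∘ Fin.suc) (λ j → h≡0 (Fin.suc j) (λ ()))))) (ℕ.≤-reflexive (trans (ℕ.+-identityʳ (N * 1)) (ℕ.*-identityʳ N)))
  go (Fin.suc i) h≤1 h≡0 = ℕ.≤-trans (ℕ.+-mono-≤ (ℕ.≤-reflexive (trans (cong (N *_) (h≡0 Fin.zero (λ ()))) (ℕ.*-zeroʳ N))) (weight-spread N h (g ∘ Fin.suc) i h≤1 (λ j j≢i → h≡0 (Fin.suc j) (j≢i ∘ Fin.suc-injective)))) ℕ.≤-refl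

basis : ∀ n {r} → Fin r → Elem (suc (suc n)) r
basis n j i with i Fin.≟ j
... | yes _ = Fin.suc Fin.zero
... | no  _ = Fin.zero

basis-refl : ∀ n {r} (i : Fin r) → toℕ (basis n i i) ≡ 1
basis-refl n i with i Fin.≟ i
... | yes _ = refl
... | no i≢i = contradiction refl i≢i

basis-≢ : ∀ n {r} {i j : Fin r} → j ≢ i → toℕ (basis n j i) ≡ 0
basis-≢ n {i = i} {j} j≢i with i Fin.≟ j
... | yes i≡j = contradiction (sym i≡j) j≢i
... | no _ = refl

-- A non-empty sublist contains some `j`-th basis vector. Its `j`-th coordinates then sum to at
-- least 1 and at most `suc n`, so not to a multiple of `suc (suc n)`.
zero-sum-lower : ∀ n r t → Good (suc (suc n)) r t → r * suc n < t
zero-sum-lower n r t (_ , good) = ℕ.≰⇒> λ t≤ → refute (good s (ℕ.≤-trans t≤ (ℕ.≤-reflexive (sym (length-spread (suc n) (basis n {r}))))))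
  where
  s : Seq (suc (suc n)) r
  s = spread (suc n) (basis n)
  refute : ¬ HasZeroSumSubseq (suc (suc n)) r s
  refute ([] , _ , T≢[] , _) = T≢[] refl
  refute (x ∷ T , T⊆ , _ , zero-sum) with Sub.All-resp-⊆ T⊆ (All-spread {P = λ y → Σ (Fin r) λ j → y ≡ basis n j} (suc n) (basis n) (λ j → j , refl))
  ... | (j , refl) ∷ _ = ℕ.<⇒≱ small (∣.∣⇒≤ {{ℕ.>-nonZero positive}} (zero-sum j))
    where
    h : Elem (suc (suc n)) r → ℕ
    h g = toℕ (g j)
    positive : 0 < weight h (x ∷ T)
    positive = ℕ.≤-trans (ℕ.≤-reflexive (sym (basis-refl n j))) (ℕ.m≤m+n (h x) (weight h T))
    small : weight h (x ∷ T) < suc (suc n)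
    small = s≤s (ℕ.≤-trans (weight-⊆ h T⊆) (weight-spread (suc n) h (basis n) j (ℕ.≤-reflexive (basis-refl n j)) (λ i i≢j → basis-≢ n i≢j)))

-- With denominators cleared, the quotient `D n / rn` lies within `1/(k + 1)` of 1; as `k` is
-- arbitrary, this is convergence to 1.
theorem1 : ∀ (r : ℕ) → 1 ≤ r →
    ∀ (D : ℕ → ℕ) → (∀ (n : ℕ) → 1 ≤ n → IsDavenport n r (D n)) →
    ∀ (k : ℕ) → Σ ℕ λ N → ∀ (n : ℕ) → N ≤ n →
    ((k + 1) * D n ≤ (k + 2) * (r * n)) × (k * (r * n) ≤ (k + 1) * D n)
theorem1 r 1≤r D davenport k = N , λ n N≤n →
  upper n (ℕ.≤-trans (ℕ.m≤m+n N₁ (2 + k)) N≤n) , lower n (ℕ.≤-trans (ℕ.m≤n+m (2 + k) N₁) N≤n)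
  where
  c Q₀ N₁ N : ℕ
  -- Then `F * c ≤ Q` turns the loss into `(k + 1) 2Fm ≤ mQ = n ≤ rn`.
  c = 2 * (k + 1)
  1≤c : 1 ≤ c
  1≤c = ℕ.*-mono-≤ {1} {2} (s≤s z≤n) (ℕ.m≤n+m 1 k)
  Q₀ = 2 + proj₁ (egz-uniform r c 1≤c)
  N₁ = Q₀ ^ suc (Q₀ * Q₀)
  -- The second summand serves the lower bound: it ensures `n ≥ 2` and `k ≤ n - 1`, whence
  -- `k n ≤ (k + 1)(n - 1)`.
  N = N₁ + (2 + k)
  open ℕ.≤-Reasoning

  upper : ∀ n → N₁ ≤ n → (k + 1) * D n ≤ (k + 2) * (r * n)
  upper n N₁≤n = bound (prime-power-split Q₀ (s≤s (s≤s z≤n)) n N₁≤n)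
    where
    bound : PrimePowerSplit Q₀ n → (k + 1) * D n ≤ (k + 2) * (r * n)
    bound (p , a , ps , pp , primes , n≡ , Q₀≤q , ps≤q) = finish (proj₂ (egz-uniform r c 1≤c) q (ℕ.≤-trans (ℕ.m≤n+m _ 2) Q₀≤q))
      where
      q m t : ℕ
      q = p ^ a
      m = product ps
      t = suc (r * q) ∸ r
      instance
        nz-p : NonZero p
        nz-p = prime⇒nonZero pp
      1≤n : 1 ≤ n
      1≤n = ℕ.≤-trans (ℕ.m^n>0 Q₀ (suc (Q₀ * Q₀))) N₁≤n
      1≤t : 1 ≤ t
      1≤t = ℕ.m<n⇒0<n∸m (s≤s (ℕ.m≤m*n r q {{ℕ.m^n≢0 p a}}))
      t≤rq : t ≤ r * q
      t≤rq = ℕ.∸-monoʳ-≤ (suc (r * q)) 1≤r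
      finish : (Σ ℕ λ F → F * c ≤ q × (∀ p′ → Prime p′ → p′ ≤ q → Blocks.EGZ p′ r (p′ * F))) → (k + 1) * D n ≤ (k + 2) * (r * n)
      finish (F , F*c≤q , egz) = begin
        (k + 1) * D n                           ≤⟨ ℕ.*-monoʳ-≤ (k + 1) (proj₂ (davenport n 1≤n) (m * t + loss F ps) (positive , zero-sum)) ⟩
        (k + 1) * (m * t + loss F ps)           ≤⟨ ℕ.*-monoʳ-≤ (k + 1) (ℕ.+-mono-≤ (ℕ.*-monoʳ-≤ m t≤rq) (ℕ.≤-trans (ℕ.m≤m+n (loss F ps) (2 * F)) (loss≤ F primes))) ⟩
        (k + 1) * (m * (r * q) + 2 * F * m)     ≡⟨ lem k m r q F ⟩
        (k + 1) * (r * (m * q)) + F * c * m     ≤⟨ ℕ.+-monoʳ-≤ ((k + 1) * (r * (m * q))) (ℕ.≤-trans (ℕ.*-monoˡ-≤ m F*c≤q) (ℕ.≤-reflexive (ℕ.*-comm q m))) ⟩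
        (k + 1) * (r * (m * q)) + m * q         ≤⟨ ℕ.+-monoʳ-≤ ((k + 1) * (r * (m * q))) (ℕ.m≤n*m (m * q) r {{ℕ.>-nonZero 1≤r}}) ⟩
        (k + 1) * (r * (m * q)) + r * (m * q)   ≡⟨ lem′ k (r * (m * q)) ⟩
        (k + 2) * (r * (m * q))                 ≡⟨ cong (λ x → (k + 2) * (r * x)) (sym n≡) ⟩
        (k + 2) * (r * n)                       ∎
        where
        lem : ∀ k m r q F → (k + 1) * (m * (r * q) + 2 * F * m) ≡ (k + 1) * (r * (m * q)) + F * (2 * (k + 1)) * m
        lem = ℕ-Ring.solve-∀
        lem′ : ∀ k x → (k + 1) * x + x ≡ (k + 2) * x
        lem′ = ℕ-Ring.solve-∀
        positive : 1 ≤ m * t + loss F ps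
        positive = ℕ.≤-trans (ℕ.*-mono-≤ (productOfPrimes≥1 primes) 1≤t) (ℕ.m≤m+n (m * t) (loss F ps))
        zero-sum : ∀ (s : Seq n r) → m * t + loss F ps ≤ length s → HasZeroSumSubseq n r s
        zero-sum = zero-sum-upper {F = F} {p} {a} {ps} pp primes
          (λ {p′} p′∈ → egz p′ (All.lookup primes p′∈) (All.lookup ps≤q p′∈)) n≡

  lower : ∀ n → 2 + k ≤ n → k * (r * n) ≤ (k + 1) * D n
  lower (suc (suc n)) (s≤s (s≤s k≤n)) = begin
    k * (r * (2 + n))                    ≡⟨ lem k r n ⟩
    k * r * (1 + n) + r * k              ≤⟨ ℕ.+-monoʳ-≤ (k * r * (1 + n)) (ℕ.*-monoʳ-≤ r (ℕ.≤-trans k≤n (ℕ.n≤1+n n))) ⟩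
    k * r * (1 + n) + r * (1 + n)        ≡⟨ lem′ k r n ⟩
    (k + 1) * (r * (1 + n))              ≤⟨ ℕ.*-monoʳ-≤ (k + 1) (ℕ.<⇒≤ (zero-sum-lower n r (D (2 + n)) (proj₁ (davenport (2 + n) (s≤s z≤n))))) ⟩
    (k + 1) * D (2 + n)                  ∎
    where
    lem : ∀ k r n → k * (r * (2 + n)) ≡ k * r * (1 + n) + r * k
    lem = ℕ-Ring.solve-∀
    lem′ : ∀ k r n → k * r * (1 + n) + r * (1 + n) ≡ (k + 1) * (r * (1 + n))
    lem′ = ℕ-Ring.solve-∀
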